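{- For all integers $n,k,d\ge 1$, \[ \mathcal L^{S_n^{k-1}}_{\mathsf{TC}}(\textsc{Word}_{S_n,k})\ \ge\ n^{\log_2 k},\qquad \mathcal L^{S_n^{k-1}}_{\mathsf{TC}_d}(\textsc{Word}_{S_n,k})\ \ge\ n^{d(k^{1/d}-1)}. \]
   Context: Word problem. For a permutation group $G\le S_n$, let $\overline G$ be the set of $n\times n$ permutation matrices of elements of $G$. View $\overline G^k$ as a subset of $\{0,1\}^{kn^2}$, with Boolean variables $M_{i,a,b}$ ($i\in[k]$, $a,b\in[n]$) giving entry $(a,b)$ of the $i$-th matrix. $\textsc{Word}_{G,k}:\overline G^k\to\{0,1\}$ outputs the $(1,1)$-entry of the product $M_1M_2\cdots M_k$. The group $G^{k-1}$ acts on the variables by $(g_1,\dots,g_{k-1})\cdot M_{i,a,b}=M_{i,g_{i-1}(a),g_i(b)}$, where $g_0=g_k=1$; on matrix tuples this is $(M_1,\dots,M_k)\mapsto(M_1\overline{g_1}^{ -1},\overline{g_1}M_2\overline{g_2}^{ -1},\dots,\overline{g_{k-2}}M_{k-1}\overline{g_{k-1}}^{ -1},\overline{g_{k-1}}M_k)$. Since the action is faithful, $G^{k-1}$ is viewed as a subgroup of $S_{kn^2}$. Formulas. An $m$-variable $\mathsf{TC}$ formula is a finite rooted tree, with the children of each node forming an unordered multiset. Each leaf is labeled by one of $0,1,x_1,\neg x_1,\dots,x_m,\neg x_m$, and each internal node (gate) is labeled $\textsc{maj}$ with unbounded fan-in; $\textsc{maj}$ outputs the majority of its inputs. An $\mathsf{AC}$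 formula is the same with gates labeled $\textsc{and}$ or $\textsc{or}$ (unbounded fan-in). Formulas are considered up to isomorphism of labeled rooted trees. The depth is the maximum number of gates on a leaf-to-root path. The size is the number of leaves labeled by literals. $S_m$ acts on formulas by relabeling $x_i\mapsto x_{\pi(i)}$ and $\neg x_i\mapsto\neg x_{\pi(i)}$. For $P\le S_m$, a formula $\Phi$ is $P$-invariant if $\pi\Phi=\Phi$ (as labeled trees) for all $\pi\in P$. A formula computes a partial function $f:\Omega\to\{0,1\}$ ($\Omega\subseteq\{0,1\}^m$) if it agrees with $f$ on $\Omega$. $\mathcal L^P_{\mathsf{TC}_d}(f)$ (resp. $\mathcal L^P_{\mathsf{TC}}(f)$) is the minimum size of a $P$-invariant $\mathsf{TC}$ formula of depth at most $d$ (resp. of any depth) computing $f$. $\mathcal L^P_{\mathsf{AC}_d}$ and $\mathcal L^P_{\mathsf{AC}}$ are defined analogously.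
   Formalization: The formal theorem assumes n ≥ 2: for n = 1 the stated bounds fail, since the constant formula 1 is invariant, computes the word problem and has size 0, while both lower bounds equal 1. -}

module Defs where

open import Level using (0ℓ)
open import Data.Bool.Base using (Bool; not; if_then_else_)
open import Data.Fin.Base using (Fin; zero; suc; toℕ; fromℕ<)
import Data.Fin.Properties as Fin
open import Data.Fin.Permutation as Perm
  using (Permutation; Permutation′; _⟨$⟩ʳ_; _⟨$⟩ˡ_)
open import Data.Nat.Base
  using (ℕ; zero; suc; _+_; _*_; _∸_; _^_; _⊔_; _≤_; _≤ᵇ_; _≡ᵇ_; NonZero)
open import Data.Nat.Properties using (+-0-monoid; _<?_; m*n≢0)
open import Algebra.Properties.Monoid.Sum +-0-monoid using (sum; sum-syntax)
open import Data.Product using (∃; _×_; _,_)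
open import Data.Vec.Functional using (Vector; foldr)
open import Function.Bundles using (_↔_; mk↔ₛ′; Inverse)
open import Relation.Binary.PropositionalEquality using (_≡_; cong₂; cong)
open import Relation.Nullary using (does; yes; no)
open import Relation.Unary using (Pred; _∈_)

bit : Bool → ℕ
bit b = if b then 1 else 0

------------------------------------------------------------------------
-- TC formulas over a set X of variables

data Label (X : Set) : Set where
  const : Bool → Label X
  pos   : X → Label X
  neg   : X → Label X

-- The order of the children is forgotten by _≅_ below; the fan-in suc r
-- is unbounded but positive, since a node without children is a leaf.
data Formula (X : Set) : Set where
  leaf : Label X → Formula X
  maj  : ∀ {r} → Vector (Formula X) (suc r) → Formula X

infix 4 _≅_

-- Isomorphism of labelled rooted (unordered) trees.
data _≅_ {X : Set} : Formula X → Formula X → Set where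
  leaf : ∀ {l} → leaf l ≅ leaf l
  maj  : ∀ {r s} {Φ : Vector (Formula X) (suc r)}
           {Ψ : Vector (Formula X) (suc s)}
         (σ : Permutation (suc r) (suc s)) →
         (∀ i → Φ i ≅ Ψ (σ ⟨$⟩ʳ i)) →
         maj Φ ≅ maj Ψ

module _ {X : Set} where

  evalLabel : (X → Bool) → Label X → Bool
  evalLabel x (const b) = b
  evalLabel x (pos v)   = x v
  evalLabel x (neg v)   = not (x v)

  -- A tie counts as a majority. Using strict majority instead changes no
  -- size or depth bound: the two differ by one extra constant input, and
  -- constants do not contribute to the size.
  eval : (X → Bool) → Formula X → Bool
  eval x (leaf l)    = evalLabel x l
  eval x (maj {r} Φ) = suc r ≤ᵇ 2 * sum (λ i → bit (eval x (Φ i)))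

  depth : Formula X → ℕ
  depth (leaf _) = 0
  depth (maj Φ)  = suc (foldr _⊔_ 0 (λ i → depth (Φ i)))

  size : Formula X → ℕ
  size (leaf (const _)) = 0
  size (leaf (pos _))   = 1
  size (leaf (neg _))   = 1
  size (maj Φ)          = sum (λ i → size (Φ i))

  relabelLabel : (X → X) → Label X → Label X
  relabelLabel f (const b) = const b
  relabelLabel f (pos v)   = pos (f v)
  relabelLabel f (neg v)   = neg (f v)

  relabel : (X → X) → Formula X → Formula X
  relabel f (leaf l) = leaf (relabelLabel f l)
  relabel f (maj Φ)  = maj (λ i → relabel f (Φ i))

  Invariant : Pred (X ↔ X) 0ℓ → Formula X → Set
  Invariant P Φ = ∀ π → π ∈ P → relabel (Inverse.to π) Φ ≅ Φ

record PartialFunction (X : Set) : Set₁ where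
  field
    Domain : Pred (X → Bool) 0ℓ
    value  : ∀ x → x ∈ Domain → Bool

Computes : ∀ {X} → Formula X → PartialFunction X → Set
Computes Φ f = ∀ x (x∈Ω : x ∈ Domain) → eval x Φ ≡ value x x∈Ω
  where open PartialFunction f

-- The sets of sizes whose minima (∞ if the set is empty) are the
-- complexities 𝓛^P_TC(f) and 𝓛^P_TC_d(f).
TCSizes : ∀ {X} → Pred (X ↔ X) 0ℓ → PartialFunction X → Pred ℕ 0ℓ
TCSizes P f s = ∃ λ Φ → Invariant P Φ × Computes Φ f × size Φ ≡ s

TCSizes[depth≤_] : ∀ {X} → ℕ → Pred (X ↔ X) 0ℓ → PartialFunction X → Pred ℕ 0ℓ
TCSizes[depth≤ d ] P f s =
  ∃ λ Φ → depth Φ ≤ d × Invariant P Φ × Computes Φ f × size Φ ≡ s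

------------------------------------------------------------------------
-- The word problem for Sₙ

-- The variable M_{i,a,b} is (i , a , b), with all indices counted from 0.
Var : ℕ → ℕ → Set
Var n k = Fin k × Fin n × Fin n

Matrix : ℕ → Set
Matrix n = Fin n → Fin n → ℕ

identity : ∀ {n} → Matrix n
identity a b = bit (does (a Fin.≟ b))

infixl 7 _·_

_·_ : ∀ {n} → Matrix n → Matrix n → Matrix n
_·_ {n} M N a b = ∑[ c < n ] (M a c * N c b)

matrixProduct : ∀ {n k} → Vector (Matrix n) k → Matrix n
matrixProduct = foldr _·_ identity

-- Column b of the matrix of π is the standard basis vector at π(b), so that
-- π ↦ permMatrix π is multiplicative and relabelling the variables by
-- M_{a,b} ↦ M_{g(a),h(b)} corresponds to M ↦ ḡ M h̄⁻¹.
permMatrix : ∀ {n} → Permutation′ n → Fin n → Fin n → Bool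
permMatrix π a b = does (a Fin.≟ (π ⟨$⟩ʳ b))

first : ∀ n .{{_ : NonZero n}} → Fin n
first (suc n) = zero

Word : ∀ n k .{{_ : NonZero n}} → PartialFunction (Var n k)
Word n k = record
  { Domain = λ x → ∃ λ (π : Vector (Permutation′ n) k) →
               ∀ i a b → x (i , a , b) ≡ permMatrix (π i) a b
  ; value  = λ x _ →
               matrixProduct (λ i a b → bit (x (i , a , b))) (first n) (first n)
                 ≡ᵇ 1
  }

-- pad (g₁ , … , g_{k-1}) is the sequence g₀ , g₁ , … , g_k with g₀ = g_k = 1.
pad : ∀ {n m} → Vector (Permutation′ n) m → ℕ → Permutation′ n
pad g zero = Perm.id
pad {m = m} g (suc j) with j <? m
... | yes j<m = g (fromℕ< j<m)
... | no  _   = Perm.id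

act : ∀ {n k} → Vector (Permutation′ n) (k ∸ 1) → Var n k ↔ Var n k
act g = mk↔ₛ′
  (λ (i , a , b) → i , (row i ⟨$⟩ʳ a) , (col i ⟨$⟩ʳ b))
  (λ (i , a , b) → i , (row i ⟨$⟩ˡ a) , (col i ⟨$⟩ˡ b))
  (λ (i , a , b) → cong (i ,_) (cong₂ _,_ (Perm.inverseʳ (row i)) (Perm.inverseʳ (col i))))
  (λ (i , a , b) → cong (i ,_) (cong₂ _,_ (Perm.inverseˡ (row i)) (Perm.inverseˡ (col i))))
  where
  row col : Fin _ → Permutation′ _
  row i = pad g (toℕ i)
  col i = pad g (suc (toℕ i))

-- Sₙ^{k-1} as a group of permutations of the variables.
WordSymmetry : ∀ n k → Pred (Var n k ↔ Var n k) 0ℓ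
WordSymmetry n k π = ∃ λ g → ∀ v → Inverse.to π v ≡ Inverse.to (act g) v

------------------------------------------------------------------------
-- Real exponents

-- A real α ≥ 0 is represented by its lower cut in the nonnegative rationals:
-- α p q stands for p / q ≤ α.
LowerCut : Set₁
LowerCut = (p q : ℕ) .{{_ : NonZero q}} → Set

-- p / q ≤ log₂ k  ⇔  2^p ≤ k^q
log₂ : ℕ → LowerCut
log₂ k p q = 2 ^ p ≤ k ^ q

-- p / q ≤ k^(1/d)  ⇔  p^d ≤ k q^d
root : ℕ → ℕ → LowerCut
root d k p q = p ^ d ≤ k * q ^ d

-- For α ≥ 1:  p / q ≤ d (α - 1)  ⇔  (p + q d) / (q d) ≤ α
_⊛[_∸1] : (d : ℕ) .{{_ : NonZero d}} → LowerCut → LowerCut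
(d ⊛[ α ∸1]) p q = α (p + q * d) (q * d)
  where instance _ = m*n≢0 q d

-- For n ≥ 1, n^α is the supremum of n^(p/q) over the rationals p / q ≤ α.
-- Hence "min S ≥ n^α" says that n^p ≤ s^q for all s ∈ S and all such p / q.
infix 4 min_≥_^ʳ_

min_≥_^ʳ_ : Pred ℕ 0ℓ → ℕ → LowerCut → Set
min S ≥ n ^ʳ α =
  ∀ s → s ∈ S → ∀ p q .{{_ : NonZero q}} → α p q → n ^ p ≤ s ^ q

-- Walk down an invariant formula from the root to a literal, always passing
-- to a subformula which distinguishes two inputs differing by a suitable
-- move. The stabiliser of a gate permutes its children, and if every child
-- ignored a translate of the given move, the gate would see equal numbers of
-- true children. If the stabiliser of the chosen child loses rank t, then the
-- move, modulo the stabiliser, still involves a fraction 1/(t + 1) of the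
-- matrices. A literal involves only one matrix, so Π (t + 1) ≥ k along the
-- path, while its orbit has at least n^(Σ t) elements, because a subgroup of
-- rank T in S_n^(k-1) has index at least n^T. The two bounds follow from
-- 2^t ≥ t + 1 and from AM-GM.
--
-- For n ≥ 5, the rank counts the coordinates at which the subgroup does not
-- contain all 3-cycles, and moves multiply one matrix by a 3-cycle. For
-- n = 2, 3, 4, the translations of the field with n elements form a normal
-- subgroup of S_n, and the rank is the codimension of the largest linear
-- subspace of translations contained in the subgroup.

module Submission where

open import Defs
open import Algebra.Bundles using (CommutativeRing)
import Algebra.Solver.Ring.NaturalCoefficients.Default
open import Algebra.Structures using (IsCommutativeRing)
open import Data.Bool.Base using (Bool; true; false; not)
open import Data.Bool.Properties using () renaming (_≟_ to _≟ᵇ_)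
open import Data.Empty using (⊥)
open import Data.Fin.Base as Fin using (Fin; zero; suc; toℕ; fromℕ<)
open import Data.Fin.Permutation as Perm
  using (Permutation; Permutation′; _⟨$⟩ʳ_; _⟨$⟩ˡ_; _≈_)
import Data.Fin.Properties as Fin
open import Data.List.Base as List using (List; []; _∷_; length; filter)
open import Data.List.Membership.Propositional using (_∈_; _∉_)
open import Data.List.Membership.Propositional.Properties using (∈-allFin)
open import Data.List.Properties using (length-++; length-map; length-replicate; length-tabulate)
open import Data.List.Relation.Unary.All as All using (All; []; _∷_)
import Data.List.Relation.Unary.All.Properties as All
open import Data.List.Relation.Unary.AllPairs as AllPairs using (AllPairs; []; _∷_)
import Data.List.Relation.Unary.AllPairs.Properties as AllPairs
open import Data.List.Relation.Unary.Any as Any using (Any; here; there)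
open import Data.List.Relation.Unary.Any.Properties using (lookup-index)
open import Data.Nat.Base
open import Data.Nat.DivMod using (_/_; _%_; m≡m%n+[m/n]*n; m%n<n)
open import Data.Nat.ListAction using (product) renaming (sum to listSum)
open import Data.Nat.ListAction.Properties using (sum-++; product-++)
open import Data.Nat.Properties
open import Data.Nat.Tactic.RingSolver using (solve-∀)
open import Algebra.Properties.CommutativeMonoid.Sum +-0-commutativeMonoid
  using (sum; sum-cong-≗; sum-permute; sum-replicate-zero; ∑-distrib-+)
open import Data.Product using (Σ; ∃; ∃₂; _×_; _,_; proj₁; proj₂; map₂)
open import Data.Sum using (_⊎_; inj₁; inj₂)
open import Data.Unit using (⊤; tt)
open import Data.Vec.Base as DVec using (Vec; []; _∷_; lookup)
open import Data.Vec.Functional as Vec using (Vector)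
open import Function.Base using (_∘_; id)
open import Function.Bundles using (Inverse)
open import Function.Definitions using (Injective)
open import Relation.Binary.Definitions using (tri<; tri≈; tri>)
open import Relation.Binary.PropositionalEquality
  using (_≡_; _≢_; _≗_; refl; sym; trans; cong; cong₂; subst; subst₂; module ≡-Reasoning)
open import Relation.Binary.PropositionalEquality.Properties using (isEquivalence)
open import Relation.Nullary using (¬_; Dec; yes; no; does; contradiction)
open import Relation.Nullary.Decidable
  using (True; toWitness; map′; ¬?; _×-dec_; _⊎-dec_; _→-dec_; ¬¬-excluded-middle; decidable-stable)

-- Three obstacles shape the details. Different children of a gate may need different translates of
-- the move. Each child gets the least one, which is constant on the orbits of the shifts, so that
-- the shifts glue to a single permutation of the children.
--
-- Counting coordinates works for n ≥ 5 because commutators split a subgroup with enough 3-cycles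
-- into its coordinates. For n ≤ 4 a hyperplane of translations has index only n among them and can
-- still avoid every coordinate axis, so codimension replaces the count. For n = 4 a further loss
-- occurs: the translations in a subgroup are closed under addition but not under multiplication by
-- field elements. The factor lost by keeping only a linear subspace is regained from the cosets
-- modulo all translations.
--
-- Membership in a stabiliser is never decided. Case distinctions on it happen under double
-- negation, which is removed at the end because `n ^ p ≤ s ^ q` is decidable.

private variable
  n m : ℕ

-- Double negation

infixl 1 _>>=_

_>>=_ : ∀ {A B : Set} → ¬ ¬ A → (A → ¬ ¬ B) → ¬ ¬ B
(¬¬a >>= f) ¬b = ¬¬a λ a → f a ¬b

pure : ∀ {A : Set} → A → ¬ ¬ A
pure a ¬a = ¬a a

¬¬-Fin : ∀ {r} {P : Fin r → Set} → (∀ i → ¬ ¬ P i) → ¬ ¬ (∀ i → P i)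
¬¬-Fin {zero}  p = pure λ ()
¬¬-Fin {suc r} p = p zero >>= λ p₀ → ¬¬-Fin (p ∘ suc) >>= λ ps →
  pure λ { zero → p₀ ; (suc i) → ps i }

-- Permutations, composed as functions

infixl 7 _⊙_

_⊙_ : Permutation′ n → Permutation′ n → Permutation′ n
π ⊙ ρ = ρ Perm.∘ₚ π

_⁻ : Permutation′ n → Permutation′ n
π ⁻ = Perm.flip π

infix 10 _⁻

perm-injective : ∀ (π : Permutation′ n) {x y} → π ⟨$⟩ʳ x ≡ π ⟨$⟩ʳ y → x ≡ y
perm-injective π {x} {y} eq =
  trans (sym (Perm.inverseˡ π)) (trans (cong (π ⟨$⟩ˡ_) eq) (Perm.inverseˡ π))

perm-injectiveˡ : ∀ (π : Permutation′ n) {x y} → π ⟨$⟩ˡ x ≡ π ⟨$⟩ˡ y → x ≡ y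
perm-injectiveˡ π {x} {y} eq =
  trans (sym (Perm.inverseʳ π)) (trans (cong (π ⟨$⟩ʳ_) eq) (Perm.inverseʳ π))

≈⇒≈ˡ : ∀ (π ρ : Permutation′ n) → π ≈ ρ → ∀ x → π ⟨$⟩ˡ x ≡ ρ ⟨$⟩ˡ x
≈⇒≈ˡ π ρ π≈ρ x = perm-injective π
  (trans (Perm.inverseʳ π) (trans (sym (Perm.inverseʳ ρ)) (sym (π≈ρ _))))

-- Tuples of permutations

Tuple : ℕ → ℕ → Set
Tuple n m = Vector (Permutation′ n) m

infix 4 _≋_

_≋_ : Tuple n m → Tuple n m → Set
g ≋ h = ∀ j → g j ≈ h j

ε : Tuple n m
ε _ = Perm.id

infixl 7 _∙_

_∙_ : Tuple n m → Tuple n m → Tuple n m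
(g ∙ h) j = g j ⊙ h j

inv : Tuple n m → Tuple n m
inv g j = g j ⁻

record Subgroup (n m : ℕ) : Set₁ where
  field
    mem  : Tuple n m → Set
    resp : ∀ {g h} → g ≋ h → mem g → mem h
    mem-ε : mem ε
    mem-∙ : ∀ {g h} → mem g → mem h → mem (g ∙ h)
    mem-inv : ∀ {g} → mem g → mem (inv g)

open Subgroup public

full : Subgroup n m
full = record { mem = λ _ → ⊤ ; resp = λ _ _ → tt ; mem-ε = tt ; mem-∙ = λ _ _ → tt ; mem-inv = λ _ → tt }

-- Says that the left cosets of `g` and `h` differ. `Index≥` asks only for representatives of some
-- distinct cosets, which is all that the leaf count uses.
Apart : Subgroup n m → Tuple n m → Tuple n m → Set
Apart U g h = ¬ mem U (inv g ∙ h)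

Index≥ : Subgroup n m → ℕ → Set
Index≥ U N = ∃ λ xs → N ≤ length xs × AllPairs (Apart U) xs

pad-cong : ∀ {g h : Tuple n m} → g ≋ h → ∀ p → pad g p ≈ pad h p
pad-cong g≋h zero x = refl
pad-cong {m = m} g≋h (suc p) x with p <? m
... | yes p<m = g≋h _ x
... | no  _   = refl

pad-∙ : ∀ (g h : Tuple n m) p → pad (g ∙ h) p ≈ pad g p ⊙ pad h p
pad-∙ g h zero x = refl
pad-∙ {m = m} g h (suc p) x with p <? m
... | yes _ = refl
... | no  _ = refl

pad-ε : ∀ p → pad (ε {n} {m}) p ≈ Perm.id
pad-ε zero x = refl
pad-ε {m = m} (suc p) x with p <? m
... | yes _ = refl
... | no  _ = refl

pad-suc : ∀ (g : Tuple n m) (j : Fin m) → pad g (suc (toℕ j)) ≡ g j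
pad-suc {m = m} g j with toℕ j <? m
... | yes p = cong g (Fin.fromℕ<-toℕ j p)
... | no ¬p = contradiction (Fin.toℕ<n j) ¬p

-- Isomorphism of formulas

module _ {X : Set} where

  ≅-refl : ∀ {Φ : Formula X} → Φ ≅ Φ
  ≅-refl {leaf l} = leaf
  ≅-refl {maj Φ}  = maj Perm.id λ i → ≅-refl

  ≅-trans : ∀ {Φ Ψ Θ : Formula X} → Φ ≅ Ψ → Ψ ≅ Θ → Φ ≅ Θ
  ≅-trans leaf leaf = leaf
  ≅-trans (maj σ p) (maj τ q) = maj (σ Perm.∘ₚ τ) λ i → ≅-trans (p i) (q _)

  ≅-sym : ∀ {Φ Ψ : Formula X} → Φ ≅ Ψ → Ψ ≅ Φ
  ≅-sym leaf = leaf
  ≅-sym {maj Φ} {maj Ψ} (maj σ p) = maj (Perm.flip σ) λ i →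
    ≅-sym (subst (λ j → Φ (σ ⟨$⟩ˡ i) ≅ Ψ j) (Perm.inverseʳ σ) (p (σ ⟨$⟩ˡ i)))

  relabelLabel-cong : ∀ {f g : X → X} → f ≗ g → ∀ l → relabelLabel f l ≡ relabelLabel g l
  relabelLabel-cong f≗g (const b) = refl
  relabelLabel-cong f≗g (pos v)   = cong pos (f≗g v)
  relabelLabel-cong f≗g (neg v)   = cong neg (f≗g v)

  leaf-≅ : ∀ {l l′ : Label X} → l ≡ l′ → leaf l ≅ leaf l′
  leaf-≅ refl = leaf

  relabel-cong : ∀ {f g : X → X} → f ≗ g → ∀ Φ → relabel f Φ ≅ relabel g Φ
  relabel-cong f≗g (leaf l) = leaf-≅ (relabelLabel-cong f≗g l)
  relabel-cong f≗g (maj Φ)  = maj Perm.id λ i → relabel-cong f≗g (Φ i)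

  relabel-≅ : ∀ (f : X → X) {Φ Ψ} → Φ ≅ Ψ → relabel f Φ ≅ relabel f Ψ
  relabel-≅ f leaf      = leaf
  relabel-≅ f (maj σ p) = maj σ λ i → relabel-≅ f (p i)

  relabel-id : ∀ {f : X → X} → f ≗ id → ∀ Φ → relabel f Φ ≅ Φ
  relabel-id f≗id (leaf (const b)) = leaf
  relabel-id f≗id (leaf (pos v))   = leaf-≅ (cong pos (f≗id v))
  relabel-id f≗id (leaf (neg v))   = leaf-≅ (cong neg (f≗id v))
  relabel-id f≗id (maj Φ)          = maj Perm.id λ i → relabel-id f≗id (Φ i)

  relabel-∘ : ∀ (f g : X → X) Φ → relabel f (relabel g Φ) ≅ relabel (f ∘ g) Φ
  relabel-∘ f g (leaf (const b)) = leaf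
  relabel-∘ f g (leaf (pos v))   = leaf
  relabel-∘ f g (leaf (neg v))   = leaf
  relabel-∘ f g (maj Φ)          = maj Perm.id λ i → relabel-∘ f g (Φ i)

  evalLabel-cong : ∀ {x y : X → Bool} → x ≗ y → ∀ l → evalLabel x l ≡ evalLabel y l
  evalLabel-cong x≗y (const b) = refl
  evalLabel-cong x≗y (pos v)   = x≗y v
  evalLabel-cong x≗y (neg v)   = cong not (x≗y v)

  eval-cong : ∀ {x y : X → Bool} → x ≗ y → ∀ Φ → eval x Φ ≡ eval y Φ
  eval-cong x≗y (leaf l) = evalLabel-cong x≗y l
  eval-cong x≗y (maj {r} Φ) =
    cong (λ s → suc r ≤ᵇ 2 * s) (sum-cong-≗ λ i → cong bit (eval-cong x≗y (Φ i)))

  eval-relabel : ∀ (x : X → Bool) f Φ → eval x (relabel f Φ) ≡ eval (x ∘ f) Φ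
  eval-relabel x f (leaf (const b)) = refl
  eval-relabel x f (leaf (pos v))   = refl
  eval-relabel x f (leaf (neg v))   = refl
  eval-relabel x f (maj {r} Φ) =
    cong (λ s → suc r ≤ᵇ 2 * s) (sum-cong-≗ λ i → cong bit (eval-relabel x f (Φ i)))

  eval-≅ : ∀ (x : X → Bool) {Φ Ψ} → Φ ≅ Ψ → eval x Φ ≡ eval x Ψ
  eval-≅ x leaf = refl
  eval-≅ x {maj {r} Φ} {maj {s} Ψ} (maj σ p) =
    cong₂ (λ a b → a ≤ᵇ 2 * b) (Perm.↔⇒≡ σ)
      (trans (sum-cong-≗ λ i → cong bit (eval-≅ x (p i)))
             (sym (sum-permute (λ i → bit (eval x (Ψ i))) σ)))

-- The action on formulas and inputs of the word problem

infixr 8 _★_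

_★_ : Tuple n m → Formula (Var n (suc m)) → Formula (Var n (suc m))
g ★ Φ = relabel (Inverse.to (act {k = suc _} g)) Φ

act-cong : ∀ {g h : Tuple n m} → g ≋ h →
           Inverse.to (act {k = suc m} g) ≗ Inverse.to (act {k = suc m} h)
act-cong g≋h (i , a , b) =
  cong (i ,_) (cong₂ _,_ (pad-cong g≋h (toℕ i) a) (pad-cong g≋h (suc (toℕ i)) b))

act-∙ : ∀ (g h : Tuple n m) →
        Inverse.to (act {k = suc m} (g ∙ h)) ≗
        Inverse.to (act {k = suc m} g) ∘ Inverse.to (act {k = suc m} h)
act-∙ g h (i , a , b) =
  cong (i ,_) (cong₂ _,_ (pad-∙ g h (toℕ i) a) (pad-∙ g h (suc (toℕ i)) b))

act-ε : ∀ {n m} → Inverse.to (act {k = suc m} (ε {n} {m})) ≗ id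
act-ε {n} {m} (i , a , b) =
  cong (i ,_) (cong₂ _,_ (pad-ε {n} {m} (toℕ i) a) (pad-ε {n} {m} (suc (toℕ i)) b))

★-cong : ∀ {g h : Tuple n m} → g ≋ h → ∀ Φ → g ★ Φ ≅ h ★ Φ
★-cong g≋h = relabel-cong (act-cong g≋h)

★-∙ : ∀ (g h : Tuple n m) Φ → g ★ h ★ Φ ≅ (g ∙ h) ★ Φ
★-∙ g h Φ = ≅-trans (relabel-∘ _ _ Φ) (relabel-cong (λ v → sym (act-∙ g h v)) Φ)

★-ε : ∀ (Φ : Formula (Var n (suc m))) → ε ★ Φ ≅ Φ
★-ε = relabel-id act-ε

★-inv : ∀ (g : Tuple n m) {Φ Ψ} → g ★ Φ ≅ Ψ → inv g ★ Ψ ≅ Φ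
★-inv g {Φ} p =
  ≅-trans (relabel-≅ _ (≅-sym p))
  (≅-trans (★-∙ (inv g) g Φ)
  (≅-trans (★-cong (λ j x → Perm.inverseˡ (g j)) Φ) (★-ε Φ)))

★-trans : ∀ (g h : Tuple n m) {Φ Ψ Θ} → h ★ Φ ≅ Ψ → g ★ Ψ ≅ Θ → (g ∙ h) ★ Φ ≅ Θ
★-trans g h p q = ≅-trans (≅-sym (★-∙ g h _)) (≅-trans (relabel-≅ _ p) q)

stabiliser : Subgroup n m → Formula (Var n (suc m)) → Subgroup n m
stabiliser U Φ = record
  { mem     = λ g → mem U g × g ★ Φ ≅ Φ
  ; resp    = λ g≋h (u , p) → resp U g≋h u , ≅-trans (★-cong (λ j x → sym (g≋h j x)) Φ) p
  ; mem-ε   = mem-ε U , ★-ε Φ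
  ; mem-∙   = λ {g} {h} (u , p) (v , q) → mem-∙ U u v , ★-trans g h q p
  ; mem-inv = λ {g} (u , p) → mem-inv U u , ★-inv g p
  }

input : Tuple n (suc m) → Var n (suc m) → Bool
input M (i , a , b) = permMatrix (M i) a b

infixr 8 _▷_

-- The inverse of the action on matrix tuples, since relabelling a formula amounts to precomposing
-- its input. Hence a right action: `g ∙ h` acts as `g` followed by `h`.
_▷_ : Tuple n m → Tuple n (suc m) → Tuple n (suc m)
(g ▷ M) i = pad g (toℕ i) ⁻ ⊙ M i ⊙ pad g (suc (toℕ i))

does-≡ : ∀ {A B : Set} (p : Dec A) (q : Dec B) → (A → B) → (B → A) → does p ≡ does q
does-≡ (yes a) (yes b) f g = refl
does-≡ (yes a) (no ¬b) f g = contradiction (f a) ¬b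
does-≡ (no ¬a) (yes b) f g = contradiction (g b) ¬a
does-≡ (no ¬a) (no ¬b) f g = refl

input-▷ : ∀ (g : Tuple n m) M → input M ∘ Inverse.to (act {k = suc m} g) ≗ input (g ▷ M)
input-▷ g M (i , a , b) = does-≡ (_ Fin.≟ _) (_ Fin.≟ _)
  (λ eq → trans (sym (Perm.inverseˡ π)) (cong (π ⟨$⟩ˡ_) eq))
  (λ eq → trans (cong (π ⟨$⟩ʳ_) eq) (Perm.inverseʳ π))
  where π = pad g (toℕ i)

value-at : Formula (Var n (suc m)) → Tuple n (suc m) → Bool
value-at Φ M = eval (input M) Φ

value-at-▷ : ∀ (g : Tuple n m) {Φ Ψ} → g ★ Φ ≅ Ψ → ∀ M → value-at Ψ M ≡ value-at Φ (g ▷ M)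
value-at-▷ g {Φ} p M =
  trans (sym (eval-≅ (input M) p))
  (trans (eval-relabel (input M) _ Φ) (eval-cong (input-▷ g M) Φ))

-- Counting leaves

data Path {X : Set} : Formula X → Set where
  leaf  : ∀ {l} → size (leaf l) ≡ 1 → Path (leaf l)
  child : ∀ {r} {Φ : Vector (Formula X) (suc r)} c → Path (Φ c) → Path (maj Φ)

-- Concerns the isomorphism types of the subformulas on the path and not their positions, as a
-- relabelling may carry a child to an isomorphic sibling.
Fixes : ∀ {Φ : Formula (Var n (suc m))} → Path Φ → Tuple n m → Set
Fixes {Φ = Φ} (leaf _)    g = g ★ Φ ≅ Φ
Fixes {Φ = Φ} (child c p) g = g ★ Φ ≅ Φ × Fixes p g

sum-δ : ∀ {r} (i : Fin r) (f : Fin r → ℕ) → sum (λ j → bit (does (i Fin.≟ j)) * f j) ≡ f i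
sum-δ {suc r} zero f =
  trans (cong₂ _+_ (*-identityˡ (f zero)) (sum-replicate-zero r)) (+-identityʳ (f zero))
sum-δ {suc r} (suc i) f = sum-δ i (f ∘ suc)

sum-mono : ∀ {r} {f g : Fin r → ℕ} → (∀ i → f i ≤ g i) → sum f ≤ sum g
sum-mono {zero}  f≤g = z≤n
sum-mono {suc r} f≤g = +-mono-≤ (f≤g zero) (sum-mono (f≤g ∘ suc))

module _ {I : Set} {r} (key : I → Fin r) where

  fibre : Fin r → List I → List I
  fibre j = filter λ i → key i Fin.≟ j

  length-fibre : ∀ j i is →
    length (fibre j (i ∷ is)) ≡ bit (does (key i Fin.≟ j)) * 1 + length (fibre j is)
  length-fibre j i is with key i Fin.≟ j
  ... | yes _ = refl
  ... | no  _ = refl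

  sum-fibres : ∀ is → length is ≡ sum λ j → length (fibre j is)
  sum-fibres []       = sym (sum-replicate-zero r)
  sum-fibres (i ∷ is) = sym (trans (sum-cong-≗ λ j → length-fibre j i is)
    (trans (∑-distrib-+ (λ j → bit (does (key i Fin.≟ j)) * 1) (λ j → length (fibre j is)))
      (cong₂ _+_ (sum-δ (key i) (λ _ → 1)) (sym (sum-fibres is)))))

module _ {I : Set} {P : I → Set} where

  length-toList : ∀ {is} (ps : All P is) → length (All.toList ps) ≡ length is
  length-toList []       = refl
  length-toList (p ∷ ps) = cong suc (length-toList ps)

  allPairs-toList : ∀ {R : I → I → Set} {is} (ps : All P is) →
    AllPairs R is → AllPairs (λ i j → R (proj₁ i) (proj₁ j)) (All.toList ps)
  allPairs-toList []       []       = []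
  allPairs-toList {R} (p ∷ ps) (q ∷ qs) = go ps q ∷ allPairs-toList ps qs
    where
    go : ∀ {i is} (ps : All P is) → All (R i) is → All (λ j → R i (proj₁ j)) (All.toList ps)
    go []       []       = []
    go (_ ∷ ps) (r ∷ rs) = r ∷ go ps rs

module _ {n m : ℕ} where

  child-iso : ∀ {r s} {Φ : Vector (Formula (Var n (suc m))) (suc r)}
                {Ψ : Vector (Formula (Var n (suc m))) (suc s)} →
              maj Φ ≅ maj Ψ → ∃ λ (σ : Permutation (suc r) (suc s)) → ∀ i → Φ i ≅ Ψ (σ ⟨$⟩ʳ i)
  child-iso (maj σ p) = σ , p

  same-image : ∀ (g h : Tuple n m) {Φ Ψ} → g ★ Φ ≅ Ψ → h ★ Φ ≅ Ψ → (inv g ∙ h) ★ Φ ≅ Φ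
  same-image g h p q = ★-trans (inv g) h q (★-inv g p)

  size-≅ : ∀ {X : Set} {Φ Ψ : Formula X} → Φ ≅ Ψ → size Φ ≡ size Ψ
  size-≅ leaf = refl
  size-≅ {Ψ = maj Ψ} (maj σ p) =
    trans (sum-cong-≗ λ i → size-≅ (p i)) (sym (sum-permute (λ i → size (Ψ i)) σ))

  size-relabel : ∀ {X : Set} (f : X → X) Φ → size (relabel f Φ) ≡ size Φ
  size-relabel f (leaf (const _)) = refl
  size-relabel f (leaf (pos _))   = refl
  size-relabel f (leaf (neg _))   = refl
  size-relabel f (maj Φ)          = sum-cong-≗ λ i → size-relabel f (Φ i)

  -- Translates of Φ by different cosets of the stabiliser of a path send its
  -- end to different leaves.
  length≤size : ∀ {Φ} (p : Path Φ) {Ψ} {I : Set} (g : I → Tuple n m) →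
    (∀ i → g i ★ Φ ≅ Ψ) → (is : List I) →
    AllPairs (λ i j → ¬ Fixes p (inv (g i) ∙ g j)) is → length is ≤ size Ψ
  length≤size (leaf lit) g iso [] apart = z≤n
  length≤size {Φ} (leaf lit) g iso (i ∷ []) apart =
    ≤-reflexive (trans (sym lit) (trans (sym (size-relabel _ Φ)) (size-≅ (iso i))))
  length≤size (leaf lit) g iso (i ∷ j ∷ is) ((i#j ∷ _) ∷ _) =
    contradiction (same-image (g i) (g j) (iso i) (iso j)) i#j
  length≤size {maj Φ} (child c p) {leaf l} g iso [] apart = z≤n
  length≤size {maj Φ} (child c p) {leaf l} g iso (i ∷ is) apart with () ← iso i
  length≤size {maj Φ} (child c p) {maj Ψ} {I} g iso is apart =
    ≤-trans (≤-reflexive (sum-fibres key is)) (sum-mono fibre≤)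
    where
    -- The child of `Ψ` to which `Φ c` is carried. Quotients of elements in one fibre fix both
    -- `maj Φ` and `Φ c`, so only the rest of the path can tell them apart.
    key : I → Fin _
    key i = proj₁ (child-iso (iso i)) ⟨$⟩ʳ c

    fibre≤ : ∀ j → length (fibre key j is) ≤ size (Ψ j)
    fibre≤ j = subst (_≤ size (Ψ j)) (length-toList in-fibre)
      (length≤size p {Ψ j} (g ∘ proj₁)
        (λ (i , eq) → subst (λ k → g i ★ Φ c ≅ Ψ k) eq (proj₂ (child-iso (iso i)) c))
        (All.toList in-fibre)
        (AllPairs.map (λ {i} {j} i#j fixes →
            i#j (same-image (g (proj₁ i)) (g (proj₁ j)) (iso (proj₁ i)) (iso (proj₁ j)) , fixes))
          (allPairs-toList in-fibre (AllPairs.filter⁺ (λ i → key i Fin.≟ j) apart))))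
      where
      in-fibre : All (λ i → key i ≡ j) (fibre key j is)
      in-fibre = All.all-filter (λ i → key i Fin.≟ j) is

-- Evaluating the word problem

compose : ∀ {k} → Tuple n k → Permutation′ n
compose = Vec.foldr _⊙_ Perm.id

matrixProduct-compose : ∀ {k} (M : Tuple n k) a b →
  matrixProduct (λ i a b → bit (permMatrix (M i) a b)) a b ≡ bit (does (a Fin.≟ (compose M ⟨$⟩ʳ b)))
matrixProduct-compose {k = zero}  M a b = refl
matrixProduct-compose {n} {k = suc k} M a b = begin
  sum (λ c → bit (permMatrix π a c) * matrixProduct (λ i a b → bit (permMatrix (M (suc i)) a b)) c b)
    ≡⟨ sum-cong-≗ (λ c → cong₂ _*_
         (cong bit (does-≡ (a Fin.≟ (π ⟨$⟩ʳ c)) ((π ⟨$⟩ˡ a) Fin.≟ c)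
           (λ eq → trans (cong (π ⟨$⟩ˡ_) eq) (Perm.inverseˡ π))
           (λ eq → trans (sym (Perm.inverseʳ π)) (cong (π ⟨$⟩ʳ_) eq))))
         (matrixProduct-compose (M ∘ suc) c b)) ⟩
  sum (λ c → bit (does ((π ⟨$⟩ˡ a) Fin.≟ c)) * bit (does (c Fin.≟ (ρ ⟨$⟩ʳ b))))
    ≡⟨ sum-δ (π ⟨$⟩ˡ a) (λ c → bit (does (c Fin.≟ (ρ ⟨$⟩ʳ b)))) ⟩
  bit (does ((π ⟨$⟩ˡ a) Fin.≟ (ρ ⟨$⟩ʳ b)))
    ≡⟨ cong bit (does-≡ ((π ⟨$⟩ˡ a) Fin.≟ (ρ ⟨$⟩ʳ b)) (a Fin.≟ (π ⟨$⟩ʳ (ρ ⟨$⟩ʳ b)))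
         (λ eq → trans (sym (Perm.inverseʳ π)) (cong (π ⟨$⟩ʳ_) eq))
         (λ eq → trans (cong (π ⟨$⟩ˡ_) eq) (Perm.inverseˡ π))) ⟩
  bit (does (a Fin.≟ (π ⟨$⟩ʳ (ρ ⟨$⟩ʳ b)))) ∎
  where
  open ≡-Reasoning
  π = M zero
  ρ = compose (M ∘ suc)

compose-id : ∀ {k} (M : Tuple n k) → (∀ i → M i ≈ Perm.id) → compose M ≈ Perm.id
compose-id {k = zero}  M triv x = refl
compose-id {k = suc k} M triv x = trans (triv zero _) (compose-id (M ∘ suc) (triv ∘ suc) x)

word-value : ∀ {Φ : Formula (Var (suc n) (suc m))} → Computes Φ (Word (suc n) (suc m)) →
             ∀ M → value-at Φ M ≡ does (zero Fin.≟ (compose M ⟨$⟩ʳ zero))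
word-value {Φ = Φ} computes M =
  trans (computes (input M) (M , λ _ _ _ → refl))
  (trans (cong (_≡ᵇ 1) (matrixProduct-compose M zero zero)) (lemma _))
  where
  lemma : ∀ b → (bit b ≡ᵇ 1) ≡ b
  lemma true  = refl
  lemma false = refl

-- Extracting the bounds on real exponents

2xy≤x²+y² : ∀ x y → 2 * (x * y) ≤ x * x + y * y
2xy≤x²+y² x y with ≤-total x y
... | inj₁ x≤y with e , refl ← m≤n⇒∃[o]m+o≡n x≤y =
  ≤-trans (m≤m+n _ (e * e)) (≤-reflexive (lemma x e))
  where
  lemma : ∀ x e → 2 * (x * (x + e)) + e * e ≡ x * x + (x + e) * (x + e)
  lemma = solve-∀
... | inj₂ y≤x with e , refl ← m≤n⇒∃[o]m+o≡n y≤x =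
  ≤-trans (m≤m+n _ (e * e)) (≤-reflexive (lemma y e))
  where
  lemma : ∀ y e → 2 * ((y + e) * y) + e * e ≡ (y + e) * (y + e) + y * y
  lemma = solve-∀

-- AM-GM for `l` copies of `x` and one `y`. The step adds `y` times the induction hypothesis to
-- `(l + 1) x ^ l` times `2xy ≤ x² + y²`; the terms that should be subtracted are instead added on
-- both sides and cancelled.
weighted-am-gm : ∀ l x y → suc l * (x ^ l * y) ≤ y ^ suc l + l * x ^ suc l
weighted-am-gm zero x y = ≤-reflexive (lemma y)
  where
  lemma : ∀ y → 1 * (1 * y) ≡ y * 1 + 0
  lemma = solve-∀
weighted-am-gm (suc l) x y = +-cancelʳ-≤ (suc l * (p * (y * y)) + l * (x * p * y)) _ _ (begin
  suc (suc l) * (x * p * y) + (suc l * (p * (y * y)) + l * (x * p * y))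
    ≡⟨ lemma₁ l x y p ⟩
  suc l * p * (2 * (x * y)) + y * (suc l * (p * y))
    ≤⟨ +-mono-≤ (*-monoʳ-≤ (suc l * p) (2xy≤x²+y² x y)) (*-monoʳ-≤ y (weighted-am-gm l x y)) ⟩
  suc l * p * (x * x + y * y) + y * (y * q + l * (x * p))
    ≡⟨ lemma₂ l x y p q ⟩
  y * (y * q) + suc l * (x * (x * p)) + (suc l * (p * (y * y)) + l * (x * p * y)) ∎)
  where
  open ≤-Reasoning
  p = x ^ l
  q = y ^ l
  lemma₁ : ∀ l x y p → suc (suc l) * (x * p * y) + (suc l * (p * (y * y)) + l * (x * p * y)) ≡
                       suc l * p * (2 * (x * y)) + y * (suc l * (p * y))
  lemma₁ = solve-∀
  lemma₂ : ∀ l x y p q → suc l * p * (x * x + y * y) + y * (y * q + l * (x * p)) ≡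
    y * (y * q) + suc l * (x * (x * p)) + (suc l * (p * (y * y)) + l * (x * p * y))
  lemma₂ = solve-∀

^-distribʳ-* : ∀ d a b → (a * b) ^ d ≡ a ^ d * b ^ d
^-distribʳ-* zero    a b = refl
^-distribʳ-* (suc d) a b = trans (cong (a * b *_) (^-distribʳ-* d a b)) (lemma a b (a ^ d) (b ^ d))
  where
  lemma : ∀ a b p q → a * b * (p * q) ≡ a * p * (b * q)
  lemma = solve-∀

-- weighted-am-gm at x = (l + 2) S, y = (l + 1) (b + S).
am-gm-step : ∀ l S b → suc (suc l) ^ suc (suc l) * (S ^ suc l * b) ≤ suc l ^ suc l * (b + S) ^ suc (suc l)
am-gm-step l S b = *-cancelˡ-≤ L (begin
  L * (L′ ^ suc L * (S ^ L * b))
    ≡⟨ lemma₁ l (L′ ^ L) (S ^ L) b ⟩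
  L′ ^ L * S ^ L * (suc L * (L * b))
    ≡⟨ cong (_* (suc L * (L * b))) (sym (^-distribʳ-* L L′ S)) ⟩
  x ^ L * (suc L * (L * b))
    ≤⟨ +-cancelʳ-≤ (L * x ^ suc L) _ _ (≤-trans (≤-reflexive (lemma₂ l S b (x ^ L))) (weighted-am-gm L x y)) ⟩
  y ^ suc L
    ≡⟨ ^-distribʳ-* (suc L) L (b + S) ⟩
  L ^ suc L * (b + S) ^ suc L
    ≡⟨ *-assoc L (L ^ L) _ ⟩
  L * (L ^ L * (b + S) ^ suc L) ∎)
  where
  open ≤-Reasoning
  L = suc l
  L′ = suc L
  x = L′ * S
  y = L * (b + S)
  lemma₁ : ∀ l p s b → suc l * (suc (suc l) * p * (s * b)) ≡ p * s * (suc (suc l) * (suc l * b))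
  lemma₁ = solve-∀
  lemma₂ : ∀ l S b p → p * (suc (suc l) * (suc l * b)) + suc l * (suc (suc l) * S * p) ≡
                       suc (suc l) * (p * (suc l * (b + S)))
  lemma₂ = solve-∀

am-gm : ∀ as → length as ^ length as * product as ≤ listSum as ^ length as
am-gm []       = ≤-refl
am-gm (b ∷ []) = ≤-reflexive (lemma b)
  where
  lemma : ∀ b → 1 * 1 * (b * 1) ≡ (b + 0) * 1
  lemma = solve-∀
am-gm (b ∷ as@(_ ∷ as′)) = *-cancelˡ-≤ (L ^ L) {{m^n≢0 L L}} (begin
  L ^ L * (suc L ^ suc L * (b * product as))
    ≡⟨ lemma (L ^ L) (suc L ^ suc L) b (product as) ⟩
  suc L ^ suc L * (L ^ L * product as * b)
    ≤⟨ *-monoʳ-≤ (suc L ^ suc L) (*-monoˡ-≤ b (am-gm as)) ⟩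
  suc L ^ suc L * (listSum as ^ L * b)
    ≤⟨ am-gm-step (length as′) (listSum as) b ⟩
  L ^ L * (b + listSum as) ^ suc L ∎)
  where
  open ≤-Reasoning
  L = length as
  lemma : ∀ p q b r → p * (q * (b * r)) ≡ q * (p * r * b)
  lemma = solve-∀

sum-suc : ∀ ts → listSum (List.map suc ts) ≡ listSum ts + length ts
sum-suc []       = refl
sum-suc (t ∷ ts) = trans (cong (suc t +_) (sum-suc ts)) (lemma t (listSum ts) (length ts))
  where
  lemma : ∀ t s l → suc t + (s + l) ≡ t + s + suc l
  lemma = solve-∀

listSum-ones : ∀ e → listSum (List.replicate e 1) ≡ e
listSum-ones zero    = refl
listSum-ones (suc e) = cong suc (listSum-ones e)

product-ones : ∀ e → product (List.replicate e 1) ≡ 1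
product-ones zero    = refl
product-ones (suc e) = trans (+-identityʳ _) (product-ones e)

-- A path may meet fewer than `d` gates; padding with ones makes the list exactly `d` long without
-- changing the product.
am-gm-suc : ∀ d ts → length ts ≤ d → d ^ d * product (List.map suc ts) ≤ (listSum ts + d) ^ d
am-gm-suc d ts len≤d with e , refl ← m≤n⇒∃[o]m+o≡n len≤d =
  subst₂ _≤_
    (cong₂ _*_ (cong (λ l → l ^ l) len)
      (trans (product-++ (List.map suc ts) ones) (trans (cong (product (List.map suc ts) *_) (product-ones e)) (*-identityʳ _))))
    (cong₂ _^_
      (trans (sum-++ (List.map suc ts) ones) (trans (cong₂ _+_ (sum-suc ts) (listSum-ones e)) (+-assoc (listSum ts) (length ts) e)))
      len)
    (am-gm (List.map suc ts List.++ ones))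
  where
  ones = List.replicate e 1
  len : length (List.map suc ts List.++ ones) ≡ length ts + e
  len = trans (length-++ (List.map suc ts)) (cong₂ _+_ (length-map suc ts) (length-replicate e))

product≤2^sum : ∀ ts → product (List.map suc ts) ≤ 2 ^ listSum ts
product≤2^sum []       = ≤-refl
product≤2^sum (t ∷ ts) =
  ≤-trans (*-mono-≤ (suc≤2^ t) (product≤2^sum ts)) (≤-reflexive (sym (^-distribˡ-+-* 2 t (listSum ts))))
  where
  suc≤2^ : ∀ t → suc t ≤ 2 ^ t
  suc≤2^ zero    = ≤-refl
  suc≤2^ (suc t) = ≤-trans (s≤s (suc≤2^ t)) (+-mono-≤ (m^n>0 2 t) (≤-reflexive (sym (+-identityʳ _))))

^-cancelʳ-≤ : ∀ {p q} → 2 ^ p ≤ 2 ^ q → p ≤ q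
^-cancelʳ-≤ le = ≮⇒≥ λ q<p → <⇒≱ (^-monoʳ-< 2 (s≤s (s≤s z≤n)) q<p) le

^-cancelˡ-≤ : ∀ d .{{_ : NonZero d}} {a b} → a ^ d ≤ b ^ d → a ≤ b
^-cancelˡ-≤ d le = ≮⇒≥ λ b<a → <⇒≱ (^-monoˡ-< d b<a) le

-- `ts` lists the ranks lost at the gates of the path. Both real bounds follow from this numerical
-- data alone.
record Bound (n k depth size : ℕ) : Set where
  field
    ts       : List ℕ
    length≤  : length ts ≤ depth
    product≥ : k ≤ product (List.map suc ts)
    size≥    : n ^ listSum ts ≤ size

module _ {n k D s : ℕ} .{{_ : NonZero n}} (bound : Bound n k D s) where
  open Bound bound

  power-bound : ∀ p q → p ≤ listSum ts * q → n ^ p ≤ s ^ q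
  power-bound p q le = ≤-trans (^-monoʳ-≤ n le)
    (≤-trans (≤-reflexive (sym (^-*-assoc n (listSum ts) q))) (^-monoˡ-≤ q size≥))

  log-bound : ∀ p q .{{_ : NonZero q}} → log₂ k p q → n ^ p ≤ s ^ q
  log-bound p q le = power-bound p q (^-cancelʳ-≤ (≤-trans le
    (≤-trans (^-monoˡ-≤ q (≤-trans product≥ (product≤2^sum ts)))
             (≤-reflexive (^-*-assoc 2 (listSum ts) q)))))

  -- In real terms `k ≤ (1 + Σ ts / d)^d`, hence `d (k^(1/d) - 1) ≤ Σ ts`; multiplying by `(q d)^d`
  -- keeps the computation in the natural numbers.
  root-bound : ∀ d .{{_ : NonZero d}} → D ≤ d →
               ∀ p q .{{_ : NonZero q}} → (d ⊛[ root d k ∸1]) p q → n ^ p ≤ s ^ q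
  root-bound d D≤d p q le = power-bound p q (+-cancelʳ-≤ (q * d) _ _ (^-cancelˡ-≤ d (begin
    (p + q * d) ^ d
      ≤⟨ le ⟩
    k * (q * d) ^ d
      ≤⟨ *-monoˡ-≤ ((q * d) ^ d) product≥ ⟩
    product (List.map suc ts) * (q * d) ^ d
      ≡⟨ cong (product (List.map suc ts) *_) (^-distribʳ-* d q d) ⟩
    product (List.map suc ts) * (q ^ d * d ^ d)
      ≡⟨ lemma (product (List.map suc ts)) (q ^ d) (d ^ d) ⟩
    q ^ d * (d ^ d * product (List.map suc ts))
      ≤⟨ *-monoʳ-≤ (q ^ d) (am-gm-suc d ts (≤-trans length≤ D≤d)) ⟩
    q ^ d * (listSum ts + d) ^ d
      ≡⟨ sym (^-distribʳ-* d q (listSum ts + d)) ⟩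
    (q * (listSum ts + d)) ^ d
      ≡⟨ cong (_^ d) (lemma′ q (listSum ts) d) ⟩
    (listSum ts * q + q * d) ^ d ∎)))
    where
    open ≤-Reasoning
    lemma : ∀ a b c → a * (b * c) ≡ b * (c * a)
    lemma = solve-∀
    lemma′ : ∀ q t d → q * (t + d) ≡ t * q + q * d
    lemma′ = solve-∀

WordBound : (n m : ℕ) .{{_ : NonZero n}} → Set
WordBound n m = ∀ Φ → (∀ g → g ★ Φ ≅ Φ) → Computes Φ (Word n (suc m)) →
                ¬ ¬ Bound n (suc m) (depth Φ) (size Φ)

-- Descent along a path of sensitive subformulas

least : ∀ {N} {P : Fin N → Set} → (∀ v → Dec (P v)) → ∃ P →
        ∃ λ v → P v × ∀ w → w Fin.< v → ¬ P w
least {suc N} P? (v , p) with P? zero | v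
... | yes p₀ | _     = zero , p₀ , λ _ ()
... | no ¬p₀ | zero  = contradiction p ¬p₀
... | no ¬p₀ | suc v with w , q , min ← least (P? ∘ suc) (v , p) =
  suc w , q , λ { zero _ → ¬p₀ ; (suc u) u<w → min u (s≤s⁻¹ u<w) }

least-unique : ∀ {N} {P Q : Fin N → Set} → (∀ {v} → P v → Q v) → (∀ {v} → Q v → P v) →
  ∀ {v w} → P v → (∀ u → u Fin.< v → ¬ P u) → Q w → (∀ u → u Fin.< w → ¬ Q u) → v ≡ w
least-unique P⇒Q Q⇒P {v} {w} p minp q minq with Fin.<-cmp v w
... | tri< v<w _ _ = contradiction (P⇒Q p) (minq v v<w)
... | tri≈ _ v≡w _ = v≡w
... | tri> _ _ w<v = contradiction (Q⇒P q) (minp w w<v)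

maj-count : ∀ {n m r} → Vector (Formula (Var n (suc m))) (suc r) → Tuple n (suc m) → ℕ
maj-count Φ M = sum λ c → bit (value-at (Φ c) M)

-- Inputs related by rel v differ by the move v; a formula is sensitive to v if
-- it can tell such inputs apart. A move v is Good for μ with respect to a
-- subgroup if, modulo the subgroup, it can avoid any μ - 1 matrices.
module Descent {n m N : ℕ}
  (rel   : Fin N → Tuple n (suc m) → Tuple n (suc m) → Set)
  (Trans : Tuple n m → Set)
  {V     : Set} (view : Subgroup n m → V → Set)
  (Good  : (V → Set) → ℕ → Fin N → Set)
  (Rank  : (V → Set) → ℕ → Set)
  where

  -- A formula fixed by `U` takes equal values at `M′` and `u ▷ M′`, so for such a formula the move
  -- `v` can be traded for `w`. Quantifying over all related inputs makes this a property of the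
  -- moves alone.
  Shift : Subgroup n m → Fin N → Fin N → Set
  Shift U v w = ∀ M M′ → rel v M M′ → ∃ λ u → mem U u × Trans u × rel w M (u ▷ M′)

  Refines : Subgroup n m → Subgroup n m → ℕ → ℕ → Fin N → Fin N → Set
  Refines U U₁ μ T v w = ∃₂ λ t ν →
    μ ≤ ν * suc t × Good (view U₁) ν w × Rank (view U₁) (T + t) × Shift U v w

  Sensitive : Formula (Var n (suc m)) → Fin N → Set
  Sensitive Φ v = ∃₂ λ M M′ → rel v M M′ × value-at Φ M ≢ value-at Φ M′

  Outcome : Formula (Var n (suc m)) → Subgroup n m → ℕ → ℕ → Set₁
  Outcome Φ U μ T = Σ (Subgroup n m) λ U₁ → ∃₂ λ ts (p : Path Φ) →
    length ts ≤ depth Φ × μ ≤ product (List.map suc ts) ×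
    Rank (view U₁) (T + listSum ts) × (∀ g → mem U g → Fixes p g → mem U₁ g)

  -- `Good` and `Rank` see a subgroup only through `view`, and by `conj` conjugation by an
  -- admissible shift does not affect the view. A child and its image under a shift therefore admit
  -- the same translates.
  module Run
    (good-mono : ∀ {A B : V → Set} {μ v} → (∀ {x} → A x → B x) → Good A μ v → Good B μ v)
    (rank-anti : ∀ {A B : V → Set} {T} → (∀ {x} → B x → A x) → Rank A T → Rank B T)
    (trans-inv : ∀ u → Trans u → Trans (inv u))
    (conj : ∀ U U′ u → Trans u → (∀ {g} → mem U g → mem U′ (u ∙ g ∙ inv u)) →
            ∀ {x} → view U x → view U′ x)
    (refine : ∀ U U₁ {μ T v} → (∀ {g} → mem U₁ g → mem U g) →
              Good (view U) μ v → Rank (view U) T → ¬ ¬ ∃ (Refines U U₁ μ T v))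
    (avoid : ∀ U {μ v} → Good (view U) (suc (suc μ)) v → ∀ i →
             ¬ ¬ ∃ λ w → Shift U v w × ∀ M M′ → rel w M M′ → M i ≈ M′ i)
    where

    -- A literal reads a single matrix, and a move that is good for two or more can be shifted off
    -- that matrix by an element fixing the leaf.
    leaf-insensitive : ∀ U l {μ v} → (∀ g → mem U g → g ★ leaf l ≅ leaf l) →
      Good (view U) (suc (suc μ)) v → ¬ Sensitive (leaf l) v
    leaf-insensitive U l {μ} {v} inv good (M , M′ , r , ≢) = go l refl
      where
      literal : ∀ i → (∀ {M₁ M₂ : Tuple n (suc m)} → M₁ i ≈ M₂ i → value-at (leaf l) M₁ ≡ value-at (leaf l) M₂) → ⊥
      literal i local = avoid U {μ} {v} good i λ (w , shift , same) →
        let u , u∈U , _ , r′ = shift M M′ r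
        in ≢ (trans (local {M} {u ▷ M′} (same M (u ▷ M′) r′)) (sym (value-at-▷ u (inv u u∈U) M′)))
      go : ∀ l′ → l ≡ l′ → ⊥
      go (const b) refl = ≢ refl
      go (pos (i , a , b)) refl = literal i λ M₁≈M₂ → cong (λ c → does (a Fin.≟ c)) (M₁≈M₂ b)
      go (neg (i , a , b)) refl = literal i λ M₁≈M₂ → cong (λ c → not (does (a Fin.≟ c))) (M₁≈M₂ b)

    module Children {r} (Φ : Vector (Formula (Var n (suc m))) (suc r))
      (U : Subgroup n m) (inv★ : ∀ g → mem U g → g ★ maj Φ ≅ maj Φ) (μ T : ℕ) (v : Fin N) where

      Uᶜ : Fin (suc r) → Subgroup n m
      Uᶜ c = stabiliser U (Φ c)

      P : Fin (suc r) → Fin N → Set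
      P c = Refines U (Uᶜ c) μ T v

      module _ (P? : ∀ c w → Dec (P c w)) (∃P : ∀ c → ∃ (P c)) (shift? : ∀ w → Dec (Shift U v w))
        (M M′ : Tuple n (suc m)) (M~M′ : rel v M M′) where

        -- Any translate would do for one child. The least one depends only on the predicate `P c`,
        -- which by `transport` a child shares with its images under the shifts.
        κ : Fin (suc r) → Fin N
        κ c = proj₁ (least (P? c) (∃P c))

        κ-P : ∀ c → P c (κ c)
        κ-P c = proj₁ (proj₂ (least (P? c) (∃P c)))

        κ-least : ∀ c w → w Fin.< κ c → ¬ P c w
        κ-least c = proj₂ (proj₂ (least (P? c) (∃P c)))

        -- The shift must depend on w alone for ψ below to be a bijection.
        u : Fin N → Tuple n m
        u w with shift? w
        ... | yes s = proj₁ (s M M′ M~M′)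
        ... | no  _ = ε

        u∈U : ∀ w → mem U (u w)
        u∈U w with shift? w
        ... | yes s = proj₁ (proj₂ (s M M′ M~M′))
        ... | no  _ = mem-ε U

        u-shifts : ∀ {w} → Shift U v w → Trans (u w) × rel w M (u w ▷ M′)
        u-shifts {w} s with shift? w
        ... | yes s′ = proj₂ (proj₂ (s′ M M′ M~M′))
        ... | no ¬s  = contradiction s ¬s

        σ : Fin N → Permutation′ (suc r)
        σ w = proj₁ (child-iso (inv★ (u w) (u∈U w)))

        σ-iso : ∀ w c → u w ★ Φ c ≅ Φ (σ w ⟨$⟩ʳ c)
        σ-iso w = proj₂ (child-iso (inv★ (u w) (u∈U w)))

        module _ (w : Fin N) (c : Fin (suc r)) where
          private
            c′ = σ w ⟨$⟩ʳ c

          conj→ : ∀ {g} → mem (Uᶜ c) g → mem (Uᶜ c′) (u w ∙ g ∙ inv (u w))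
          conj→ {g} (g∈U , p) =
            mem-∙ U (mem-∙ U (u∈U w) g∈U) (mem-inv U (u∈U w)) ,
            ★-trans (u w ∙ g) (inv (u w)) (★-inv (u w) (σ-iso w c))
              (★-trans (u w) g p (σ-iso w c))

          conj← : ∀ {g} → mem (Uᶜ c′) g → mem (Uᶜ c) (inv (u w) ∙ g ∙ inv (inv (u w)))
          conj← {g} (g∈U , p) =
            mem-∙ U (mem-∙ U (mem-inv U (u∈U w)) g∈U) (mem-inv U (mem-inv U (u∈U w))) ,
            ★-trans (inv (u w) ∙ g) (inv (inv (u w))) (σ-iso w c)
              (★-trans (inv (u w)) g p (★-inv (u w) (σ-iso w c)))

          transport : Trans (u w) → ∀ {x} → (P c x → P c′ x) × (P c′ x → P c x)
          transport tr =
            (λ (t , ν , le , good , rank , s) → t , ν , le , good-mono f good , rank-anti g rank , s) ,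
            (λ (t , ν , le , good , rank , s) → t , ν , le , good-mono g good , rank-anti f rank , s)
            where
            f = conj (Uᶜ c) (Uᶜ c′) (u w) tr conj→
            g = conj (Uᶜ c′) (Uᶜ c) (inv (u w)) (trans-inv (u w) tr) conj←

          κ-σ : Trans (u w) → κ c′ ≡ κ c
          κ-σ tr = least-unique (proj₂ (transport tr)) (proj₁ (transport tr))
            (κ-P c′) (κ-least c′) (κ-P c) (κ-least c)

        trans-κ : ∀ c → Trans (u (κ c))
        trans-κ c = proj₁ (u-shifts (proj₂ (proj₂ (proj₂ (proj₂ (proj₂ (κ-P c)))))))

        -- For each value `w` of `κ`, the permutation `σ w` maps the fibre of `κ` over `w` to itself
        -- by `κ-σ`, and `ψ` equals `σ w` there; so `ψ` is bijective.
        ψ : Permutation′ (suc r)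
        ψ = Perm.permutation to from to∘from from∘to
          where
          to from : Fin (suc r) → Fin (suc r)
          to   c = σ (κ c) ⟨$⟩ʳ c
          from c = σ (κ c) ⟨$⟩ˡ c
          κ-from : ∀ c → κ (from c) ≡ κ c
          κ-from c = trans (sym (κ-σ (κ c) (from c) (trans-κ c))) (cong κ (Perm.inverseʳ (σ (κ c))))
          to∘from : ∀ c → to (from c) ≡ c
          to∘from c = trans (cong (λ w → σ w ⟨$⟩ʳ from c) (κ-from c)) (Perm.inverseʳ (σ (κ c)))
          from∘to : ∀ c → from (to c) ≡ c
          from∘to c = trans (cong (λ w → σ w ⟨$⟩ˡ to c) (κ-σ (κ c) c (trans-κ c))) (Perm.inverseˡ (σ (κ c)))

        -- By insensitivity child `c` has the same value at `M` as at the shifted `M′`, and by the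
        -- isomorphism this is the value of child `ψ c` at `M′`.
        counts-agree : (∀ c → ¬ Sensitive (Φ c) (κ c)) → maj-count Φ M ≡ maj-count Φ M′
        counts-agree insensitive =
          trans (sum-cong-≗ λ c → cong bit (trans (agree c) (sym (value-at-▷ (u (κ c)) (σ-iso (κ c) c) M′))))
                (sym (sum-permute (λ c → bit (value-at (Φ c) M′)) ψ))
          where
          agree : ∀ c → value-at (Φ c) M ≡ value-at (Φ c) (u (κ c) ▷ M′)
          agree c = decidable-stable (_ ≟ᵇ _) λ ≢ → insensitive c
            (M , _ , proj₂ (u-shifts (proj₂ (proj₂ (proj₂ (proj₂ (proj₂ (κ-P c))))))) , ≢)

    depth-child : ∀ {r} (Φ : Vector (Formula (Var n (suc m))) r) c →
      depth (Φ c) ≤ Vec.foldr _⊔_ 0 (λ i → depth (Φ i))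
    depth-child Φ zero    = m≤m⊔n _ _
    depth-child Φ (suc c) = ≤-trans (depth-child (Φ ∘ suc) c) (m≤n⊔m (depth (Φ zero)) _)

    -- Induction on the formula, in continuation form because `Outcome` contains a subgroup and is
    -- too large for `_>>=_`.
    descent : ∀ Φ U {μ T v} → (∀ g → mem U g → g ★ Φ ≅ Φ) → Good (view U) μ v →
      Rank (view U) T → Sensitive Φ v → (Outcome Φ U μ T → ⊥) → ⊥
    descent (leaf l) U {μ} {T} {v} inv★ good rank sens ¬out =
      ¬out (U , [] , leaf (literal l sens) , z≤n , small μ good ,
            subst (Rank (view U)) (sym (+-identityʳ T)) rank , λ _ u _ → u)
      where
      literal : ∀ l {v} → Sensitive (leaf l) v → size (leaf l) ≡ 1
      literal (const b) (_ , _ , _ , ≢) = contradiction refl ≢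
      literal (pos _) _ = refl
      literal (neg _) _ = refl
      -- The product over an empty list is 1, so the path can end here only if `μ ≤ 1`.
      small : ∀ μ → Good (view U) μ v → μ ≤ 1
      small zero          _    = z≤n
      small (suc zero)    _    = s≤s z≤n
      small (suc (suc μ)) good = contradiction sens (leaf-insensitive U l {μ} {v} inv★ good)
    descent (maj {r} Φ) U {μ} {T} {v} inv★ good rank (M , M′ , M~M′ , ≢) ¬out =
      (¬¬-Fin λ c → refine U (Uᶜ c) proj₁ good rank) λ ∃P →
      (¬¬-Fin λ c → ¬¬-Fin λ w → ¬¬-excluded-middle) λ P? →
      (¬¬-Fin λ w → ¬¬-excluded-middle) λ shift? →
      ≢ (cong (λ s → suc r ≤ᵇ 2 * s) (counts-agree P? ∃P shift? M M′ M~M′ λ c sens →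
        let t , ν , le , good′ , rank′ , _ = κ-P P? ∃P shift? M M′ M~M′ c in
        descent (Φ c) (Uᶜ c) (λ _ → proj₂) good′ rank′ sens
          λ (U₁ , ts , p , len , le′ , rank″ , sub) →
            ¬out (U₁ , t ∷ ts , child c p , s≤s (≤-trans len (depth-child Φ c)) ,
              ≤-trans le (≤-trans (*-monoˡ-≤ (suc t) le′) (≤-reflexive (*-comm _ (suc t)))) ,
              subst (Rank (view U₁)) (+-assoc T t _) rank″ ,
              λ g u (_ , fixes) → sub g (u , fixes-root p fixes) fixes)))
      where
      open Children Φ U inv★ μ T v
      fixes-root : ∀ {Ψ g} (p : Path Ψ) → Fixes p g → g ★ Ψ ≅ Ψ
      fixes-root (leaf _)    f       = f
      fixes-root (child _ _) (f , _) = f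

    word-bound : .{{_ : NonZero n}} →
      (∀ U T → Rank (view U) T → ¬ ¬ Index≥ U (n ^ T)) →
      ∀ v → Good (view full) (suc m) v → Rank (view full) 0 →
      (∀ Φ → Computes Φ (Word n (suc m)) → Sensitive Φ v) → WordBound n m
    word-bound index v good rank sens Φ inv★ computes ¬bound =
      descent Φ full (λ g _ → inv★ g) good rank (sens Φ computes)
        λ (U₁ , ts , p , len , le , rank′ , sub) →
      index U₁ (listSum ts) rank′ λ (gs , N≤ , apart) → ¬bound record
        { ts = ts ; length≤ = len ; product≥ = le
        ; size≥ = ≤-trans N≤ (length≤size p id inv★ gs
            (AllPairs.map (λ g#h fixes → g#h (sub _ tt fixes)) apart)) }

-- Transpositions and 3-cycles

record Transposition (σ : Permutation′ n) (a b : Fin n) : Set where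
  field
    a≢b : a ≢ b
    at-a : σ ⟨$⟩ʳ a ≡ b
    at-b : σ ⟨$⟩ʳ b ≡ a
    else : ∀ {x} → x ≢ a → x ≢ b → σ ⟨$⟩ʳ x ≡ x

record Cycle (τ : Permutation′ n) (a b c : Fin n) : Set where
  field
    a≢b : a ≢ b
    b≢c : b ≢ c
    a≢c : a ≢ c
    at-a : τ ⟨$⟩ʳ a ≡ b
    at-b : τ ⟨$⟩ʳ b ≡ c
    at-c : τ ⟨$⟩ʳ c ≡ a
    else : ∀ {x} → x ≢ a → x ≢ b → x ≢ c → τ ⟨$⟩ʳ x ≡ x

open Transposition using () renaming (a≢b to T≢; at-a to T-a; at-b to T-b; else to T-else)
open Cycle using (a≢b; b≢c; a≢c; at-a; at-b; at-c; else)

module _ {n : ℕ} where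

  private variable
    a b c d e : Fin n
    σ σ′ τ τ′ : Permutation′ n

  transposition : a ≢ b → Transposition (Perm.transpose a b) a b
  transposition {a} {b} a≢b = record { a≢b = a≢b ; at-a = at₁ ; at-b = at₂ ; else = λ {x} → other x }
    where
    at₁ : Perm.transpose a b ⟨$⟩ʳ a ≡ b
    at₁ with a Fin.≟ a
    ... | yes _ = refl
    ... | no a≢a = contradiction refl a≢a
    at₂ : Perm.transpose a b ⟨$⟩ʳ b ≡ a
    at₂ with b Fin.≟ a
    ... | yes b≡a = b≡a
    ... | no _ with b Fin.≟ b
    ...   | yes _ = refl
    ...   | no b≢b = contradiction refl b≢b
    other : ∀ x → x ≢ a → x ≢ b → Perm.transpose a b ⟨$⟩ʳ x ≡ x
    other x x≢a x≢b with x Fin.≟ a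
    ... | yes x≡a = contradiction x≡a x≢a
    ... | no _ with x Fin.≟ b
    ...   | yes x≡b = contradiction x≡b x≢b
    ...   | no _ = refl

  moved-back : ∀ (σ : Permutation′ n) {a b} → σ ⟨$⟩ʳ a ≡ b → σ ⟨$⟩ˡ b ≡ a
  moved-back σ refl = Perm.inverseˡ σ

  T-sym : Transposition σ a b → Transposition σ b a
  T-sym t = record { a≢b = T≢ t ∘ sym ; at-a = T-b t ; at-b = T-a t ; else = λ p q → T-else t q p }

  T-inv : Transposition σ a b → Transposition (σ ⁻) a b
  T-inv {σ = σ} t = record { a≢b = T≢ t ; at-a = moved-back σ (T-b t) ; at-b = moved-back σ (T-a t)
    ; else = λ p q → moved-back σ (T-else t p q) }

  rotate : Cycle τ a b c → Cycle τ b c a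
  rotate t = record { a≢b = b≢c t ; b≢c = a≢c t ∘ sym ; a≢c = a≢b t ∘ sym
    ; at-a = at-b t ; at-b = at-c t ; at-c = at-a t ; else = λ p q r → else t r p q }

  cycle-inv : Cycle τ a b c → Cycle (τ ⁻) a c b
  cycle-inv {τ = τ} t = record { a≢b = a≢c t ; b≢c = b≢c t ∘ sym ; a≢c = a≢b t
    ; at-a = moved-back τ (at-c t) ; at-b = moved-back τ (at-b t) ; at-c = moved-back τ (at-a t)
    ; else = λ p q r → moved-back τ (else t p r q) }

  cycle-conj : ∀ (g : Permutation′ n) → Cycle τ a b c →
               Cycle (g ⊙ τ ⊙ g ⁻) (g ⟨$⟩ʳ a) (g ⟨$⟩ʳ b) (g ⟨$⟩ʳ c)
  cycle-conj {τ = τ} g t = record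
    { a≢b = a≢b t ∘ perm-injective g ; b≢c = b≢c t ∘ perm-injective g ; a≢c = a≢c t ∘ perm-injective g
    ; at-a = move (at-a t) ; at-b = move (at-b t) ; at-c = move (at-c t)
    ; else = λ p q r → trans (cong (g ⟨$⟩ʳ_) (else t (back p) (back q) (back r))) (Perm.inverseʳ g) }
    where
    move : ∀ {x y} → τ ⟨$⟩ʳ x ≡ y → g ⟨$⟩ʳ (τ ⟨$⟩ʳ (g ⟨$⟩ˡ (g ⟨$⟩ʳ x))) ≡ g ⟨$⟩ʳ y
    move eq = cong (g ⟨$⟩ʳ_) (trans (cong (τ ⟨$⟩ʳ_) (Perm.inverseˡ g)) eq)
    back : ∀ {x y} → x ≢ g ⟨$⟩ʳ y → g ⟨$⟩ˡ x ≢ y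
    back p eq = p (trans (sym (Perm.inverseʳ g)) (cong (g ⟨$⟩ʳ_) eq))

  cycle-conj′ : ∀ (g : Permutation′ n) {a′ b′ c′} → g ⟨$⟩ʳ a ≡ a′ → g ⟨$⟩ʳ b ≡ b′ → g ⟨$⟩ʳ c ≡ c′ →
                Cycle τ a b c → Cycle (g ⊙ τ ⊙ g ⁻) a′ b′ c′
  cycle-conj′ g refl refl refl = cycle-conj g

  cycle-unique : Cycle τ a b c → Cycle τ′ a b c → τ ≈ τ′
  cycle-unique {a = a} {b} {c} t t′ x with x Fin.≟ a | x Fin.≟ b | x Fin.≟ c
  ... | yes refl | _ | _ = trans (at-a t) (sym (at-a t′))
  ... | no _ | yes refl | _ = trans (at-b t) (sym (at-b t′))
  ... | no _ | no _ | yes refl = trans (at-c t) (sym (at-c t′))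
  ... | no p | no q | no r = trans (else t p q r) (sym (else t′ p q r))

  transposition-product : ∀ {x y} → Transposition σ a x → Transposition σ′ a y → x ≢ y → Cycle (σ ⊙ σ′) a y x
  transposition-product {σ = σ} t t′ x≢y = record
    { a≢b = T≢ t′ ; b≢c = x≢y ∘ sym ; a≢c = T≢ t
    ; at-a = trans (cong (σ ⟨$⟩ʳ_) (T-a t′)) (T-else t (T≢ t′ ∘ sym) (x≢y ∘ sym))
    ; at-b = trans (cong (σ ⟨$⟩ʳ_) (T-b t′)) (T-a t)
    ; at-c = trans (cong (σ ⟨$⟩ʳ_) (T-else t′ (T≢ t ∘ sym) x≢y)) (T-b t)
    ; else = λ p q r → trans (cong (σ ⟨$⟩ʳ_) (T-else t′ p q)) (T-else t p r) }

  cycle-exists : a ≢ b → b ≢ c → a ≢ c → ∃ λ τ → Cycle τ a b c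
  cycle-exists p q r = _ , transposition-product (transposition r) (transposition p) (q ∘ sym)

  cycle-product : Cycle τ b c d → Cycle τ′ a c b → a ≢ d → Cycle (τ ⊙ τ′) a d b
  cycle-product {τ = τ} {b = b} {c = c} {d = d} {τ′ = τ′} {a = a} t t′ a≢d = record
    { a≢b = a≢d ; b≢c = a≢c t ∘ sym ; a≢c = a≢c t′
    ; at-a = trans (cong (τ ⟨$⟩ʳ_) (at-a t′)) (at-b t)
    ; at-b = trans (cong (τ ⟨$⟩ʳ_) (else t′ (a≢d ∘ sym) (b≢c t ∘ sym) (a≢c t ∘ sym))) (at-c t)
    ; at-c = trans (cong (τ ⟨$⟩ʳ_) (at-c t′)) (else t (a≢c t′) (a≢b t′) a≢d)
    ; else = λ {x} p q r → other p q r (x Fin.≟ c) }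
    where
    other : ∀ {x} → x ≢ a → x ≢ d → x ≢ b → Dec (x ≡ c) → τ ⟨$⟩ʳ (τ′ ⟨$⟩ʳ x) ≡ x
    other p q r (yes refl) = trans (cong (τ ⟨$⟩ʳ_) (at-b t′)) (at-a t)
    other p q r (no s) = trans (cong (τ ⟨$⟩ʳ_) (else t′ p s r)) (else t r s q)

  cycle-square : Cycle τ a b c → Cycle τ′ a b c → Cycle (τ ⊙ τ′) a c b
  cycle-square {τ = τ} t t′ = record
    { a≢b = a≢c t ; b≢c = b≢c t ∘ sym ; a≢c = a≢b t
    ; at-a = trans (cong (τ ⟨$⟩ʳ_) (at-a t′)) (at-b t)
    ; at-b = trans (cong (τ ⟨$⟩ʳ_) (at-c t′)) (at-a t)
    ; at-c = trans (cong (τ ⟨$⟩ʳ_) (at-b t′)) (at-c t)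
    ; else = λ p q r → trans (cong (τ ⟨$⟩ʳ_) (else t′ p r q)) (else t p r q) }

fresh : ∀ (xs : List (Fin n)) → length xs < n → ∃ λ y → y ∉ xs
fresh {n} xs len<n with Fin.any? (λ y → ¬? (Any.any? (y Fin.≟_) xs))
... | yes (y , y∉xs) = y , y∉xs
... | no  none = contradiction len<n (≤⇒≯ (Fin.injective⇒≤ {f = position} injective))
  where
  found : ∀ y → Any (y ≡_) xs
  found y = decidable-stable (Any.any? (y Fin.≟_) xs) λ y∉xs → none (y , y∉xs)
  position : Fin n → Fin (length xs)
  position y = Any.index (found y)
  injective : Injective _≡_ _≡_ position
  injective {x} {y} eq = trans (lookup-index (found x))
    (trans (cong (List.lookup xs) eq) (sym (lookup-index (found y))))

≢-here : ∀ {x y : Fin n} {xs} → y ∉ x ∷ xs → y ≢ x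
≢-here y∉ refl = y∉ (here refl)

∉-tail : ∀ {x y : Fin n} {xs} → y ∉ x ∷ xs → y ∉ xs
∉-tail y∉ y∈ = y∉ (there y∈)

≢-next : ∀ {x y z : Fin n} {xs} → y ∉ z ∷ x ∷ xs → y ≢ x
≢-next y∉ = ≢-here (∉-tail y∉)

-- Subgroups of the symmetric group containing all 3-cycles

record PermSubgroup (n : ℕ) : Set₁ where
  field
    has     : Permutation′ n → Set
    has-≈   : ∀ {g h} → g ≈ h → has g → has h
    has-id  : has Perm.id
    has-⊙   : ∀ {g h} → has g → has h → has (g ⊙ h)
    has-inv : ∀ {g} → has g → has (g ⁻)

module _ {n : ℕ} (H : PermSubgroup n) where
  open PermSubgroup H

  HasCycle : Fin n → Fin n → Fin n → Set
  HasCycle a b c = ∃ λ τ → has τ × Cycle τ a b c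

  HasTransposition : Fin n → Fin n → Set
  HasTransposition a b = ∃ λ σ → has σ × Transposition σ a b

  AllCycles : Set
  AllCycles = ∀ {a b c} → a ≢ b → b ≢ c → a ≢ c → HasCycle a b c

  Separates : ∀ {I : Set} → (I → Permutation′ n) → Set
  Separates X = ∀ {x y} → x ≢ y → ¬ has (X x ⁻ ⊙ X y)

module _ {n : ℕ} (H : PermSubgroup n) where
  open PermSubgroup H

  private
    C₃ = HasCycle H
    T₂ = HasTransposition H
    variable
      a b c d x y z : Fin n

  rot : C₃ a b c → C₃ b c a
  rot (τ , h , t) = τ , h , rotate t

  rev : C₃ a b c → C₃ a c b
  rev (τ , h , t) = τ ⁻ , has-inv h , cycle-inv t

  conj₃ : ∀ g → has g → C₃ a b c → ∀ {a′ b′ c′} → g ⟨$⟩ʳ a ≡ a′ → g ⟨$⟩ʳ b ≡ b′ → g ⟨$⟩ʳ c ≡ c′ → C₃ a′ b′ c′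
  conj₃ g hg (τ , h , t) p q r = _ , has-⊙ (has-⊙ hg h) (has-inv hg) , cycle-conj′ g p q r t

  T₂-sym : T₂ a b → T₂ b a
  T₂-sym (σ , h , t) = σ , h , T-sym t

  T₂-product : T₂ a x → T₂ a y → x ≢ y → C₃ a y x
  T₂-product (_ , h , t) (_ , h′ , t′) x≢y = _ , has-⊙ h h′ , transposition-product t t′ x≢y

  -- Conjugating one 3-cycle of `H` by another renames its points. This yields first all cycles (a x
  -- y), then those that avoid `a`.
  all-cycles : (∀ x → x ≢ a → ∃ λ z → C₃ a x z) → AllCycles H
  all-cycles {a} through = any
    where
    through₂ : x ≢ a → y ≢ a → x ≢ y → C₃ a x y
    through₂ {x} {y} x≢a y≢a x≢y with through x x≢a | through y y≢a
    ... | z , Cxz@(σ , hσ , s) | w , Cyw@(τ , hτ , t) with z Fin.≟ y | w Fin.≟ x | w Fin.≟ z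
    ... | yes refl | _ | _ = Cxz
    ... | no _ | yes refl | _ = rev Cyw
    ... | no _ | no _ | yes refl =
      rev (rot (rot (conj₃ τ hτ Cxz (at-a t) (else t x≢a x≢y (b≢c s)) (at-c t))))
    ... | no z≢y | no w≢x | no w≢z =
      rev (conj₃ ρ hρ Czy (else r (a≢b t) (a≢b s) (a≢c s)) (at-c r) (at-a r))
      where
      Cyxz = conj₃ τ hτ Cxz (at-a t) (else t x≢a x≢y (w≢x ∘ sym)) (else t (a≢c s ∘ sym) z≢y (w≢z ∘ sym))
      ρ = proj₁ Cyxz
      hρ = proj₁ (proj₂ Cyxz)
      r = proj₂ (proj₂ Cyxz)
      Czy = conj₃ ρ hρ Cxz (else r (a≢b t) (a≢b s) (a≢c s)) (at-b r) (at-c r)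
    any : AllCycles H
    any {x} {y} {z} x≢y y≢z x≢z with x Fin.≟ a | y Fin.≟ a | z Fin.≟ a
    ... | yes refl | _ | _ = through₂ (x≢y ∘ sym) (x≢z ∘ sym) y≢z
    ... | no _ | yes refl | _ = rot (rot (through₂ (y≢z ∘ sym) x≢y (x≢z ∘ sym)))
    ... | no _ | no _ | yes refl = rot (through₂ x≢z y≢z x≢y)
    ... | no x≢a | no y≢a | no z≢a with through₂ y≢a z≢a y≢z
    ... | τ , hτ , t =
      rot (rot (rev (conj₃ τ hτ (through₂ x≢a y≢a x≢y) (at-a t) (else t x≢a x≢y x≢z) (at-b t))))

-- A subgroup of the symmetric group on n ≥ 5 points with fewer than n cosets
-- contains all 3-cycles: in each family X below, elements of the same coset
-- enlarge the set of 3-cycles known to be in H.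
module _ {n : ℕ} (5≤n : 5 ≤ n) (H : PermSubgroup n) where
  open PermSubgroup H

  private
    C₃ = HasCycle H
    T₂ = HasTransposition H
    variable
      a b c d x y z : Fin n

  C₃⇒≢ : C₃ a b c → a ≢ b × b ≢ c × a ≢ c
  C₃⇒≢ (_ , _ , t) = a≢b t , b≢c t , a≢c t

  module _ (small : ∀ X → ¬ Separates H {Fin n} X) where

    cycle-or-transposition : ∀ a → ¬ ¬ ((∃ λ b → ∃ λ c → C₃ a b c) ⊎ (∃ λ b → T₂ a b))
    cycle-or-transposition a ¬goal = small X λ {x} {y} → apart x y
      where
      X : Fin n → Permutation′ n
      X x with x Fin.≟ a
      ... | yes _ = Perm.id
      ... | no  _ = Perm.transpose a x
      apart : ∀ x y → x ≢ y → ¬ has (X x ⁻ ⊙ X y)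
      apart x y x≢y h with x Fin.≟ a | y Fin.≟ a
      ... | yes refl | yes refl = x≢y refl
      ... | yes refl | no y≢a = ¬goal (inj₂ (y , _ , has-≈ (λ _ → refl) h , transposition (y≢a ∘ sym)))
      ... | no x≢a | yes refl = ¬goal (inj₂ (x , _ , has-≈ (λ _ → refl) h , T-inv (transposition (x≢a ∘ sym))))
      ... | no x≢a | no y≢a = ¬goal (inj₁ (_ , _ , _ , h ,
        transposition-product (T-inv (transposition (x≢a ∘ sym))) (transposition (y≢a ∘ sym)) x≢y))

    AnyCycle : Set
    AnyCycle = ∃ λ a → ∃ λ b → ∃ λ c → C₃ a b c

    -- The family of the preceding lemma, with (c d) in the place of (a b), which already lies in
    -- `H`. Whenever (a x) shares a coset with the identity or with (c d), a 3-cycle arises, if need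
    -- be by first conjugating (a b) to (b x).
    another-transposition : T₂ a b → c ≢ a → c ≢ b → d ≢ a → d ≢ b → c ≢ d → ¬ ¬ (AnyCycle ⊎ T₂ c d)
    another-transposition {a} {b} {c} {d} Tab@(σ , hσ , s) c≢a c≢b d≢a d≢b c≢d ¬goal = small X λ {x} {y} → apart x y
      where
      a≢b′ = T≢ s
      tcd = transposition c≢d
      X : Fin n → Permutation′ n
      X x with x Fin.≟ a | x Fin.≟ b
      ... | yes _ | _     = Perm.id
      ... | no  _ | yes _ = Perm.transpose c d
      ... | no  _ | no _  = Perm.transpose a x
      absurd : C₃ x y z → ⊥
      absurd C = ¬goal (inj₁ (_ , _ , _ , C))
      fromT : ∀ {σ} → x ≢ b → has σ → Transposition σ a x → ⊥
      fromT x≢b h t = absurd (T₂-product H Tab (_ , h , t) (x≢b ∘ sym))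
      mixed : ∀ {σ ρ} → x ≢ a → x ≢ b → Transposition σ c d → Transposition ρ a x → has (σ ⊙ ρ) → ⊥
      mixed {x} {σ} {ρ} x≢a x≢b t u h with x Fin.≟ c | x Fin.≟ d
      ... | yes refl | _ = absurd (_ , h , transposition-product t (T-sym u) d≢a)
      ... | no _ | yes refl = absurd (_ , h , transposition-product (T-sym t) (T-sym u) c≢a)
      ... | no x≢c | no x≢d = absurd (T₂-product H (T₂-sym H Tab) Tbx (x≢a ∘ sym))
        where
        g = σ ⊙ ρ
        Tbx : T₂ b x
        Tbx = _ , has-⊙ (has-⊙ h hσ) (has-inv h) , subst₂ (Transposition _)
          (trans (cong (σ ⟨$⟩ʳ_) (T-else u (a≢b′ ∘ sym) (x≢b ∘ sym))) (T-else t (c≢b ∘ sym) (d≢b ∘ sym)))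
          (trans (cong (σ ⟨$⟩ʳ_) (T-a u)) (T-else t x≢c x≢d))
          (conjugate g (T-sym s))
          where
          conjugate : ∀ (g : Permutation′ n) {σ a b} → Transposition σ a b →
                      Transposition (g ⊙ σ ⊙ g ⁻) (g ⟨$⟩ʳ a) (g ⟨$⟩ʳ b)
          conjugate g {σ} t = record
            { a≢b = T≢ t ∘ perm-injective g
            ; at-a = cong (g ⟨$⟩ʳ_) (trans (cong (σ ⟨$⟩ʳ_) (Perm.inverseˡ g)) (T-a t))
            ; at-b = cong (g ⟨$⟩ʳ_) (trans (cong (σ ⟨$⟩ʳ_) (Perm.inverseˡ g)) (T-b t))
            ; else = λ p q → trans (cong (g ⟨$⟩ʳ_) (T-else t (back p) (back q))) (Perm.inverseʳ g) }
            where
            back : ∀ {x y} → x ≢ g ⟨$⟩ʳ y → g ⟨$⟩ˡ x ≢ y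
            back p eq = p (trans (sym (Perm.inverseʳ g)) (cong (g ⟨$⟩ʳ_) eq))
      apart : ∀ x y → x ≢ y → ¬ has (X x ⁻ ⊙ X y)
      apart x y x≢y h with x Fin.≟ a | x Fin.≟ b | y Fin.≟ a | y Fin.≟ b
      ... | yes refl | _ | yes refl | _ = x≢y refl
      ... | yes refl | _ | no _ | yes refl = ¬goal (inj₂ (_ , has-≈ (λ _ → refl) h , tcd))
      ... | yes refl | _ | no y≢a | no y≢b = fromT y≢b (has-≈ (λ _ → refl) h) (transposition (y≢a ∘ sym))
      ... | no _ | yes refl | yes refl | _ = ¬goal (inj₂ (_ , has-≈ (λ _ → refl) h , T-inv tcd))
      ... | no _ | yes refl | no _ | yes refl = x≢y refl
      ... | no _ | yes refl | no y≢a | no y≢b = mixed y≢a y≢b (T-inv tcd) (transposition (y≢a ∘ sym)) h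
      ... | no x≢a | no x≢b | yes refl | _ = fromT x≢b (has-≈ (λ _ → refl) h) (T-inv (transposition (x≢a ∘ sym)))
      ... | no x≢a | no x≢b | no _ | yes refl =
        mixed x≢a x≢b (T-inv tcd) (transposition (x≢a ∘ sym)) (has-≈ (λ _ → refl) (has-inv h))
      ... | no x≢a | no x≢b | no y≢a | no y≢b =
        absurd (_ , h , transposition-product (T-inv (transposition (x≢a ∘ sym))) (transposition (y≢a ∘ sym)) x≢y)

    -- Transpositions sharing one point multiply to a 3-cycle. From (a₀ b) the preceding lemma
    -- produces (c d) and (c e), which takes five points.
    some-cycle : ¬ ¬ AnyCycle
    some-cycle ¬goal = cycle-or-transposition a₀ start
      where
      a₀ : Fin n
      a₀ = fromℕ< 5≤n
      second : ∀ {c d e} → d ≢ e → AnyCycle ⊎ T₂ c d → (¬ ¬ (AnyCycle ⊎ T₂ c e)) → ⊥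
      second _ (inj₁ C) _ = ¬goal C
      second d≢e (inj₂ Tcd) next = next λ
        { (inj₁ C)   → ¬goal C
        ; (inj₂ Tce) → ¬goal (_ , _ , _ , T₂-product H Tcd Tce d≢e) }
      start : (∃ λ b → ∃ λ c → C₃ a₀ b c) ⊎ (∃ λ b → T₂ a₀ b) → ⊥
      start (inj₁ (b , c , C)) = ¬goal (a₀ , b , c , C)
      start (inj₂ (b , T)) =
        let c , c∉ = fresh (a₀ ∷ b ∷ []) (≤-trans (s≤s (s≤s (s≤s z≤n))) 5≤n)
            d , d∉ = fresh (c ∷ a₀ ∷ b ∷ []) (≤-trans (s≤s (s≤s (s≤s (s≤s z≤n)))) 5≤n)
            e , e∉ = fresh (d ∷ c ∷ a₀ ∷ b ∷ []) 5≤n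
            c≢d = ≢-here d∉ ∘ sym
        in another-transposition T (≢-here c∉) (≢-next c∉) (≢-next d∉) (≢-next (∉-tail d∉)) c≢d
             λ T′ → second (≢-here e∉ ∘ sym) T′
               (another-transposition T (≢-here c∉) (≢-next c∉)
                 (≢-next (∉-tail e∉)) (≢-next (∉-tail (∉-tail e∉))) (≢-next e∉ ∘ sym))

    -- a shares a 3-cycle in H with every point: for b₀ outside the class of a,
    -- take X x = (x b₀) inside the class and X x = (a x) outside.
    module _ (Cabc : C₃ a b c) where

      Related : Fin n → Set
      Related x = ∃ λ z → C₃ a x z

      module _ (Related? : ∀ x → Dec (Related x)) {b₀ : Fin n} (b₀≢a : b₀ ≢ a) (outside : ¬ Related b₀) where

        relate-last : C₃ a y z → Related z
        relate-last C = _ , rev H C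

        inside-≢ : Related x → x ≢ b₀
        inside-≢ r refl = outside r

        fromT-out : T₂ a y → Related y
        fromT-out {y} (σ , h , t) with y Fin.≟ b | y Fin.≟ c
        ... | yes refl | _ = _ , Cabc
        ... | no _ | yes refl = relate-last Cabc
        ... | no y≢b | no y≢c =
          let a≢b , _ , a≢c = C₃⇒≢ Cabc
              ρ , hρ , r = conj₃ H σ h Cabc (T-a t)
                (T-else t (a≢b ∘ sym) (y≢b ∘ sym)) (T-else t (a≢c ∘ sym) (y≢c ∘ sym))
          in _ , rev H (conj₃ H ρ hρ Cabc (else r (T≢ t) a≢b a≢c) (at-b r) (at-c r))

        move-to-b₀ : Related y → ∀ g → has g → g ⟨$⟩ʳ a ≡ a → g ⟨$⟩ʳ y ≡ b₀ → ⊥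
        move-to-b₀ (z , C) g h ga gy = outside (_ , conj₃ H g h C ga gy refl)

        -- If `x` is `b₀`, the product is a 3-cycle through `a` and `b₀`. Otherwise it conjugates (a
        -- y z) to (x b₀ z), which in turn conjugates (a y z) to (a y x), so that `x` is related
        -- after all.
        out-in : ∀ {σ σ′} → x ≢ a → ¬ Related x → Related y →
                 Transposition σ a x → Transposition σ′ y b₀ → has (σ ⊙ σ′) → ⊥
        out-in {x} {y} {σ} {σ′} x≢a ¬rx ry@(z , Cayz) t u h with x Fin.≟ b₀
        ... | yes refl = outside (_ , rot H (rot H (_ , h , transposition-product (T-sym t) (T-sym u) (proj₁ (C₃⇒≢ Cayz)))))
        ... | no x≢b₀ = ¬rx (_ , rev H (conj₃ H ρ hρ Cayz
                 (else r (x≢a ∘ sym) (b₀≢a ∘ sym) a≢z)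
                 (else r y≢x y≢b₀ (y≢z)) (at-c r)))
          where
          a≢y = proj₁ (C₃⇒≢ Cayz)
          y≢z = proj₁ (proj₂ (C₃⇒≢ Cayz))
          a≢z = proj₂ (proj₂ (C₃⇒≢ Cayz))
          y≢x : y ≢ x
          y≢x refl = ¬rx ry
          y≢b₀ = inside-≢ ry
          z≢b₀ = inside-≢ (relate-last Cayz)
          z≢x : z ≢ x
          z≢x refl = ¬rx (relate-last Cayz)
          C : C₃ x b₀ z
          C = conj₃ H (σ ⊙ σ′) h Cayz
            (trans (cong (σ ⟨$⟩ʳ_) (T-else u a≢y (b₀≢a ∘ sym))) (T-a t))
            (trans (cong (σ ⟨$⟩ʳ_) (T-a u)) (T-else t b₀≢a (x≢b₀ ∘ sym)))
            (trans (cong (σ ⟨$⟩ʳ_) (T-else u (y≢z ∘ sym) z≢b₀)) (T-else t (a≢z ∘ sym) z≢x))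
          ρ = proj₁ C
          hρ = proj₁ (proj₂ C)
          r = proj₂ (proj₂ C)

        ¬outside : ⊥
        ¬outside = small X λ {x} {y} → apart x y
          where
          X : Fin n → Permutation′ n
          X x with x Fin.≟ a | Related? x
          ... | yes _ | _     = Perm.id
          ... | no  _ | yes _ = Perm.transpose x b₀
          ... | no  _ | no _  = Perm.transpose a x
          in-tr : Related x → Transposition (Perm.transpose x b₀) x b₀
          in-tr r = transposition (inside-≢ r)
          out-tr : x ≢ a → Transposition (Perm.transpose a x) a x
          out-tr x≢a = transposition (x≢a ∘ sym)
          fixes-a : ∀ {σ} → Related x → Transposition σ x b₀ → σ ⟨$⟩ʳ a ≡ a
          fixes-a (_ , C) t = T-else t (proj₁ (C₃⇒≢ C)) (b₀≢a ∘ sym)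
          apart : ∀ x y → x ≢ y → ¬ has (X x ⁻ ⊙ X y)
          apart x y x≢y h with x Fin.≟ a | Related? x | y Fin.≟ a | Related? y
          ... | yes refl | _ | yes refl | _ = x≢y refl
          ... | yes refl | _ | no _ | yes ry = move-to-b₀ ry _ h (fixes-a ry (in-tr ry)) (T-a (in-tr ry))
          ... | yes refl | _ | no y≢a | no ¬ry = ¬ry (fromT-out (_ , has-≈ (λ _ → refl) h , out-tr y≢a))
          ... | no _ | yes rx | yes refl | _ =
            move-to-b₀ rx _ h (fixes-a rx (T-inv (in-tr rx))) (T-a (T-inv (in-tr rx)))
          ... | no _ | yes rx | no _ | yes ry =
            let t = T-inv (in-tr rx) ; u = in-tr ry
                C = rev H (_ , h , transposition-product (T-sym t) (T-sym u) x≢y)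
                _ , hρ , r = C
            in move-to-b₀ ry _ hρ (else r (b₀≢a ∘ sym) (proj₁ (C₃⇒≢ (proj₂ rx))) (proj₁ (C₃⇒≢ (proj₂ ry)))) (at-c r)
          ... | no x≢a | yes rx | no y≢a | no ¬ry =
            out-in y≢a ¬ry rx (T-inv (out-tr y≢a)) (in-tr rx) (has-≈ (λ _ → refl) (has-inv h))
          ... | no x≢a | no ¬rx | yes refl | _ = ¬rx (fromT-out (_ , has-≈ (λ _ → refl) h , T-inv (out-tr x≢a)))
          ... | no x≢a | no ¬rx | no y≢a | yes ry = out-in x≢a ¬rx ry (T-inv (out-tr x≢a)) (in-tr ry) h
          ... | no x≢a | no ¬rx | no y≢a | no ¬ry =
            ¬ry (_ , _ , h , transposition-product (T-inv (out-tr x≢a)) (out-tr y≢a) x≢y)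

    few-cosets⇒all-cycles : ¬ ¬ AllCycles H
    few-cosets⇒all-cycles ¬all = some-cycle λ (a , _ , _ , C) →
      ¬¬-Fin (λ x → ¬¬-excluded-middle) λ Related? →
      ¬all (all-cycles H λ x x≢a → decidable-stable (Related? x) (¬outside C Related? x≢a))

-- A nontrivial subgroup normalised by the 3-cycles contains all of them, by
-- the usual commutator computations behind the simplicity of A_n.
module _ {n : ℕ} (5≤n : 5 ≤ n) (H : PermSubgroup n) where
  open PermSubgroup H

  module _ (normal : ∀ {τ h} {a b c : Fin n} → Cycle τ a b c → has h → has (τ ⊙ h ⊙ τ ⁻)) where

    private
      C₃ = HasCycle H
      variable
        a b c d e f x y : Fin n
        q : Permutation′ n

      2≤n : 2 < n
      2≤n = ≤-trans (s≤s (s≤s (s≤s z≤n))) 5≤n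
      3≤n : 3 < n
      3≤n = ≤-trans (s≤s (s≤s (s≤s (s≤s z≤n)))) 5≤n

    -- `q τ q⁻¹ τ⁻¹` is `q` times a conjugate of its inverse, hence in `H`; it is also the product
    -- of the 3-cycles (qa qb qc) and (a c b), which can be computed.
    commutator : has q → a ≢ b → b ≢ c → a ≢ c → ∃₂ λ ρ ρ′ → has (ρ ⊙ ρ′) ×
      Cycle ρ (q ⟨$⟩ʳ a) (q ⟨$⟩ʳ b) (q ⟨$⟩ʳ c) × Cycle ρ′ a c b
    commutator {q = q} hq a≢b b≢c a≢c with τ , t ← cycle-exists a≢b b≢c a≢c =
      q ⊙ τ ⊙ q ⁻ , τ ⁻ , has-≈ (λ _ → refl) (has-⊙ hq (normal t (has-inv hq))) , cycle-conj q t , cycle-inv t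

    commutator′ : has q → a ≢ b → b ≢ c → a ≢ c → q ⟨$⟩ʳ a ≡ d → q ⟨$⟩ʳ b ≡ e → q ⟨$⟩ʳ c ≡ f →
      ∃₂ λ ρ ρ′ → has (ρ ⊙ ρ′) × Cycle ρ d e f × Cycle ρ′ a c b
    commutator′ hq p r s refl refl refl = commutator hq p r s

    chain : has q → a ≢ b → b ≢ c → a ≢ c → a ≢ d →
            q ⟨$⟩ʳ a ≡ b → q ⟨$⟩ʳ b ≡ c → q ⟨$⟩ʳ c ≡ d → ∃ λ x → ∃ λ y → C₃ a x y
    chain hq a≢b b≢c a≢c a≢d qa qb qc
      with ρ , ρ′ , h , r , r′ ← commutator′ hq a≢b b≢c a≢c qa qb qc =
      _ , _ , _ , h , cycle-product r r′ a≢d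

    two-fixed : has q → x ≢ y → x ≢ a → y ≢ a → a ≢ b →
                q ⟨$⟩ʳ x ≡ x → q ⟨$⟩ʳ y ≡ y → q ⟨$⟩ʳ a ≡ b → ∃ λ u → ∃ λ v → C₃ a u v
    two-fixed hq x≢y x≢a y≢a a≢b qx qy qa
      with ρ , ρ′ , h , r , r′ ← commutator′ hq x≢y y≢a x≢a qx qy qa =
      _ , _ , _ , h , cycle-product r (rotate r′) a≢b

    swap-fixed : has q → a ≢ b → e ≢ a → e ≢ b →
                 q ⟨$⟩ʳ a ≡ b → q ⟨$⟩ʳ b ≡ a → q ⟨$⟩ʳ e ≡ e → ∃ λ u → ∃ λ v → C₃ a u v
    swap-fixed hq a≢b e≢a e≢b qa qb qe
      with ρ , ρ′ , h , r , r′ ← commutator′ hq a≢b (e≢b ∘ sym) (e≢a ∘ sym) qa qb qe =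
      _ , _ , _ , h , cycle-square (rotate r) r′

    SomeCycle : Set
    SomeCycle = ∃ λ a → ∃ λ b → ∃ λ c → C₃ a b c

    -- The commutator with (a b x) sends `a` to `x`, `x` to `c` and `c` to `y`, so `chain` applies
    -- to it.
    triple-and-moved : has q → a ≢ b → b ≢ c → a ≢ c → x ≢ a → x ≢ b → x ≢ c → x ≢ y →
      q ⟨$⟩ʳ a ≡ b → q ⟨$⟩ʳ b ≡ c → q ⟨$⟩ʳ c ≡ a → q ⟨$⟩ʳ x ≡ y → SomeCycle
    triple-and-moved {q = q} {y = y} hq a≢b b≢c a≢c x≢a x≢b x≢c x≢y qa qb qc qx
      with ρ , ρ′ , h , r , r′ ← commutator′ hq a≢b (x≢b ∘ sym) (x≢a ∘ sym) qa qb qx =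
      _ , chain h (x≢a ∘ sym) x≢c a≢c a≢y
        (trans (cong (ρ ⟨$⟩ʳ_) (at-a r′)) (else r x≢b x≢c x≢y))
        (trans (cong (ρ ⟨$⟩ʳ_) (at-b r′)) (at-a r))
        (trans (cong (ρ ⟨$⟩ʳ_) (else r′ (a≢c ∘ sym) (x≢c ∘ sym) (b≢c ∘ sym))) (at-b r))
      where
      a≢y : _ ≢ y
      a≢y a≡y = x≢c (perm-injective q (trans qx (trans (sym a≡y) (sym qc))))

    -- By the cycles of `q`. One longer than 3 is a case for `chain`. Beside a 3-cycle, two more
    -- points are either both fixed or one of them is moved. Beside a 2-cycle, a fixed point allows
    -- `swap-fixed`; what remains is a second 2-cycle and a further moved point.
    moved⇒cycle : has q → q ⟨$⟩ʳ a ≢ a → SomeCycle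
    moved⇒cycle {q} {a} hq qa≢a = orbit (q ⟨$⟩ʳ qa Fin.≟ a)
      where
      qa = q ⟨$⟩ʳ a
      from-chain : ∀ a → q ⟨$⟩ʳ a ≢ a → q ⟨$⟩ʳ (q ⟨$⟩ʳ a) ≢ a → SomeCycle
      from-chain a qa≢a qqa≢a with q ⟨$⟩ʳ (q ⟨$⟩ʳ (q ⟨$⟩ʳ a)) Fin.≟ a
      ... | no d≢a = _ , chain hq (qa≢a ∘ sym) (qa≢a ∘ perm-injective q ∘ sym) (qqa≢a ∘ sym) (d≢a ∘ sym) refl refl refl
      ... | yes d≡a with x , x∉ ← fresh (a ∷ (q ⟨$⟩ʳ a) ∷ (q ⟨$⟩ʳ (q ⟨$⟩ʳ a)) ∷ []) 3≤n
                    with y , y∉ ← fresh (x ∷ a ∷ (q ⟨$⟩ʳ a) ∷ (q ⟨$⟩ʳ (q ⟨$⟩ʳ a)) ∷ []) 5≤n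
                    with q ⟨$⟩ʳ x Fin.≟ x | q ⟨$⟩ʳ y Fin.≟ y
      ...   | no qx≢x | _ = triple-and-moved hq (qa≢a ∘ sym) (qa≢a ∘ perm-injective q ∘ sym) (qqa≢a ∘ sym)
                (≢-here x∉) (≢-next x∉) (≢-next (∉-tail x∉)) (qx≢x ∘ sym) refl refl d≡a refl
      ...   | yes _ | no qy≢y = triple-and-moved hq (qa≢a ∘ sym) (qa≢a ∘ perm-injective q ∘ sym) (qqa≢a ∘ sym)
                (≢-next y∉) (≢-next (∉-tail y∉)) (≢-next (∉-tail (∉-tail y∉))) (qy≢y ∘ sym) refl refl d≡a refl
      ...   | yes qx | yes qy = _ , two-fixed hq (≢-here y∉ ∘ sym) (≢-here x∉) (≢-next y∉) (qa≢a ∘ sym) qx qy refl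
      involution : q ⟨$⟩ʳ qa ≡ a → SomeCycle
      involution qb with e , e∉ ← fresh (a ∷ qa ∷ []) 2≤n with q ⟨$⟩ʳ e Fin.≟ e
      ... | yes qe = _ , swap-fixed hq (qa≢a ∘ sym) (≢-here e∉) (≢-next e∉) refl qb qe
      ... | no qe≢e with q ⟨$⟩ʳ (q ⟨$⟩ʳ e) Fin.≟ e
      ...   | no qqe≢e = from-chain e qe≢e qqe≢e
      ...   | yes qf with g , g∉ ← fresh ((q ⟨$⟩ʳ e) ∷ e ∷ a ∷ qa ∷ []) 5≤n with q ⟨$⟩ʳ g Fin.≟ g
      ...     | yes qg = _ , swap-fixed hq (qa≢a ∘ sym) (≢-next (∉-tail g∉)) (≢-next (∉-tail (∉-tail g∉))) refl qb qg
      ...     | no qg≢g = three-swaps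
        where
        e≢a = ≢-here e∉
        e≢b = ≢-next e∉
        g≢f = ≢-here g∉
        g≢e = ≢-next g∉
        g≢a = ≢-next (∉-tail g∉)
        g≢b = ≢-next (∉-tail (∉-tail g∉))
        from-q : ∀ {x y} → q ⟨$⟩ʳ y ≡ x → ∀ {z} → z ≢ y → q ⟨$⟩ʳ z ≢ x
        from-q qy z≢y eq = z≢y (perm-injective q (trans eq (sym qy)))
        -- The commutator with (a e g) is (qa qe qg)(a g e). These two cycles are disjoint, so it
        -- has a 3-cycle and moves the further point `a`.
        three-swaps : SomeCycle
        three-swaps with ρ , ρ′ , hρ , r , r′ ← commutator hq (e≢a ∘ sym) (g≢e ∘ sym) (g≢a ∘ sym) =
          triple-and-moved hρ (a≢b r) (b≢c r) (a≢c r)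
            (qa≢a ∘ sym) (from-q qb e≢b ∘ sym) (from-q qb g≢b ∘ sym) (g≢a ∘ sym)
            (trans (cong (ρ ⟨$⟩ʳ_) (else r′ qa≢a (g≢b ∘ sym) (e≢b ∘ sym))) (at-a r))
            (trans (cong (ρ ⟨$⟩ʳ_) (else r′ (from-q qb e≢b) (g≢f ∘ sym) qe≢e)) (at-b r))
            (trans (cong (ρ ⟨$⟩ʳ_) (else r′ (from-q qb g≢b) qg≢g (from-q qf g≢f))) (at-c r))
            (trans (cong (ρ ⟨$⟩ʳ_) (at-a r′)) (else r g≢b g≢f (qg≢g ∘ sym)))
      orbit : Dec (q ⟨$⟩ʳ qa ≡ a) → SomeCycle
      orbit (yes qb) = involution qb
      orbit (no qb)  = from-chain a qa≢a qb

    -- For a new point `x`, conjugation by (c x e) replaces `c` by `x` and leaves `a` and `b` alone;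
    -- the auxiliary `e` is the fifth point.
    spread : C₃ a b c → AllCycles H
    spread {a} {b} {c} C@(τ , hτ , t) = all-cycles H through
      where
      through : ∀ x → x ≢ a → ∃ λ z → C₃ a x z
      through x x≢a with x Fin.≟ b | x Fin.≟ c
      ... | yes refl | _ = _ , C
      ... | no _ | yes refl = _ , rev H C
      ... | no x≢b | no x≢c with e , e∉ ← fresh (a ∷ b ∷ c ∷ x ∷ []) 5≤n
          with ρ , r ← cycle-exists (x≢c ∘ sym) (≢-next (∉-tail (∉-tail e∉)) ∘ sym) (≢-next (∉-tail e∉) ∘ sym) =
        _ , rev H (_ , normal r hτ , cycle-conj′ ρ
          (else r (a≢c t) (x≢a ∘ sym) (≢-here e∉ ∘ sym))
          (else r (b≢c t) (x≢b ∘ sym) (≢-next e∉ ∘ sym)) (at-a r) t)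

    nontrivial⇒all-cycles : has q → q ⟨$⟩ʳ a ≢ a → AllCycles H
    nontrivial⇒all-cycles hq qa≢a = spread (proj₂ (proj₂ (proj₂ (moved⇒cycle hq qa≢a))))

    -- A normalised subgroup without all 3-cycles is trivial, so any two distinct permutations lie
    -- in different cosets.
    normal-separates : ∀ {I : Set} (X : I → Permutation′ n) →
      (∀ {i j} → i ≢ j → ¬ X i ≈ X j) → ¬ AllCycles H → Separates H X
    normal-separates X distinct ¬all {i} {j} i≢j h = distinct i≢j λ x →
      decidable-stable (_ Fin.≟ _) λ Xi≢Xj → ¬all (nontrivial⇒all-cycles h
        λ eq → Xi≢Xj (sym (trans (sym (Perm.inverseʳ (X i))) (cong (X i ⟨$⟩ʳ_) eq))))

-- Families of n² distinct permutations

module _ {n : ℕ} where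
  private
    p₁ p₂ p₃ : Fin (5 + n)
    p₁ = suc zero
    p₂ = suc (suc zero)
    p₃ = suc (suc (suc zero))

    -- n distinct permutations fixing 0: the transpositions (1 b) for `b ≠ 0`, with the identity for
    -- `b = 1`, and one 3-cycle for the index 0. In `square-family` the image of 0 recovers `a`, so
    -- all pairs give distinct products.
    fixing-0 : Fin (5 + n) → Permutation′ (5 + n)
    fixing-0 zero    = Perm.transpose p₁ p₂ ⊙ Perm.transpose p₂ p₃
    fixing-0 (suc b) = Perm.transpose p₁ (suc b)

    at-0 : ∀ b → fixing-0 b ⟨$⟩ʳ zero ≡ zero
    at-0 zero    = refl
    at-0 (suc b) = refl

    fixing-0-injective : ∀ b c → fixing-0 b ≈ fixing-0 c → b ≡ c
    fixing-0-injective zero zero eq = refl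
    fixing-0-injective zero (suc c) eq with refl ← eq p₁ with () ← eq p₂
    fixing-0-injective (suc b) zero eq with refl ← eq p₁ with () ← eq p₂
    fixing-0-injective (suc b) (suc c) eq = eq p₁

  square-family : Fin (5 + n) × Fin (5 + n) → Permutation′ (5 + n)
  square-family (a , b) = Perm.transpose zero a ⊙ fixing-0 b

  square-family-distinct : ∀ {i j} → i ≢ j → ¬ square-family i ≈ square-family j
  square-family-distinct {a , b} {c , d} i≢j eq = i≢j (cong₂ _,_ a≡c (fixing-0-injective b d λ x →
    perm-injective (Perm.transpose zero a) (trans (eq x) (cong (λ a → Perm.transpose zero a ⟨$⟩ʳ (fixing-0 d ⟨$⟩ʳ x)) (sym a≡c)))))
    where
    a≡c : a ≡ c
    a≡c = trans (cong (Perm.transpose zero a ⟨$⟩ʳ_) (sym (at-0 b)))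
      (trans (eq zero) (cong (Perm.transpose zero c ⟨$⟩ʳ_) (at-0 d)))

-- Lower bounds for the index of a subgroup of a power

module _ {A B C : Set} {R : A → A → Set} {S : B → B → Set} {T : C → C → Set} (f : A → B → C)
  (differ₁ : ∀ {x x′} → R x x′ → ∀ y y′ → T (f x y) (f x′ y′))
  (differ₂ : ∀ {y y′} → S y y′ → ∀ x → T (f x y) (f x y′)) where

  allPairs-product : ∀ {xs ys} → AllPairs R xs → AllPairs S ys → AllPairs T (List.cartesianProductWith f xs ys)
  allPairs-product []         ps = []
  allPairs-product {x ∷ xs} {ys} (r ∷ rs) ps =
    AllPairs.++⁺ (AllPairs.map⁺ (AllPairs.map (λ s → differ₂ s x) ps)) (allPairs-product rs ps)
      (All.map⁺ (All.universal (λ y → cross y r) ys))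
    where
    cross : ∀ y {xs} → All (R x) xs → All (T (f x y)) (List.cartesianProductWith f xs ys)
    cross y []       = []
    cross y (r ∷ rs) = All.++⁺ (All.map⁺ (All.universal (differ₁ r y) ys)) (cross y rs)

  length-product : ∀ xs ys → length (List.cartesianProductWith f xs ys) ≡ length xs * length ys
  length-product []       ys = refl
  length-product (x ∷ xs) ys = trans (length-++ (List.map (f x) ys))
    (cong₂ _+_ (length-map (f x) ys) (length-product xs ys))

Differ : ∀ {m} {a : Fin m → ℕ} → (∀ j → Fin (a j)) → (∀ j → Fin (a j)) → Set
Differ f g = ∃ λ j → f j ≢ g j

prod : ∀ {m} → (Fin m → ℕ) → ℕ
prod = Vec.foldr _*_ 1

cons : ∀ {m} {a : Fin (suc m) → ℕ} → Fin (a zero) → (∀ j → Fin (a (suc j))) → ∀ j → Fin (a j)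
cons x f zero    = x
cons x f (suc j) = f j

choices : ∀ {m} (a : Fin m → ℕ) →
  ∃ λ (fs : List (∀ j → Fin (a j))) → length fs ≡ prod a × AllPairs Differ fs
choices {zero}  a = (λ ()) ∷ [] , refl , [] ∷ []
choices {suc m} a with fs , len , ps ← choices (a ∘ suc) =
  List.cartesianProductWith cons (List.allFin (a zero)) fs ,
  trans (length-product {R = _≢_} {S = Differ} {T = Differ} cons differ₁ differ₂ (List.allFin (a zero)) fs)
    (cong₂ _*_ (length-tabulate {n = a zero} id) len) ,
  allPairs-product cons differ₁ differ₂ (AllPairs.tabulate⁺ id) ps
  where
  differ₁ : ∀ {x x′} → x ≢ x′ → ∀ f g → Differ {a = a} (cons x f) (cons x′ g)
  differ₁ x≢x′ f g = zero , x≢x′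
  differ₂ : ∀ {f g} → Differ f g → ∀ x → Differ {a = a} (cons x f) (cons x g)
  differ₂ (j , ≢) x = suc j , ≢

prod-mono : ∀ {m} {a b : Fin m → ℕ} → (∀ j → a j ≤ b j) → prod a ≤ prod b
prod-mono {zero}  le = ≤-refl
prod-mono {suc m} le = *-mono-≤ (le zero) (prod-mono (le ∘ suc))

prod-^ : ∀ n {m} (p : Fin m → ℕ) → prod (λ j → n ^ p j) ≡ n ^ sum p
prod-^ n {zero}  p = refl
prod-^ n {suc m} p = trans (cong (n ^ p zero *_) (prod-^ n (p ∘ suc)))
  (sym (^-distribˡ-+-* n (p zero) (sum (p ∘ suc))))

greatest : ∀ {N} {P : Fin N → Set} → (∀ v → Dec (P v)) → ∃ P →
           ∃ λ v → P v × ∀ w → v Fin.< w → ¬ P w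
greatest {suc N} P? (v , p) with Fin.any? (P? ∘ suc) | v
... | yes q | _ with w , q , max ← greatest (P? ∘ suc) q =
  suc w , q , λ { (suc u) w<u → max u (s≤s⁻¹ w<u) }
... | no ¬q | zero  = zero , p , λ { (suc w) _ q → ¬q (w , q) }
... | no ¬q | suc v = contradiction (v , p) ¬q

single : Fin m → Permutation′ n → Tuple n m
single j τ i with i Fin.≟ j
... | yes _ = τ
... | no  _ = Perm.id

single-at : ∀ (j : Fin m) (τ : Permutation′ n) → single j τ j ≡ τ
single-at j τ with j Fin.≟ j
... | yes _  = refl
... | no j≢j = contradiction refl j≢j

single-off : ∀ (j : Fin m) (τ : Permutation′ n) {i} → i ≢ j → single j τ i ≡ Perm.id
single-off j τ {i} i≢j with i Fin.≟ j
... | yes i≡j = contradiction i≡j i≢j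
... | no _    = refl

single-≋ : ∀ (j : Fin m) (τ : Permutation′ n) (g : Tuple n m) →
           g j ≈ τ → (∀ i → i ≢ j → g i ≈ Perm.id) → g ≋ single j τ
single-≋ j τ g at off i with i Fin.≟ j
... | yes refl = at
... | no i≢j   = off i i≢j

coordinate : Subgroup n m → Fin m → PermSubgroup n
coordinate U j = record
  { has     = λ τ → mem U (single j τ)
  ; has-≈   = λ {g} {h} g≈h u → resp U (single-≋ j h (single j g)
      (λ x → trans (cong (_⟨$⟩ʳ x) (single-at j g)) (g≈h x))
      (λ i i≢j x → cong (_⟨$⟩ʳ x) (single-off j g i≢j))) u
  ; has-id  = resp U (single-≋ j Perm.id ε (λ _ → refl) (λ _ _ _ → refl)) (mem-ε U)
  ; has-⊙   = λ {g} {h} u v → resp U (single-≋ j (g ⊙ h) (single j g ∙ single j h)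
      (λ x → cong₂ (λ a b → a ⟨$⟩ʳ (b ⟨$⟩ʳ x)) (single-at j g) (single-at j h))
      (λ i i≢j x → cong₂ (λ a b → a ⟨$⟩ʳ (b ⟨$⟩ʳ x)) (single-off j g i≢j) (single-off j h i≢j)))
      (mem-∙ U u v)
  ; has-inv = λ {g} u → resp U (single-≋ j (g ⁻) (inv (single j g))
      (λ x → cong (_⟨$⟩ˡ x) (single-at j g))
      (λ i i≢j x → cong (_⟨$⟩ˡ x) (single-off j g i≢j)))
      (mem-inv U u)
  }

id-⁻ : ∀ (π : Permutation′ n) → π ≈ Perm.id → π ⁻ ≈ Perm.id
id-⁻ π π≈id = ≈⇒≈ˡ π Perm.id π≈id

-- The successive quotients of the chain of subgroups of `U` that are trivial on more and more
-- coordinates. It is used with both orders, clearing coordinates from the left or from the right.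
filtration : (Fin m → Fin m → Set) → Subgroup n m → Fin m → PermSubgroup n
filtration _≺_ U j = record
  { has     = λ τ → ∃ λ u → mem U u × (∀ i → i ≺ j → u i ≈ Perm.id) × u j ≈ τ
  ; has-≈   = λ g≈h (u , u∈U , triv , at) → u , u∈U , triv , λ x → trans (at x) (g≈h x)
  ; has-id  = ε , mem-ε U , (λ _ _ _ → refl) , λ _ → refl
  ; has-⊙   = λ {g} (u , u∈U , triv , at) (v , v∈U , triv′ , at′) → u ∙ v , mem-∙ U u∈U v∈U ,
      (λ i i≺j x → trans (triv i i≺j _) (triv′ i i≺j x)) , λ x → trans (at _) (cong (g ⟨$⟩ʳ_) (at′ x))
  ; has-inv = λ {g} (u , u∈U , triv , at) → inv u , mem-inv U u∈U ,
      (λ i i≺j → id-⁻ (u i) (triv i i≺j)) , ≈⇒≈ˡ (u j) g at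
  }

module _ {n m : ℕ} (_≺_ : Fin m → Fin m → Set)
  (first-difference : ∀ {a : Fin m → ℕ} {f g : ∀ j → Fin (a j)} → Differ {a = a} f g →
                      ∃ λ j → f j ≢ g j × ∀ i → i ≺ j → f i ≡ g i)
  (U : Subgroup n m) where

  -- Suppose two tuples with entries from the families lie in the same coset. Their quotient is
  -- trivial before the first difference, so its entry there belongs to the filtration, against
  -- `sep`.
  index-filtration : ∀ (a : Fin m → ℕ) (X : ∀ j → Fin (a j) → Permutation′ n) →
    (∀ j → Separates (filtration _≺_ U j) (X j)) → Index≥ U (prod a)
  index-filtration a X sep with fs , len , ps ← choices a =
    List.map tuple fs , ≤-reflexive (sym (trans (length-map tuple fs) len)) ,
    AllPairs.map⁺ (AllPairs.map (λ {f} {g} → apart f g) ps)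
    where
    tuple : (∀ j → Fin (a j)) → Tuple n m
    tuple f j = X j (f j)
    apart : ∀ f g → Differ {a = a} f g → Apart U (tuple f) (tuple g)
    apart f g differ u with j , fj≢gj , agree ← first-difference {a} {f} {g} differ = sep j fj≢gj
      (_ , u , (λ i i≺j x → trans (cong (λ y → X i (f i) ⟨$⟩ˡ (X i y ⟨$⟩ʳ x)) (sym (agree i i≺j)))
                                  (Perm.inverseˡ (X i (f i)))) , λ _ → refl)

least-difference : ∀ {a : Fin m → ℕ} {f g : ∀ j → Fin (a j)} → Differ {a = a} f g →
                   ∃ λ j → f j ≢ g j × ∀ i → i Fin.< j → f i ≡ g i
least-difference {f = f} {g} d =
  map₂ (map₂ λ min i i<j → decidable-stable (_ Fin.≟ _) (min i i<j))
    (least (λ j → ¬? (f j Fin.≟ g j)) d)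

greatest-difference : ∀ {a : Fin m → ℕ} {f g : ∀ j → Fin (a j)} → Differ {a = a} f g →
                      ∃ λ j → f j ≢ g j × ∀ i → i Fin.> j → f i ≡ g i
greatest-difference {f = f} {g} d =
  map₂ (map₂ λ max i i>j → decidable-stable (_ Fin.≟ _) (max i i>j))
    (greatest (λ j → ¬? (f j Fin.≟ g j)) d)

-- Index of a subgroup with bad coordinates, n ≥ 5

module _ {n′ m : ℕ} (U : Subgroup (5 + n′) m) where

  private
    N = 5 + n′
    5≤n : 5 ≤ N
    5≤n = s≤s (s≤s (s≤s (s≤s (s≤s z≤n))))

  module _ {_≺₁_ _≺₂_ : Fin m → Fin m → Set} (j : Fin m) where

    private
      P = filtration _≺₁_ U j
      Q = filtration _≺₂_ U j

    -- Conjugate by an element of `U` whose entry at `j` is the 3-cycle. Its other entries are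
    -- unknown, but conjugation preserves the trivial entries that membership in `Q` requires.
    normalised : AllCycles P → ∀ {τ h} {a b c : Fin N} → Cycle τ a b c →
                 PermSubgroup.has Q h → PermSubgroup.has Q (τ ⊙ h ⊙ τ ⁻)
    normalised all {τ} {h} t (v , v∈U , triv , at)
      with τ′ , (u , u∈U , _ , at′) , t′ ← all (a≢b t) (b≢c t) (a≢c t) =
      u ∙ v ∙ inv u , mem-∙ U (mem-∙ U u∈U v∈U) (mem-inv U u∈U) ,
      (λ i i≺j x → trans (cong (u i ⟨$⟩ʳ_) (triv i i≺j _)) (Perm.inverseʳ (u i))) ,
      (λ x → trans (at″ _) (cong (τ ⟨$⟩ʳ_) (trans (at _) (cong (h ⟨$⟩ʳ_) (≈⇒≈ˡ (u j) τ at″ x)))))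
      where
      at″ : u j ≈ τ
      at″ x = trans (at′ x) (cycle-unique t′ t x)

    -- (a b c) is the commutator of (a b d) and (a c e).
    coordinate-all-cycles : (∀ i → i ≢ j → i ≺₁ j ⊎ i ≺₂ j) →
                            AllCycles P → AllCycles Q → AllCycles (coordinate U j)
    coordinate-all-cycles cover allP allQ {a} {b} {c} a≢b b≢c a≢c
      with d , d∉ ← fresh (a ∷ b ∷ c ∷ []) (s≤s (s≤s (s≤s (s≤s z≤n))))
      with e , e∉ ← fresh (d ∷ a ∷ b ∷ c ∷ []) 5≤n
      with p , (u , u∈U , uᵗ , uʲ) , s ← allP a≢b (≢-next d∉ ∘ sym) (≢-here d∉ ∘ sym)
      with q , (v , v∈U , vᵗ , vʲ) , t ← allQ a≢c (≢-next (∉-tail (∉-tail e∉)) ∘ sym) (≢-next e∉ ∘ sym) =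
      τ , resp U (single-≋ j τ (u ∙ v ∙ inv u ∙ inv v) at off)
            (mem-∙ U (mem-∙ U (mem-∙ U u∈U v∈U) (mem-inv U u∈U)) (mem-inv U v∈U)) ,
      cycle-product (rotate (cycle-conj′ p (at-a s)
          (else s (a≢c ∘ sym) (b≢c ∘ sym) (≢-next (∉-tail d∉) ∘ sym))
          (else s (≢-next e∉) (≢-next (∉-tail e∉)) (≢-here e∉)) t))
        (cycle-inv t) a≢b
      where
      τ = (p ⊙ q ⊙ p ⁻) ⊙ q ⁻
      at : (u ∙ v ∙ inv u ∙ inv v) j ≈ τ
      at x = trans (uʲ _) (cong (p ⟨$⟩ʳ_) (trans (vʲ _) (cong (q ⟨$⟩ʳ_)
        (trans (≈⇒≈ˡ (u j) p uʲ _) (cong (p ⟨$⟩ˡ_) (≈⇒≈ˡ (v j) q vʲ x))))))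
      off : ∀ i → i ≢ j → (u ∙ v ∙ inv u ∙ inv v) i ≈ Perm.id
      off i i≢j x with cover i i≢j
      ... | inj₁ i≺j = trans (uᵗ i i≺j _)
        (trans (cong (v i ⟨$⟩ʳ_) (id-⁻ (u i) (uᵗ i i≺j) _)) (Perm.inverseʳ (v i)))
      ... | inj₂ i≺j = trans (cong (u i ⟨$⟩ʳ_) (vᵗ i i≺j _))
        (trans (Perm.inverseʳ (u i)) (id-⁻ (v i) (vᵗ i i≺j) x))

  private
    P = filtration Fin._<_ U
    Q = filtration Fin._>_ U

  record Family (H : PermSubgroup N) (p : ℕ) : Set where
    field
      cosets : ℕ
      n^p≤   : N ^ p ≤ cosets
      X      : Fin cosets → Permutation′ N
      sep    : Separates H X

  open Family

  trivial-family : ∀ H → Family H 0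
  trivial-family H = record { cosets = 1 ; n^p≤ = ≤-refl ; X = λ _ → Perm.id
    ; sep = λ { {zero} {zero} 0≢0 → contradiction refl 0≢0 } }

  n-family : ∀ H → ¬ AllCycles H → ¬ ¬ Family H 1
  n-family H ¬all ¬family = few-cosets⇒all-cycles 5≤n H
    (λ X sep → ¬family record { cosets = N ; n^p≤ = ≤-reflexive (*-identityʳ N) ; X = X ; sep = sep }) ¬all

  n²-family : ∀ H → (∀ {τ h} {a b c : Fin N} → Cycle τ a b c → PermSubgroup.has H h → PermSubgroup.has H (τ ⊙ h ⊙ τ ⁻)) →
              ¬ AllCycles H → Family H 2
  n²-family H normal ¬all = record
    { cosets = N * N ; n^p≤ = ≤-reflexive (cong (N *_) (*-identityʳ N)) ; X = square-family ∘ Fin.remQuot N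
    ; sep = normal-separates 5≤n H normal (square-family ∘ Fin.remQuot N) (λ {i} {j} i≢j →
        square-family-distinct {i = Fin.remQuot N i} {Fin.remQuot N j} λ eq → i≢j
          (trans (sym (Fin.combine-remQuot {N} N i))
            (trans (cong (λ (a , b) → Fin.combine a b) eq) (Fin.combine-remQuot {N} N j)))) ¬all }

  TwoFamilies : Fin m → ℕ → Set
  TwoFamilies j e = ∃₂ λ p q → e ≤ p + q × Family (P j) p × Family (Q j) q

  cover : ∀ (j i : Fin m) → i ≢ j → i Fin.< j ⊎ i Fin.> j
  cover j i i≢j with Fin.<-cmp i j
  ... | tri< i<j _ _ = inj₁ i<j
  ... | tri≈ _ i≡j _ = contradiction i≡j i≢j
  ... | tri> _ _ i>j = inj₂ i>j

  -- If both filtrations contained all 3-cycles at `j`, commutators would place them in the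
  -- coordinate itself. If only one does, the other is normalised by 3-cycles, hence trivial, and
  -- has n² cosets; if neither does, each has n.
  two-families : ∀ j → ¬ AllCycles (coordinate U j) → ¬ ¬ TwoFamilies j 2
  two-families j ¬all =
    ¬¬-excluded-middle {A = AllCycles (P j)} >>= λ allP →
    ¬¬-excluded-middle {A = AllCycles (Q j)} >>= λ allQ →
    cases allP allQ
    where
    cases : Dec (AllCycles (P j)) → Dec (AllCycles (Q j)) → ¬ ¬ TwoFamilies j 2
    cases (yes allP) (yes allQ) = contradiction
      (λ {a} {b} {c} → coordinate-all-cycles {Fin._<_} {Fin._>_} j (cover j) allP allQ {a} {b} {c}) ¬all
    cases (yes allP) (no ¬allQ) = pure (0 , 2 , ≤-refl , trivial-family (P j) ,
      n²-family (Q j) (λ {τ} {h} → normalised {Fin._<_} {Fin._>_} j allP {τ} {h}) ¬allQ)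
    cases (no ¬allP) (yes allQ) = pure (2 , 0 , ≤-refl ,
      n²-family (P j) (λ {τ} {h} → normalised {Fin._>_} {Fin._<_} j allQ {τ} {h}) ¬allP , trivial-family (Q j))
    cases (no ¬allP) (no ¬allQ) =
      n-family (P j) ¬allP >>= λ F → n-family (Q j) ¬allQ >>= λ G → pure (1 , 1 , ≤-refl , F , G)

  -- The exponents of the left and the right filtration add up to at least `2T`, so one of the two
  -- filtrations alone accounts for `T`.
  index-bad : ∀ (s : Fin m → Bool) → (∀ j → s j ≡ true → ¬ AllCycles (coordinate U j)) →
              ∀ T → T ≤ sum (λ j → bit (s j)) → ¬ ¬ Index≥ U (N ^ T)
  index-bad s bad T T≤ = ¬¬-Fin (λ j → families j (s j) (bad j)) >>= λ fam → pure (bound fam)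
    where
    families : ∀ j b → (b ≡ true → ¬ AllCycles (coordinate U j)) → ¬ ¬ TwoFamilies j (bit b + bit b)
    families j true  ¬all = two-families j (¬all refl)
    families j false _    = pure (0 , 0 , z≤n , trivial-family (P j) , trivial-family (Q j))
    bound : (∀ j → TwoFamilies j (bit (s j) + bit (s j))) → Index≥ U (N ^ T)
    bound fam = pick (≤-total T (sum p))
      where
      p q : Fin m → ℕ
      p j = proj₁ (fam j)
      q j = proj₁ (proj₂ (fam j))
      e = λ j → bit (s j)
      2T≤ : T + T ≤ sum p + sum q
      2T≤ = ≤-trans (+-mono-≤ T≤ T≤) (≤-trans (≤-reflexive (sym (∑-distrib-+ e e)))
        (≤-trans (sum-mono λ j → proj₁ (proj₂ (proj₂ (fam j)))) (≤-reflexive (∑-distrib-+ p q))))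
      index : ∀ {H : Fin m → PermSubgroup N} (r : Fin m → ℕ) (F : ∀ j → Family (H j) (r j)) →
        Index≥ U (prod λ j → cosets (F j)) → T ≤ sum r → Index≥ U (N ^ T)
      index r F (gs , le , apart) T≤ = gs , ≤-trans (^-monoʳ-≤ N T≤)
        (≤-trans (≤-reflexive (sym (prod-^ N r))) (≤-trans (prod-mono λ j → n^p≤ (F j)) le)) , apart
      pick : T ≤ sum p ⊎ sum p ≤ T → Index≥ U (N ^ T)
      pick (inj₁ T≤p) = index p F
        (index-filtration Fin._<_ (λ {a} {f} {g} → least-difference {a = a} {f} {g}) U _ (λ j → X (F j)) (λ j → sep (F j))) T≤p
        where F = λ j → proj₁ (proj₂ (proj₂ (proj₂ (fam j))))
      pick (inj₂ p≤T) = index q F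
        (index-filtration Fin._>_ (λ {a} {f} {g} → greatest-difference {a = a} {f} {g}) U _ (λ j → X (F j)) (λ j → sep (F j)))
        (+-cancelˡ-≤ T _ _ (≤-trans 2T≤ (+-monoˡ-≤ (sum q) p≤T)))
        where F = λ j → proj₂ (proj₂ (proj₂ (proj₂ (fam j))))

-- The bound for n ≥ 5

pad-off : ∀ (j : Fin m) (τ : Permutation′ n) p → p ≢ suc (toℕ j) → pad (single j τ) p ≈ Perm.id
pad-off j τ zero p≢ x = refl
pad-off {m} j τ (suc p) p≢ x with p <? m
... | no _    = refl
... | yes p<m = cong (_⟨$⟩ʳ x) (single-off j τ λ eq → p≢ (cong suc (trans (sym (Fin.toℕ-fromℕ< p<m)) (cong toℕ eq))))

pad-at : ∀ (j : Fin m) (τ : Permutation′ n) → pad (single j τ) (suc (toℕ j)) ≡ τ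
pad-at j τ = trans (pad-suc (single j τ) j) (single-at j τ)

count-update : ∀ {m} (s : Fin m → Bool) (j : Fin m) → s j ≡ false →
  ∃ λ (s′ : Fin m → Bool) → sum (λ i → bit (s′ i)) ≡ suc (sum λ i → bit (s i)) ×
    s′ j ≡ true × ∀ i → s′ i ≡ true → s i ≡ true ⊎ i ≡ j
count-update s zero s₀ = (λ { zero → true ; (suc i) → s (suc i) }) ,
  cong (λ b → suc (bit b + sum (λ i → bit (s (suc i))))) (sym s₀) , refl ,
  λ { zero _ → inj₂ refl ; (suc i) → inj₁ }
count-update s (suc j) sⱼ with s′ , total , at , only ← count-update (s ∘ suc) j sⱼ =
  (λ { zero → s zero ; (suc i) → s′ i }) ,
  trans (cong (bit (s zero) +_) total) (+-suc (bit (s zero)) _) , at ,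
  λ { zero eq → inj₁ eq ; (suc i) eq → Data.Sum.map₂ (cong suc) (only i eq) }

-- If t of the positions strictly inside an interval of length μ are bad, then
-- they cut it into pieces, one of which has length ν ≥ μ / (t + 1).
module _ {m : ℕ} (A : Fin m → Set) (A? : ∀ j → Dec (A j)) where

  -- Coordinate `j` acts between the matrices `j` and `suc j`, so an interval of `len` matrices has
  -- `len - 1` interior coordinates.
  Interior : ℕ → ℕ → (Fin m → Set) → Set
  Interior lo len B = ∀ j → lo ≤ toℕ j → suc (toℕ j) < lo + len → B j

  module _ (lo : ℕ) (s : Fin m → Bool) (s-bad : ∀ j → s j ≡ true → ¬ A j) where

    -- State after `r` matrices from `lo`: a longest piece of length `ν` at `lo₁`, the current piece
    -- of length `cur` at `lo₂`, and `t` cuts so far, added to the marks `s` to give `s′`. `known`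
    -- ensures that the next coordinate is not yet marked, so that each cut raises the count.
    record Scan (r : ℕ) : Set where
      field
        ν lo₁ cur lo₂ t : ℕ
        s′     : Fin m → Bool
        bad    : ∀ j → s′ j ≡ true → ¬ A j
        known  : ∀ j → s′ j ≡ true → s j ≡ true ⊎ suc (toℕ j) < lo + r
        count  : sum (λ j → bit (s j)) + t ≡ sum (λ j → bit (s′ j))
        ν>0    : 0 < ν
        lo≤lo₁ : lo ≤ lo₁
        ends₁  : lo₁ + ν ≤ lo + r
        good₁  : Interior lo₁ ν A
        cur≤ν  : cur ≤ ν
        lo≤lo₂ : lo ≤ lo₂
        ends₂  : lo₂ + cur ≡ lo + r
        good₂  : Interior lo₂ cur A
        length≤ : r ≤ ν * t + cur

    scan-one : Scan 1
    scan-one = record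
      { ν = 1 ; lo₁ = lo ; cur = 1 ; lo₂ = lo ; t = 0 ; s′ = s
      ; bad = s-bad ; known = λ _ → inj₁ ; count = +-identityʳ _
      ; ν>0 = ≤-refl ; lo≤lo₁ = ≤-refl ; ends₁ = ≤-refl ; good₁ = none
      ; cur≤ν = ≤-refl ; lo≤lo₂ = ≤-refl ; ends₂ = refl ; good₂ = none ; length≤ = ≤-refl }
      where
      none : Interior lo 1 A
      none j lo≤j j< = contradiction (≤-trans j< (≤-reflexive (+-comm lo 1))) (≤⇒≯ (s≤s lo≤j))

    scan-step : ∀ {r} → lo + suc r ≤ suc m → 0 < r →
                (∀ j → suc (toℕ j) ≡ lo + r → s j ≡ false) → Scan r → Scan (suc r)
    scan-step {r} fits 0<r unmarked scan = cases (A? j)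
      where
      open Scan scan
      p<m : pred (lo + r) < m
      p<m = s≤s⁻¹ (≤-trans (s≤s (≤-reflexive (suc-pred (lo + r) {{>-nonZero (≤-trans 0<r (m≤n+m r lo))}})))
                           (≤-trans (≤-reflexive (sym (+-suc lo r))) fits))
      j : Fin m
      j = fromℕ< p<m
      toℕ-j : suc (toℕ j) ≡ lo + r
      toℕ-j = trans (cong suc (Fin.toℕ-fromℕ< p<m)) (suc-pred (lo + r) {{>-nonZero (≤-trans 0<r (m≤n+m r lo))}})
      weaken : ∀ {x} → x ≤ lo + r → x ≤ lo + suc r
      weaken x≤ = ≤-trans x≤ (+-monoʳ-≤ lo (n≤1+n r))
      ends : lo₂ + suc cur ≡ lo + suc r
      ends = trans (+-suc lo₂ cur) (trans (cong suc ends₂) (sym (+-suc lo r)))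
      known′ : ∀ j → s′ j ≡ true → s j ≡ true ⊎ suc (toℕ j) < lo + suc r
      known′ j eq = Data.Sum.map₂ weaken (known j eq)
      unmarked′ : s′ j ≡ false
      unmarked′ with s′ j in eq
      ... | false = refl
      ... | true with known j eq
      ...   | inj₁ sj = trans (sym sj) (unmarked j toℕ-j)
      ...   | inj₂ j< = contradiction j< (<-irrefl toℕ-j)
      cases : Dec (A j) → Scan (suc r)
      cases (yes Aj) = longer (≤-total (suc cur) ν)
        where
        good : Interior lo₂ (suc cur) A
        good i lo≤i i< with suc (toℕ i) <? lo₂ + cur
        ... | yes i<′ = good₂ i lo≤i i<′
        ... | no i≮ = subst A (Fin.toℕ-injective (suc-injective (trans toℕ-j (trans (sym ends₂)
                (≤-antisym (≮⇒≥ i≮) (s≤s⁻¹ (≤-trans i< (≤-reflexive (+-suc lo₂ cur))))))))) Aj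
        longer : suc cur ≤ ν ⊎ ν ≤ suc cur → Scan (suc r)
        longer (inj₁ le) = record
          { ν = ν ; lo₁ = lo₁ ; cur = suc cur ; lo₂ = lo₂ ; t = t ; s′ = s′ ; bad = bad ; known = known′
          ; count = count ; ν>0 = ν>0 ; lo≤lo₁ = lo≤lo₁ ; ends₁ = weaken ends₁ ; good₁ = good₁ ; cur≤ν = le
          ; lo≤lo₂ = lo≤lo₂ ; ends₂ = ends ; good₂ = good
          ; length≤ = ≤-trans (s≤s length≤) (≤-reflexive (sym (+-suc (ν * t) cur))) }
        longer (inj₂ le) = record
          { ν = suc cur ; lo₁ = lo₂ ; cur = suc cur ; lo₂ = lo₂ ; t = t ; s′ = s′ ; bad = bad ; known = known′
          ; count = count ; ν>0 = s≤s z≤n ; lo≤lo₁ = lo≤lo₂ ; ends₁ = ≤-reflexive ends ; good₁ = good ; cur≤ν = ≤-refl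
          ; lo≤lo₂ = lo≤lo₂ ; ends₂ = ends ; good₂ = good
          ; length≤ = ≤-trans (s≤s length≤) (≤-trans (≤-reflexive (sym (+-suc (ν * t) cur)))
              (+-monoˡ-≤ (suc cur) (*-monoˡ-≤ t le))) }
      cases (no ¬Aj) with s″ , total , at , only ← count-update s′ j unmarked′ = record
        { ν = ν ; lo₁ = lo₁ ; cur = 1 ; lo₂ = lo + r ; t = suc t ; s′ = s″
        ; bad = λ i eq → Data.Sum.[ bad i , (λ { refl → ¬Aj }) ] (only i eq)
        ; known = λ i eq → Data.Sum.[ known′ i , (λ { refl → inj₂ (≤-reflexive (trans (cong suc toℕ-j) (sym (+-suc lo r)))) }) ] (only i eq)
        ; count = trans (+-suc _ t) (trans (cong suc count) (sym total))
        ; ν>0 = ν>0 ; lo≤lo₁ = lo≤lo₁ ; ends₁ = weaken ends₁ ; good₁ = good₁ ; cur≤ν = ν>0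
        ; lo≤lo₂ = m≤m+n lo r ; ends₂ = trans (+-assoc lo r 1) (cong (lo +_) (+-comm r 1)) ; good₂ = none
        ; length≤ = ≤-trans (≤-reflexive (+-comm 1 r)) (+-monoˡ-≤ 1 (≤-trans length≤
            (≤-trans (+-monoʳ-≤ (ν * t) cur≤ν) (≤-reflexive (trans (+-comm (ν * t) ν) (sym (*-suc ν t))))))) }
        where
        none : Interior (lo + r) 1 A
        none i lo≤i i< = contradiction (≤-trans i< (≤-reflexive (+-comm (lo + r) 1))) (≤⇒≯ (s≤s lo≤i))

    scan : ∀ r → lo + suc r ≤ suc m → (∀ j → lo ≤ toℕ j → suc (toℕ j) < lo + suc r → s j ≡ false) → Scan (suc r)
    scan zero    fits unmarked = scan-one
    scan (suc r) fits unmarked = scan-step fits (s≤s z≤n)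
      (λ j eq → unmarked j (lo≤ j eq) (≤-reflexive (trans (cong suc eq) (sym (+-suc lo (suc r))))))
      (scan r (≤-trans (+-monoʳ-≤ lo (n≤1+n (suc r))) fits)
        λ j lo≤j j< → unmarked j lo≤j (≤-trans j< (+-monoʳ-≤ lo (n≤1+n (suc r)))))
      where
      lo≤ : ∀ j → suc (toℕ j) ≡ lo + suc r → lo ≤ toℕ j
      lo≤ j eq = ≤-trans (m≤m+n lo r) (≤-reflexive (suc-injective (trans (sym (+-suc lo r)) (sym eq))))

-- Descent with 3-cycles as moves

module AtLeast5 {n′ m : ℕ} where

  private
    N = 5 + n′

  -- The 3-cycle is left unspecified because shifting it to a neighbouring matrix conjugates it by
  -- an entry of the input.
  rel : Fin (suc m) → Tuple N (suc m) → Tuple N (suc m) → Set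
  rel b M M′ = ∃ λ τ → (∃ λ x → ∃ λ y → ∃ λ z → Cycle τ x y z) ×
    M′ b ≈ M b ⊙ τ × ∀ i → i ≢ b → M′ i ≈ M i

  view : Subgroup N m → Fin m → Set
  view U j = AllCycles (coordinate U j)

  Good : (Fin m → Set) → ℕ → Fin (suc m) → Set
  Good A μ b = ∃ λ lo → lo ≤ toℕ b × toℕ b < lo + μ × lo + μ ≤ suc m ×
    ∀ j → lo ≤ toℕ j → suc (toℕ j) < lo + μ → A j

  Rank : (Fin m → Set) → ℕ → Set
  Rank A T = ∃ λ (s : Fin m → Bool) → (∀ j → s j ≡ true → ¬ A j) × T ≤ sum (λ j → bit (s j))

  open Descent rel (λ _ → ⊤) view Good Rank

  rel-cong : ∀ {b} {M M₁ M₂ : Tuple N (suc m)} → M₁ ≋ M₂ → rel b M M₁ → rel b M M₂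
  rel-cong M₁≋M₂ (τ , cyc , at , off) = τ , cyc ,
    (λ x → trans (sym (M₁≋M₂ _ x)) (at x)) , λ i i≢b x → trans (sym (M₁≋M₂ i x)) (off i i≢b x)

  coordinate-mem : ∀ U j → view U j → ∀ {τ a b c} → Cycle τ a b c → mem U (single j τ)
  coordinate-mem U j all {τ} t with τ′ , u , t′ ← all (a≢b t) (b≢c t) (a≢c t) =
    PermSubgroup.has-≈ (coordinate U j) {τ′} {τ} (cycle-unique t′ t) u

  conj : ∀ U U′ u → ⊤ → (∀ {g} → mem U g → mem U′ (u ∙ g ∙ inv u)) → ∀ {j} → view U j → view U′ j
  conj U U′ u _ conj {j} all {a} {b} {c} a≢b b≢c a≢c
    with τ , v , t ← all {u j ⟨$⟩ˡ a} {u j ⟨$⟩ˡ b} {u j ⟨$⟩ˡ c} (a≢b ∘ perm-injectiveˡ (u j))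
           (b≢c ∘ perm-injectiveˡ (u j)) (a≢c ∘ perm-injectiveˡ (u j)) =
    u j ⊙ τ ⊙ u j ⁻ ,
    resp U′ (single-≋ j _ (u ∙ single j τ ∙ inv u)
      (λ x → cong (λ ρ → u j ⟨$⟩ʳ (ρ ⟨$⟩ʳ (u j ⟨$⟩ˡ x))) (single-at j τ))
      (λ i i≢j x → trans (cong (λ ρ → u i ⟨$⟩ʳ (ρ ⟨$⟩ʳ (u i ⟨$⟩ˡ x))) (single-off j τ i≢j)) (Perm.inverseʳ (u i))))
      (conj v) ,
    cycle-conj′ (u j) (Perm.inverseʳ (u j)) (Perm.inverseʳ (u j)) (Perm.inverseʳ (u j)) t

  shift-refl : ∀ U b → Shift U b b
  shift-refl U b M M′ r = ε , mem-ε U , tt , rel-cong {b} {M} {M′} {ε ▷ M′} (λ i x →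
    sym (trans (id-⁻ (pad (ε {N} {m}) (toℕ i)) (pad-ε {N} {m} (toℕ i)) _) (cong (M′ i ⟨$⟩ʳ_) (pad-ε {N} {m} (suc (toℕ i)) x)))) r

  shift-trans : ∀ U {b c d} → Shift U b c → Shift U c d → Shift U b d
  shift-trans U {d = d} s s′ M M′ r with u , u∈U , _ , r₁ ← s M M′ r with v , v∈U , _ , r₂ ← s′ M (u ▷ M′) r₁ =
    u ∙ v , mem-∙ U u∈U v∈U , tt , rel-cong {d} {M} {v ▷ u ▷ M′} {(u ∙ v) ▷ M′} (λ i x → sym (trans
      (≈⇒≈ˡ (pad (u ∙ v) (toℕ i)) (pad u (toℕ i) ⊙ pad v (toℕ i)) (pad-∙ u v (toℕ i)) _)
      (cong (λ y → pad v (toℕ i) ⟨$⟩ˡ (pad u (toℕ i) ⟨$⟩ˡ (M′ i ⟨$⟩ʳ y))) (pad-∙ u v (suc (toℕ i)) x)))) r₂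

  module _ (U : Subgroup N m) (j : Fin m) (all : view U j) where

    private
      i₀ = Fin.inject₁ j
      toℕ-i₀ : toℕ i₀ ≡ toℕ j
      toℕ-i₀ = Fin.toℕ-inject₁ j

      at-left : ∀ (τ : Permutation′ N) → pad (single j τ) (suc (toℕ i₀)) ≈ τ
      at-left τ x = cong (_⟨$⟩ʳ x) (trans (cong (pad (single j τ)) (cong suc toℕ-i₀)) (pad-at j τ))
      before-left : ∀ (τ : Permutation′ N) → pad (single j τ) (toℕ i₀) ≈ Perm.id
      before-left τ = pad-off j τ (toℕ i₀) λ eq → m≢1+m+n (toℕ j) {0}
        (trans (trans (sym toℕ-i₀) eq) (cong suc (sym (+-identityʳ _))))
      at-right : ∀ (τ : Permutation′ N) → pad (single j τ) (suc (toℕ j)) ≈ τ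
      at-right τ x = cong (_⟨$⟩ʳ x) (pad-at j τ)
      after-right : ∀ (τ : Permutation′ N) → pad (single j τ) (suc (suc (toℕ j))) ≈ Perm.id
      after-right τ = pad-off j τ (suc (suc (toℕ j))) λ eq → m≢1+m+n (toℕ j) {0}
        (trans (sym (suc-injective eq)) (cong suc (sym (+-identityʳ _))))

      elsewhere : ∀ τ (M : Tuple N (suc m)) i → i ≢ i₀ → i ≢ suc j → (single j τ ▷ M) i ≈ M i
      elsewhere τ M i i≢i₀ i≢sj x = trans
        (id-⁻ (pad (single j τ) (toℕ i)) (pad-off j τ (toℕ i) (i≢sj ∘ Fin.toℕ-injective)) _)
        (cong (M i ⟨$⟩ʳ_) (pad-off j τ (suc (toℕ i))
          (λ eq → i≢i₀ (Fin.toℕ-injective (trans (suc-injective eq) (sym toℕ-i₀)))) x))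

      i₀≢sj : i₀ ≢ suc j
      i₀≢sj eq = m≢1+m+n (toℕ j) {0} (trans (sym toℕ-i₀) (trans (cong toℕ eq) (cong suc (sym (+-identityʳ _)))))

    -- The inverse of `τ` at coordinate `j` takes `τ` off the matrix on the left and puts it before
    -- the next matrix; moving it behind that matrix turns it into a conjugate.
    shift-right : Shift U i₀ (suc j)
    shift-right M M′ (τ , (a , b , c , t) , at , off) =
      single j (τ ⁻) , coordinate-mem U j all (cycle-inv t) , tt ,
      M (suc j) ⁻ ⊙ τ ⊙ (M (suc j) ⁻) ⁻ , (_ , _ , _ , cycle-conj (M (suc j) ⁻) t) ,
      (λ x → trans (≈⇒≈ˡ (pad u (suc (toℕ j))) (τ ⁻) (at-right (τ ⁻)) _)
        (trans (cong (τ ⟨$⟩ʳ_) (trans (cong (M′ (suc j) ⟨$⟩ʳ_) (after-right (τ ⁻) x))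
          (off (suc j) (i₀≢sj ∘ sym) x))) (sym (Perm.inverseʳ (M (suc j)))))) ,
      others
      where
      u = single j (τ ⁻)
      others : ∀ i → i ≢ suc j → (u ▷ M′) i ≈ M i
      others i i≢sj x with i Fin.≟ i₀
      ... | no i≢i₀ = trans (elsewhere (τ ⁻) M′ i i≢i₀ i≢sj x) (off i i≢i₀ x)
      ... | yes refl = trans (id-⁻ (pad u (toℕ i₀)) (before-left (τ ⁻)) _)
        (trans (at _) (cong (M i₀ ⟨$⟩ʳ_) (trans (cong (τ ⟨$⟩ʳ_) (at-left (τ ⁻) x)) (Perm.inverseʳ τ))))

    shift-left : Shift U (suc j) i₀
    shift-left M M′ (τ , (a , b , c , t) , at , off) =
      u , coordinate-mem U j all t′ , tt , ρ , (_ , _ , _ , t′) ,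
      (λ x → trans (id-⁻ (pad u (toℕ i₀)) (before-left ρ) _)
        (trans (off i₀ i₀≢sj _) (cong (M i₀ ⟨$⟩ʳ_) (at-left ρ x)))) ,
      others
      where
      π = M (suc j)
      ρ = π ⊙ τ ⊙ π ⁻
      t′ = cycle-conj π t
      u = single j ρ
      others : ∀ i → i ≢ i₀ → (u ▷ M′) i ≈ M i
      others i i≢i₀ x with i Fin.≟ suc j
      ... | no i≢sj = trans (elsewhere ρ M′ i i≢i₀ i≢sj x) (off i i≢sj x)
      ... | yes refl = trans (≈⇒≈ˡ (pad u (suc (toℕ j))) ρ (at-right ρ) _)
        (trans (cong (ρ ⟨$⟩ˡ_) (trans (cong (M′ (suc j) ⟨$⟩ʳ_) (after-right ρ x)) (at x)))
        (moved-back ρ (cong (λ y → π ⟨$⟩ʳ (τ ⟨$⟩ʳ y)) (Perm.inverseˡ π))))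

  shift-between : ∀ U d (b c : Fin (suc m)) → d + toℕ b ≡ toℕ c →
    (∀ j → toℕ b ≤ toℕ j → toℕ j < toℕ c → view U j) → Shift U b c × Shift U c b
  shift-between U zero b c eq _ with refl ← Fin.toℕ-injective eq = shift-refl U b , shift-refl U b
  shift-between U (suc d) b (suc j) eq all
    with s , s′ ← shift-between U d b (Fin.inject₁ j) (trans (suc-injective eq) (sym (Fin.toℕ-inject₁ j)))
                    (λ i b≤i i< → all i b≤i (≤-trans i< (≤-trans (≤-reflexive (Fin.toℕ-inject₁ j)) (n≤1+n _)))) =
    shift-trans U s (shift-right U j vj) , shift-trans U (shift-left U j vj) s′
    where
    vj = all j (≤-trans (m≤n+m (toℕ b) d) (≤-reflexive (suc-injective eq))) ≤-refl

  shift-within : ∀ U lo μ (b c : Fin (suc m)) → lo ≤ toℕ b → toℕ b < lo + μ → lo ≤ toℕ c → toℕ c < lo + μ →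
    (∀ j → lo ≤ toℕ j → suc (toℕ j) < lo + μ → view U j) → Shift U b c
  shift-within U lo μ b c lo≤b b< lo≤c c< all with ≤-total (toℕ b) (toℕ c)
  ... | inj₁ b≤c with d , eq ← m≤n⇒∃[o]m+o≡n b≤c =
    proj₁ (shift-between U d b c (trans (+-comm d _) eq) λ j b≤j j<c → all j (≤-trans lo≤b b≤j) (≤-<-trans j<c c<))
  ... | inj₂ c≤b with d , eq ← m≤n⇒∃[o]m+o≡n c≤b =
    proj₂ (shift-between U d c b (trans (+-comm d _) eq) λ j c≤j j<b → all j (≤-trans lo≤c c≤j) (≤-<-trans j<b b<))

  -- The interior of the old interval is good for `U`, hence unmarked. Each interior coordinate that
  -- is bad for `U₁` is therefore a new mark, and the move is shifted into a longest remaining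
  -- piece.
  refine : ∀ U U₁ {μ T b} → (∀ {g} → mem U₁ g → mem U g) →
           Good (view U) μ b → Rank (view U) T → ¬ ¬ ∃ (Refines U U₁ μ T b)
  refine U U₁ {zero} {T} {b} sub (lo , lo≤b , b< , _) rank =
    contradiction (≤-trans b< (≤-reflexive (+-identityʳ lo))) (≤⇒≯ lo≤b)
  refine U U₁ {suc μ} {T} {b} sub (lo , lo≤b , b< , fits , all) (s , s-bad , T≤) =
    ¬¬-Fin (λ j → ¬¬-excluded-middle {A = view U₁ j}) >>= λ A? → pure (found A?)
    where
    view-mono : ∀ {j} → view U₁ j → view U j
    view-mono all p q r with τ , u , t ← all p q r = τ , sub u , t
    unmarked : ∀ j → lo ≤ toℕ j → suc (toℕ j) < lo + suc μ → s j ≡ false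
    unmarked j lo≤j j< with s j in eq
    ... | false = refl
    ... | true  = contradiction (λ {a} {b} {c} → all j lo≤j j< {a} {b} {c}) (s-bad j eq)
    found : (∀ j → Dec (view U₁ j)) → ∃ (Refines U U₁ (suc μ) T b)
    found A? = w , t , ν , ≤-trans length≤ (≤-trans (+-monoʳ-≤ (ν * t) cur≤ν)
          (≤-reflexive (trans (+-comm (ν * t) ν) (sym (*-suc ν t))))) ,
        (lo₁ , ≤-reflexive (sym toℕ-w) , ≤-trans (≤-reflexive (cong suc toℕ-w)) lo₁<
          , ≤-trans ends₁ fits , good₁) ,
        (s′ , bad , ≤-trans (+-monoˡ-≤ t T≤) (≤-reflexive count)) ,
        shift-within U lo (suc μ) b w lo≤b b< (≤-trans lo≤lo₁ (≤-reflexive (sym toℕ-w)))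
          (≤-trans (≤-reflexive (cong suc toℕ-w)) (≤-trans lo₁< ends₁)) all
      where
      open Scan (scan (view U₁) A? lo s (λ j eq v → s-bad j eq (λ {a} {b} {c} → view-mono v {a} {b} {c})) μ fits unmarked)
      lo₁< : lo₁ < lo₁ + ν
      lo₁< = m<m+n lo₁ ν>0
      w : Fin (suc m)
      w = fromℕ< (≤-trans lo₁< (≤-trans ends₁ fits))
      toℕ-w : toℕ w ≡ lo₁
      toℕ-w = Fin.toℕ-fromℕ< _

  neighbour : ∀ lo μ (i : Fin (suc m)) → lo + suc (suc μ) ≤ suc m →
            ∃ λ w → w ≢ i × lo ≤ toℕ w × toℕ w < lo + suc (suc μ)
  neighbour lo μ i fits with lo Data.Nat.Properties.≟ toℕ i
  ... | no lo≢i = lw , (λ eq → lo≢i (trans (sym toℕ-lw) (cong toℕ eq))) , ≤-reflexive (sym toℕ-lw) ,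
        ≤-trans (≤-reflexive (cong suc toℕ-lw)) (m<m+n lo (s≤s z≤n))
    where
    lo<m : lo < suc m
    lo<m = ≤-trans (m<m+n lo (s≤s z≤n)) fits
    lw = fromℕ< lo<m
    toℕ-lw : toℕ lw ≡ lo
    toℕ-lw = Fin.toℕ-fromℕ< lo<m
  ... | yes lo≡i = rw , (λ eq → 1+n≢n (trans (sym toℕ-rw) (trans (cong toℕ eq) (sym lo≡i)))) ,
        ≤-trans (n≤1+n lo) (≤-reflexive (sym toℕ-rw)) , ≤-trans (≤-reflexive (cong suc toℕ-rw)) s<
    where
    s< : suc lo < lo + suc (suc μ)
    s< = ≤-trans (s≤s (s≤s (m≤m+n lo μ))) (≤-reflexive (sym (trans (+-suc lo (suc μ)) (cong suc (+-suc lo μ)))))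
    rw = fromℕ< (≤-trans s< fits)
    toℕ-rw : toℕ rw ≡ suc lo
    toℕ-rw = Fin.toℕ-fromℕ< (≤-trans s< fits)

  avoid : ∀ U {μ b} → Good (view U) (suc (suc μ)) b → ∀ i →
          ¬ ¬ ∃ λ w → Shift U b w × ∀ M M′ → rel w M M′ → M i ≈ M′ i
  avoid U {μ} {b} (lo , lo≤b , b< , fits , all) i with i Fin.≟ b
  ... | no i≢b = pure (b , shift-refl U b , λ { M M′ (_ , _ , _ , off) x → sym (off i i≢b x) })
  ... | yes refl with w , w≢i , lo≤w , w< ← neighbour lo μ i fits =
    pure (w , shift-within U lo (suc (suc μ)) i w lo≤b b< lo≤w w< all ,
      λ { M M′ (_ , _ , _ , off) x → sym (off i (w≢i ∘ sym) x) })

  good-mono : ∀ {A B : Fin m → Set} {μ v} → (∀ {x} → A x → B x) → Good A μ v → Good B μ v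
  good-mono A⊆B (lo , p , q , r , good) = lo , p , q , r , λ j x y → A⊆B (good j x y)

  rank-anti : ∀ {A B : Fin m → Set} {T} → (∀ {x} → B x → A x) → Rank A T → Rank B T
  rank-anti B⊆A (s , bad , T≤) = s , (λ j eq b → bad j eq (B⊆A b)) , T≤

  conj′ : ∀ U U′ u → ⊤ → (∀ {g} → mem U g → mem U′ (u ∙ g ∙ inv u)) → ∀ {j} → view U j → view U′ j
  conj′ U U′ u t c {j} = conj U U′ u t c {j}

  open Run good-mono rank-anti (λ _ _ → tt) conj′ refine avoid

  sensitive : ∀ Φ → Computes Φ (Word N (suc m)) → Sensitive Φ zero
  sensitive Φ computes = ε , M , (τ , (_ , _ , _ , t) , (λ _ → refl) , λ { zero 0≢0 → contradiction refl 0≢0 ; (suc i) _ _ → refl }) ,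
    λ eq → contradiction (trans (sym (trans (word-value {Φ = Φ} computes ε) value-ε)) (trans eq (trans (word-value {Φ = Φ} computes M) value-M))) λ ()
    where
    t₀ = cycle-exists {N} {zero} {suc zero} {suc (suc zero)} (λ ()) (λ ()) (λ ())
    τ = proj₁ t₀
    t = proj₂ t₀
    M : Tuple N (suc m)
    M zero    = τ
    M (suc _) = Perm.id
    value-ε : does (zero Fin.≟ (compose (ε {N} {suc m}) ⟨$⟩ʳ zero)) ≡ true
    value-ε = cong (λ x → does (zero {n = 4 + n′} Fin.≟ x)) (compose-id (ε {N} {suc m}) (λ _ _ → refl) zero)
    value-M : does (zero Fin.≟ (compose M ⟨$⟩ʳ zero)) ≡ false
    value-M = cong (λ x → does (zero {n = 4 + n′} Fin.≟ x)) (cong (τ ⟨$⟩ʳ_) (compose-id (M ∘ suc) (λ _ _ → refl) zero))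

  bound : WordBound N m
  bound = word-bound (λ { U T (s , bad , T≤) → index-bad U s bad T T≤ }) zero
    (0 , z≤n , s≤s z≤n , ≤-refl , λ j _ _ p q r → let τ , t = cycle-exists p q r in τ , tt , t)
    ((λ _ → false) , (λ _ ()) , z≤n) sensitive

-- Linear algebra over a finite field

record Field (n : ℕ) : Set where
  infixl 6 _+ᶠ_
  infixl 7 _*ᶠ_
  field
    _+ᶠ_ _*ᶠ_ : Fin n → Fin n → Fin n
    -ᶠ_ : Fin n → Fin n
    0ᶠ 1ᶠ : Fin n
    isCommutativeRing : IsCommutativeRing _≡_ _+ᶠ_ _*ᶠ_ -ᶠ_ 0ᶠ 1ᶠ
    invertible : ∀ c → c ≢ 0ᶠ → ∃ λ d → d *ᶠ c ≡ 1ᶠ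
    1≢0 : 1ᶠ ≢ 0ᶠ

  commutativeRing : CommutativeRing _ _
  commutativeRing = record { isCommutativeRing = isCommutativeRing }

  open CommutativeRing commutativeRing public
    using (zeroˡ; zeroʳ)
    renaming ( +-assoc to +ᶠ-assoc; +-comm to +ᶠ-comm; *-assoc to *ᶠ-assoc; distribˡ to distribˡᶠ
             ; +-identityˡ to +ᶠ-identityˡ; +-identityʳ to +ᶠ-identityʳ; *-identityˡ to *ᶠ-identityˡ
             ; -‿inverseʳ to +ᶠ-inverseʳ)

  open import Algebra.Properties.Ring (CommutativeRing.ring commutativeRing) public
    using (-1*x≈-x; -‿distribˡ-*; -‿distribʳ-*)
  open import Algebra.Properties.AbelianGroup (CommutativeRing.+-abelianGroup commutativeRing) public
    using () renaming ( \\-leftDividesʳ to cancelˡ; \\-leftDividesˡ to cancelˡ′; x∙y⁻¹≈ε⇒x≈y to difference-0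
                      ; ⁻¹-∙-comm to -ᶠ-+; ⁻¹-involutive to -ᶠ-involutive; ∙-cancelˡ to +ᶠ-cancelˡ; ∙-cancelʳ to +ᶠ-cancelʳ)
  open Algebra.Solver.Ring.NaturalCoefficients.Default (CommutativeRing.commutativeSemiring commutativeRing) public
    using (solve; _:+_; _:*_; _:=_)

module Linear {n : ℕ} (F : Field n) {m : ℕ} where
  open Field F

  V : Set
  V = Fin m → Fin n

  infixl 6 _+ⱽ_
  infixl 7 _·ⱽ_

  _+ⱽ_ : V → V → V
  (x +ⱽ y) j = x j +ᶠ y j

  _·ⱽ_ : Fin n → V → V
  (c ·ⱽ x) j = c *ᶠ x j

  0ⱽ : V
  0ⱽ _ = 0ᶠ

  -ⱽ_ : V → V
  (-ⱽ x) j = -ᶠ x j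

  record Subspace (A : V → Set) : Set where
    field
      resp-≗ : ∀ {x y} → x ≗ y → A x → A y
      has-0  : A 0ⱽ
      has-+  : ∀ {x y} → A x → A y → A (x +ⱽ y)
      has-·  : ∀ c {x} → A x → A (c ·ⱽ x)

    has-- : ∀ {x} → A x → A (-ⱽ x)
    has-- {x} a = resp-≗ (λ j → -1*x≈-x (x j)) (has-· (-ᶠ 1ᶠ) a)

    has-difference : ∀ {x y} → A x → A (x +ⱽ y) → A y
    has-difference {x} {y} a b = resp-≗ (λ j → cancelˡ (x j) (y j)) (has-+ (has-- a) b)

  open Subspace public

  data Span : List V → V → Set where
    []  : ∀ {x} → x ≗ 0ⱽ → Span [] x
    _∷_ : ∀ {e es y x} c → x ≗ c ·ⱽ e +ⱽ y → Span es y → Span (e ∷ es) x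

  span-subspace : ∀ es → Subspace (Span es)
  span-subspace [] = record
    { resp-≗ = λ { x≗y ([] x≗0) → [] λ j → trans (sym (x≗y j)) (x≗0 j) }
    ; has-0  = [] λ _ → refl
    ; has-+  = λ { ([] p) ([] q) → [] λ j → trans (cong₂ _+ᶠ_ (p j) (q j)) (+ᶠ-identityˡ 0ᶠ) }
    ; has-·  = λ { c ([] p) → [] λ j → trans (cong (c *ᶠ_) (p j)) (zeroʳ c) } }
  span-subspace (e ∷ es) = record
    { resp-≗ = λ { x≗y ((c ∷ eq) s) → (c ∷ λ j → trans (sym (x≗y j)) (eq j)) s }
    ; has-0  = (0ᶠ ∷ λ j → sym (trans (cong (_+ᶠ 0ᶠ) (zeroˡ (e j))) (+ᶠ-identityˡ 0ᶠ))) (has-0 S)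
    ; has-+  = λ { ((_∷_ {y = y} c p) s) ((_∷_ {y = z} d q) t) → ((c +ᶠ d) ∷ λ j → trans (cong₂ _+ᶠ_ (p j) (q j))
        (solve 5 (λ c d e y z → (((c :* e) :+ y) :+ ((d :* e) :+ z)) := (((c :+ d) :* e) :+ (y :+ z))) refl c d (e j) (y j) (z j)))
        (has-+ S s t) }
    ; has-·  = λ { a ((_∷_ {y = y} c p) s) → ((a *ᶠ c) ∷ λ j → trans (cong (a *ᶠ_) (p j))
        (solve 4 (λ a c e y → (a :* ((c :* e) :+ y)) := (((a :* c) :* e) :+ (a :* y))) refl a c (e j) (y j)))
        (has-· S a s) } }
    where S = span-subspace es

  span-within : ∀ {A es} → Subspace A → All A es → ∀ {x} → Span es x → A x
  span-within S [] ([] x≗0) = resp-≗ S (λ j → sym (x≗0 j)) (has-0 S)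
  span-within S (a ∷ as) ((c ∷ eq) s) =
    resp-≗ S (λ j → sym (eq j)) (has-+ S (has-· S c a) (span-within S as s))

  span-++ : ∀ es {fs x} → Span (es List.++ fs) x → ∃₂ λ y z → Span es y × Span fs z × x ≗ y +ⱽ z
  span-++ [] {x = x} s = 0ⱽ , x , [] (λ _ → refl) , s , λ j → sym (+ᶠ-identityˡ (x j))
  span-++ (e ∷ es) ((_∷_ {y = u} c eq) s) with y , z , sy , sz , eq′ ← span-++ es s =
    c ·ⱽ e +ⱽ y , z , (c ∷ λ _ → refl) sy , sz ,
    λ j → trans (eq j) (trans (cong (c *ᶠ e j +ᶠ_) (eq′ j)) (sym (+ᶠ-assoc (c *ᶠ e j) (y j) (z j))))

  -- Independence modulo A, reading the list from the right.
  Indep : (V → Set) → List V → Set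
  Indep A []       = ⊤
  Indep A (e ∷ es) = (∀ x → Span es x → ¬ A (e +ⱽ x)) × Indep A es

  indep-anti : ∀ {A B} → (∀ {x} → B x → A x) → ∀ es → Indep A es → Indep B es
  indep-anti B⊆A []       _         = tt
  indep-anti B⊆A (e ∷ es) (i , is) = (λ x s b → i x s (B⊆A b)) , indep-anti B⊆A es is

  -- Codimensions add up along `A₁ ⊆ A`: the part of a combination spanned by `fs` lies in `A`, so a
  -- relation modulo `A₁` would give one among `es` modulo `A`.
  indep-++ : ∀ {A A₁} → Subspace A → (∀ {x} → A₁ x → A x) → ∀ es {fs} →
             Indep A es → All A fs → Indep A₁ fs → Indep A₁ (es List.++ fs)
  indep-++ S sub []       _        _  is′ = is′
  indep-++ S sub (e ∷ es) (i , is) as is′ = (λ x s a →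
      let y , z , sy , sz , eq = span-++ es s
      in i y sy (has-difference S (span-within S as sz) (resp-≗ S
           (λ j → trans (cong (e j +ᶠ_) (eq j)) (solve 3 (λ e y z → ((e :+ (y :+ z))) := ((z :+ (e :+ y)))) refl (e j) (y j) (z j)))
           (sub a)))) ,
    indep-++ S sub es is as is′

  Distinct : (V → Set) → V → V → Set
  Distinct A x y = ¬ A (-ⱽ x +ⱽ y)

  combinations : ∀ es → List (∃ (Span es))
  combinations []       = (0ⱽ , [] λ _ → refl) ∷ []
  combinations (e ∷ es) = List.cartesianProductWith (λ c (x , s) → c ·ⱽ e +ⱽ x , (c ∷ λ _ → refl) s)
    (List.allFin n) (combinations es)

  length-combinations : ∀ es → length (combinations es) ≡ n ^ length es
  length-combinations []       = refl
  length-combinations (e ∷ es) = trans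
    (length-product {R = λ _ _ → ⊤} {S = λ _ _ → ⊤} {T = λ _ _ → ⊤} _ (λ _ _ _ → tt) (λ _ _ → tt) (List.allFin n) (combinations es))
    (cong₂ _*_ (length-tabulate {n = n} id) (length-combinations es))

  -- If leading coefficients `c ≠ d` gave the same class, dividing the difference by `d - c` would
  -- put `e` plus a combination of `es` into `A`.
  combinations-distinct : ∀ {A} → Subspace A → ∀ es → Indep A es →
    AllPairs (λ p q → Distinct A (proj₁ p) (proj₁ q)) (combinations es)
  combinations-distinct S []       _        = [] ∷ []
  combinations-distinct {A} S (e ∷ es) (i , is) =
    allPairs-product {R = _≢_} {S = λ p q → Distinct A (proj₁ p) (proj₁ q)} {T = λ p q → Distinct A (proj₁ p) (proj₁ q)}
      _ differ₁ (λ {p} {q} → differ₂ {p} {q}) (AllPairs.tabulate⁺ id) (combinations-distinct S es is)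
    where
    differ₁ : ∀ {c d} → c ≢ d → ∀ p q → Distinct A (c ·ⱽ e +ⱽ proj₁ p) (d ·ⱽ e +ⱽ proj₁ q)
    differ₁ {c} {d} c≢d (x , s) (y , t) a with r , r-inv ← invertible (d +ᶠ -ᶠ c) (c≢d ∘ sym ∘ difference-0 d c) =
      i (r ·ⱽ (-ⱽ x +ⱽ y)) (has-· T r (has-+ T (has-- T s) t)) (resp-≗ S
        (λ j → trans (cong (λ z → r *ᶠ (z +ᶠ (d *ᶠ e j +ᶠ y j)))
                   (trans (sym (-ᶠ-+ (c *ᶠ e j) (x j))) (cong (_+ᶠ -ᶠ x j) (-‿distribˡ-* c (e j)))))
               (trans (solve 6 (λ r c- d e x- y → (r :* (((c- :* e) :+ x-) :+ ((d :* e) :+ y))) :=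
                                 (((r :* (d :+ c-)) :* e) :+ (r :* (x- :+ y)))) refl r (-ᶠ c) d (e j) (-ᶠ x j) (y j))
                 (cong (_+ᶠ r *ᶠ (-ᶠ x j +ᶠ y j)) (trans (cong (_*ᶠ e j) r-inv) (*ᶠ-identityˡ (e j))))))
        (has-· S r a))
      where
      T = span-subspace es
    differ₂ : ∀ {p q} → Distinct A (proj₁ p) (proj₁ q) → ∀ c → Distinct A (c ·ⱽ e +ⱽ proj₁ p) (c ·ⱽ e +ⱽ proj₁ q)
    differ₂ {x , _} {y , _} x#y c a = x#y (resp-≗ S
      (λ j → trans (cong (_+ᶠ (c *ᶠ e j +ᶠ y j)) (sym (-ᶠ-+ (c *ᶠ e j) (x j))))
        (trans (solve 4 (λ u u- x- y → ((u- :+ x-) :+ (u :+ y)) := (x- :+ (u- :+ (u :+ y)))) refl (c *ᶠ e j) (-ᶠ (c *ᶠ e j)) (-ᶠ x j) (y j))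
                   (cong (-ᶠ x j +ᶠ_) (cancelˡ (c *ᶠ e j) (y j))))) a)

length-concat : ∀ {X : Set} {ν} (Ss : List (List X)) → All (λ S → length S ≤ ν) Ss → length (List.concat Ss) ≤ length Ss * ν
length-concat []       []       = z≤n
length-concat (S ∷ Ss) (p ∷ ps) =
  ≤-trans (≤-reflexive (length-++ S)) (+-mono-≤ p (length-concat Ss ps))

-- Translations and their action on words

module Translations {n : ℕ} (F : Field n) {m : ℕ} where
  open Field F
  open Linear F {m} public

  τ : Fin n → Permutation′ n
  τ a = Perm.permutation (a +ᶠ_) (-ᶠ a +ᶠ_) (λ b → cancelˡ′ a b) (λ b → cancelˡ a b)

  τ-+ : ∀ a b → τ (a +ᶠ b) ≈ τ a ⊙ τ b
  τ-+ a b x = +ᶠ-assoc a b x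

  τ-0 : τ 0ᶠ ≈ Perm.id
  τ-0 x = +ᶠ-identityˡ x

  translate : ∀ {k} → (Fin k → Fin n) → Tuple n k
  translate x i = τ (x i)

  translate-cong : ∀ {k} {x y : Fin k → Fin n} → x ≗ y → translate x ≋ translate y
  translate-cong x≗y i b = cong (_+ᶠ b) (x≗y i)

  -- Asking for all multiples yields a linear subspace also over the field with four elements, where
  -- the translations in `U` need only form an additive group.
  core : Subgroup n m → V → Set
  core U w = ∀ c → mem U (translate (c ·ⱽ w))

  core-subspace : ∀ U → Subspace (core U)
  core-subspace U = record
    { resp-≗ = λ x≗y u c → resp U (translate-cong λ j → cong (c *ᶠ_) (x≗y j)) (u c)
    ; has-0  = λ c → resp U (λ j x → sym (trans (cong (_+ᶠ x) (zeroʳ c)) (τ-0 x))) (mem-ε U)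
    ; has-+  = λ {x} {y} u v c → resp U (λ j z → sym (trans (cong (_+ᶠ z) (distribˡᶠ c (x j) (y j)))
        (τ-+ (c *ᶠ x j) (c *ᶠ y j) z))) (mem-∙ U (u c) (v c))
    ; has-·  = λ d {x} u c → resp U (translate-cong λ j → *ᶠ-assoc c d (x j)) (u (c *ᶠ d)) }

  core-mem : ∀ U {w} → core U w → mem U (translate w)
  core-mem U {w} u = resp U (translate-cong λ j → *ᶠ-identityˡ (w j)) (u 1ᶠ)

  ext : V → ℕ → Fin n
  ext w zero = 0ᶠ
  ext w (suc p) with p <? m
  ... | yes p<m = w (fromℕ< p<m)
  ... | no  _   = 0ᶠ

  -- The discrete derivative of `w`, extended by 0 at both ends. On a tuple of translations,
  -- `translate w` acts by adding `∂ w`.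
  ∂ : V → Fin (suc m) → Fin n
  ∂ w i = ext w (suc (toℕ i)) +ᶠ -ᶠ ext w (toℕ i)

  pad-translate : ∀ w p → pad (translate w) p ≈ τ (ext w p)
  pad-translate w zero x = sym (τ-0 x)
  pad-translate w (suc p) x with p <? m
  ... | yes _ = refl
  ... | no  _ = sym (τ-0 x)

  ext-+ : ∀ x y p → ext (x +ⱽ y) p ≡ ext x p +ᶠ ext y p
  ext-+ x y zero = sym (+ᶠ-identityˡ 0ᶠ)
  ext-+ x y (suc p) with p <? m
  ... | yes _ = refl
  ... | no  _ = sym (+ᶠ-identityˡ 0ᶠ)

  ext-· : ∀ c x p → ext (c ·ⱽ x) p ≡ c *ᶠ ext x p
  ext-· c x zero = sym (zeroʳ c)
  ext-· c x (suc p) with p <? m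
  ... | yes _ = refl
  ... | no  _ = sym (zeroʳ c)

  ext-cong : ∀ {x y} → x ≗ y → ∀ p → ext x p ≡ ext y p
  ext-cong x≗y zero = refl
  ext-cong x≗y (suc p) with p <? m
  ... | yes _ = x≗y _
  ... | no  _ = refl

  ∂-cong : ∀ {x y} → x ≗ y → ∂ x ≗ ∂ y
  ∂-cong x≗y i = cong₂ (λ a b → a +ᶠ -ᶠ b) (ext-cong x≗y (suc (toℕ i))) (ext-cong x≗y (toℕ i))

  ∂-+ : ∀ x y i → ∂ (x +ⱽ y) i ≡ ∂ x i +ᶠ ∂ y i
  ∂-+ x y i = trans (cong₂ (λ a b → a +ᶠ -ᶠ b) (ext-+ x y q) (ext-+ x y p))
    (trans (cong (ext x q +ᶠ ext y q +ᶠ_) (sym (-ᶠ-+ (ext x p) (ext y p))))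
      (solve 4 (λ a b c d → ((a :+ b) :+ (c :+ d)) := ((a :+ c) :+ (b :+ d))) refl
        (ext x q) (ext y q) (-ᶠ ext x p) (-ᶠ ext y p)))
    where
    p = toℕ i
    q = suc p

  ∂-· : ∀ c x i → ∂ (c ·ⱽ x) i ≡ c *ᶠ ∂ x i
  ∂-· c x i = trans (cong₂ (λ a b → a +ᶠ -ᶠ b) (ext-· c x (suc (toℕ i))) (ext-· c x (toℕ i)))
    (trans (cong (c *ᶠ ext x (suc (toℕ i)) +ᶠ_) (-‿distribʳ-* c (ext x (toℕ i))))
      (sym (distribˡᶠ c _ _)))

  ∂-- : ∀ x i → ∂ (-ⱽ x) i ≡ -ᶠ ∂ x i
  ∂-- x i = trans (∂-cong (λ j → sym (-1*x≈-x (x j))) i) (trans (∂-· (-ᶠ 1ᶠ) x i) (-1*x≈-x (∂ x i)))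

  ∂-0 : ∀ i → ∂ 0ⱽ i ≡ 0ᶠ
  ∂-0 i = trans (∂-cong (λ _ → sym (zeroˡ 0ᶠ)) i) (trans (∂-· 0ᶠ 0ⱽ i) (zeroˡ _))

  translate-▷ : ∀ w (M : Tuple n (suc m)) x → M ≋ translate x → translate w ▷ M ≋ translate (λ i → x i +ᶠ ∂ w i)
  translate-▷ w M x M≋ i b =
    trans (≈⇒≈ˡ (pad (translate w) (toℕ i)) (τ p) (pad-translate w (toℕ i)) _)
    (trans (cong (-ᶠ p +ᶠ_) (trans (cong (M i ⟨$⟩ʳ_) (pad-translate w (suc (toℕ i)) b)) (M≋ i _)))
      (solve 4 (λ p- x q b → (p- :+ (x :+ (q :+ b))) := ((x :+ (q :+ p-)) :+ b)) refl (-ᶠ p) (x i) q b))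
    where
    p = ext w (toℕ i)
    q = ext w (suc (toℕ i))

module _ {n m : ℕ} (F : Field n) where
  open Field F
  open Translations F {m}

  -- Conjugation by `μ` multiplies a translation by `c`, while `ρ` and `translate w` commute with
  -- `translate x`.
  scale-conjugate : ∀ (U : Subgroup n m) c (μ : Permutation′ n) → (∀ a → μ ⟨$⟩ʳ a ≡ c *ᶠ a) →
    ∀ (ρ : Tuple n m) w x → (∀ j y → ρ j ⟨$⟩ʳ (x j +ᶠ y) ≡ x j +ᶠ (ρ j ⟨$⟩ʳ y)) →
    mem U ((λ j → μ ⊙ ρ j) ∙ translate w) → mem U (translate x) → mem U (translate (c ·ⱽ x))
  scale-conjugate U c μ μ≗c ρ w x commutes g∈U x∈U =
    resp U {g ∙ translate x ∙ inv g} conjugated (mem-∙ U (mem-∙ U g∈U x∈U) (mem-inv U g∈U))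
    where
    g : Tuple n m
    g = (λ j → μ ⊙ ρ j) ∙ translate w
    conjugated : ∀ j → (g ∙ translate x ∙ inv g) j ≈ τ (c *ᶠ x j)
    conjugated j z = begin
      μ ⟨$⟩ʳ (ρ j ⟨$⟩ʳ (w j +ᶠ (x j +ᶠ y)))   ≡⟨ cong (λ y → μ ⟨$⟩ʳ (ρ j ⟨$⟩ʳ y)) swap ⟩
      μ ⟨$⟩ʳ (ρ j ⟨$⟩ʳ (x j +ᶠ (w j +ᶠ y)))   ≡⟨ cong (μ ⟨$⟩ʳ_) (commutes j (w j +ᶠ y)) ⟩
      μ ⟨$⟩ʳ (x j +ᶠ y′)                       ≡⟨ μ≗c (x j +ᶠ y′) ⟩
      c *ᶠ (x j +ᶠ y′)                         ≡⟨ distribˡᶠ c (x j) y′ ⟩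
      c *ᶠ x j +ᶠ c *ᶠ y′                      ≡⟨ cong (c *ᶠ x j +ᶠ_) (trans (sym (μ≗c y′)) (Perm.inverseʳ (g j))) ⟩
      c *ᶠ x j +ᶠ z                            ∎
      where
      open ≡-Reasoning
      y = g j ⟨$⟩ˡ z
      y′ = ρ j ⟨$⟩ʳ (w j +ᶠ y)
      swap : w j +ᶠ (x j +ᶠ y) ≡ x j +ᶠ (w j +ᶠ y)
      swap = trans (sym (+ᶠ-assoc (w j) (x j) y)) (trans (cong (_+ᶠ y) (+ᶠ-comm (w j) (x j))) (+ᶠ-assoc (x j) (w j) y))

-- Descent with translations as moves

module FieldCase {n : ℕ} (F : Field n) {m : ℕ} where
  open Field F
  open Translations F {m}

  -- Vectors are coded by a finite ordinal because `Descent` selects least moves.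
  Move : Set
  Move = Fin (n ^ suc m)

  vec : Move → Fin (suc m) → Fin n
  vec = Fin.finToFun

  -- Only tuples of translations are compared. These commute, so shifts act on them linearly through
  -- `∂`.
  rel : Move → Tuple n (suc m) → Tuple n (suc m) → Set
  rel v M M′ = ∃ λ x → M ≋ translate x × M′ ≋ translate (λ i → x i +ᶠ vec v i)

  Trans : Tuple n m → Set
  Trans u = ∃ λ w → u ≋ translate w

  Good : (V → Set) → ℕ → Move → Set
  Good A μ v = ∀ S → length S < μ → ¬ ¬ ∃ λ w → A w × All (λ i → vec v i +ᶠ ∂ w i ≡ 0ᶠ) S

  Rank : (V → Set) → ℕ → Set
  Rank A t = ∃ λ es → length es ≡ t × Indep A es

  open Descent rel Trans core Good Rank

  trans-inv : ∀ u → Trans u → Trans (inv u)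
  trans-inv u (w , u≋w) = -ⱽ w , λ j x → ≈⇒≈ˡ (u j) (τ (w j)) (u≋w j) x

  conj : ∀ U U′ u → Trans u → (∀ {g} → mem U g → mem U′ (u ∙ g ∙ inv u)) → ∀ {x} → core U x → core U′ x
  conj U U′ u (w , u≋w) conj {x} a c = resp U′ (λ j b →
      trans (u≋w j _) (trans (cong (λ z → w j +ᶠ (c *ᶠ x j +ᶠ z)) (≈⇒≈ˡ (u j) (τ (w j)) (u≋w j) b))
        (trans (solve 4 (λ w cx w- b → (w :+ (cx :+ (w- :+ b))) := (w :+ (w- :+ (cx :+ b)))) refl (w j) (c *ᶠ x j) (-ᶠ w j) b)
               (cancelˡ′ (w j) _))))
    (conj (a c))

  shift : ∀ U v {w} → core U w → Shift U v (Fin.funToFin λ i → vec v i +ᶠ ∂ w i)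
  shift U v {w} a M M′ (x , M≋ , M′≋) = translate w , core-mem U a , (w , λ _ _ → refl) , x , M≋ ,
    λ i b → trans (translate-▷ w M′ _ M′≋ i b) (cong (_+ᶠ b)
      (trans (+ᶠ-assoc (x i) (vec v i) (∂ w i)) (cong (x i +ᶠ_) (sym (Fin.finToFun-funToFin (λ i → vec v i +ᶠ ∂ w i) i)))))

  avoid : ∀ U {μ v} → Good (core U) (suc (suc μ)) v → ∀ i →
          ¬ ¬ ∃ λ w → Shift U v w × ∀ M M′ → rel w M M′ → M i ≈ M′ i
  avoid U {v = v} good i = good (i ∷ []) (s≤s (s≤s z≤n)) >>= λ { (w , a , eq ∷ []) →
    pure (_ , shift U v a , λ { M M′ (x , M≋ , M′≋) b → trans (M≋ i b) (sym (trans (M′≋ i b) (cong (_+ᶠ b)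
      (trans (cong (x i +ᶠ_) (trans (Fin.finToFun-funToFin (λ i → vec v i +ᶠ ∂ w i) i) eq)) (+ᶠ-identityʳ (x i)))))) }) }

  -- Working modulo A₁ ⊆ A, sets S are chosen greedily such that ever fewer
  -- elements of A look on them like elements of A₁. Each choice yields one
  -- more independent vector; if no choice is left, then cancelling v on the
  -- union of the sets S chosen so far makes it avoidable by A₁.
  module _ (A A₁ : V → Set) (SA : Subspace A) (S₁ : Subspace A₁) (A₁⊆A : ∀ {x} → A₁ x → A x) where

    Near : List (Fin (suc m)) → V → Set
    Near S w = ¬ ¬ ∃ λ a → A₁ a × All (λ i → ∂ w i ≡ ∂ a i) S

    near-subspace : ∀ S → Subspace (Near S)
    near-subspace S = record
      { resp-≗ = λ x≗y nx → nx >>= λ (a , a∈ , eqs) →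
          pure (a , a∈ , All.map (λ {i} eq → trans (sym (∂-cong x≗y i)) eq) eqs)
      ; has-0  = pure (0ⱽ , has-0 S₁ , All.universal (λ _ → refl) S)
      ; has-+  = λ {x} {y} nx ny → nx >>= λ (a , a∈ , eqs) → ny >>= λ (b , b∈ , eqs′) →
          pure (a +ⱽ b , has-+ S₁ a∈ b∈ , All.zipWith
            (λ {i} (p , q) → trans (∂-+ x y i) (trans (cong₂ _+ᶠ_ p q) (sym (∂-+ a b i)))) (eqs , eqs′))
      ; has-·  = λ c {x} nx → nx >>= λ (a , a∈ , eqs) →
          pure (c ·ⱽ a , has-· S₁ c a∈ , All.map
            (λ {i} p → trans (∂-· c x i) (trans (cong (c *ᶠ_) p) (sym (∂-· c a i)))) eqs) }

    AllNear : List (List (Fin (suc m))) → V → Set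
    AllNear Ss w = A w × All (λ S → Near S w) Ss

    module _ (ν : ℕ) where

      Chain : ℕ → List (List (Fin (suc m))) → Set
      Chain f Ss = ∃ λ es → length es ≡ f × All (AllNear Ss) es × Indep A₁ es

      Saturated : ℕ → Set
      Saturated f = ∃ λ Ss → length Ss < f × All (λ S → length S ≤ ν) Ss ×
        ∀ S → length S ≤ ν → ∀ w → AllNear Ss w → Near S w

      -- A chosen `e` is far from `A₁` on its set `S`, whereas all later vectors are near to `A₁` on
      -- `S`. Hence no sum of `e` and a combination of later vectors lies in `A₁`.
      greedy : ∀ f Ss → All (λ S → length S ≤ ν) Ss → ¬ ¬ (Chain f Ss ⊎ Saturated (f + length Ss))
      greedy zero Ss small = pure (inj₁ ([] , refl , [] , tt))
      greedy (suc f) Ss small =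
        ¬¬-excluded-middle {A = ∃₂ λ S e → length S ≤ ν × AllNear Ss e × ¬ Near S e} >>= λ where
          (no none) → pure (inj₂ (Ss , s≤s (m≤n+m (length Ss) f) , small ,
            λ S S≤ w near → λ ¬near → none (S , w , S≤ , near , λ n → n ¬near)))
          (yes (S , e , S≤ , near , far)) → greedy f (S ∷ Ss) (S≤ ∷ small) >>= λ where
            (inj₁ (es , len , nears , indep)) → pure (inj₁ (e ∷ es , cong suc len ,
              near ∷ All.map (λ { (a , _ ∷ ns) → a , ns }) nears ,
              (λ x s a₁ → far (has-difference (near-subspace S)
                (span-within (near-subspace S) (All.map (λ { (_ , n ∷ _) → n }) nears) s)
                (λ ¬n → ¬n (_ , resp-≗ S₁ (λ j → +ᶠ-comm (e j) (x j)) a₁ , All.universal (λ _ → refl) S)))) ,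
              indep))
            (inj₂ (Ss′ , len , small′ , sat)) → pure (inj₂ (Ss′ ,
              ≤-trans len (≤-reflexive (+-suc f (length Ss))) , small′ , sat))

    -- Let `w` cancel `v` on the union `S*`, and `w′` on `S*` and a further set `S`. Then `w - w′`
    -- has derivative 0 on `S*`, so by saturation it looks on `S` like some `a` in `A₁`, and `-a`
    -- cancels `v + ∂ w` on `S`. The sizes add up to at most `(t + 1) ν`.
    saturated⇒good : ∀ {μ ν t} v → Good A μ v → suc t * ν < μ → Saturated ν (suc t) →
      ¬ ¬ ∃ λ w → A w × Good A₁ (suc ν) (Fin.funToFin λ i → vec v i +ᶠ ∂ w i)
    saturated⇒good {μ} {ν} {t} v good small (Ss , len , Ss≤ , sat) =
      good S* (≤-<-trans S*≤ (≤-<-trans (m≤n+m (t * ν) ν) small)) >>= λ (w , w∈ , w-on) → pure (w , w∈ , λ S S< →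
      good (S* List.++ S) (≤-<-trans (≤-trans (≤-reflexive (length-++ S*)) (≤-trans (+-mono-≤ S*≤ (s≤s⁻¹ S<)) (≤-reflexive (+-comm (t * ν) ν)))) small) >>= λ (w′ , w′∈ , w′-on) →
      let d = w +ⱽ -ⱽ w′
          d-on : All (λ i → ∂ d i ≡ 0ᶠ) S*
          d-on = All.zipWith (λ {i} (p , q) → agree w w′ i p q) (w-on , All.++⁻ˡ S* w′-on)
      in sat S (s≤s⁻¹ S<) d (has-+ SA w∈ (has-- SA w′∈) , concat-near Ss d-on) >>= λ (a , a∈ , a-on) →
      pure (-ⱽ a , has-- S₁ a∈ , All.zipWith (λ {i} (p , q) → final w w′ a i p q) (a-on , All.++⁻ʳ S* w′-on)))
      where
      concat-near : ∀ {d} Ss → All (λ i → ∂ d i ≡ 0ᶠ) (List.concat Ss) → All (λ S → Near S d) Ss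
      concat-near []       ps = []
      concat-near (S ∷ Ss) ps =
        pure (0ⱽ , has-0 S₁ , All.map (λ {i} p → trans p (sym (∂-0 i))) (All.++⁻ˡ S ps)) ∷ concat-near Ss (All.++⁻ʳ S ps)
      S* = List.concat Ss
      S*≤ : length S* ≤ t * ν
      S*≤ = ≤-trans (length-concat Ss Ss≤) (*-monoˡ-≤ ν (s≤s⁻¹ len))
      ∂-difference : ∀ w w′ i → ∂ (w +ⱽ -ⱽ w′) i ≡ ∂ w i +ᶠ -ᶠ ∂ w′ i
      ∂-difference w w′ i = trans (∂-+ w (-ⱽ w′) i) (cong (∂ w i +ᶠ_) (∂-- w′ i))
      agree : ∀ w w′ i → vec v i +ᶠ ∂ w i ≡ 0ᶠ → vec v i +ᶠ ∂ w′ i ≡ 0ᶠ → ∂ (w +ⱽ -ⱽ w′) i ≡ 0ᶠ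
      agree w w′ i p q = trans (∂-difference w w′ i) (trans (cong (_+ᶠ -ᶠ ∂ w′ i) (+ᶠ-cancelˡ (vec v i) _ _ (trans p (sym q)))) (+ᶠ-inverseʳ (∂ w′ i)))
      final : ∀ w w′ a i → ∂ (w +ⱽ -ⱽ w′) i ≡ ∂ a i → vec v i +ᶠ ∂ w′ i ≡ 0ᶠ →
              vec (Fin.funToFin λ i → vec v i +ᶠ ∂ w i) i +ᶠ ∂ (-ⱽ a) i ≡ 0ᶠ
      final w w′ a i p q = trans (cong₂ _+ᶠ_ (Fin.finToFun-funToFin (λ i → vec v i +ᶠ ∂ w i) i)
          (trans (∂-- a i) (cong -ᶠ_ (trans (sym p) (∂-difference w w′ i)))))
        (trans (cong (λ z → vec v i +ᶠ ∂ w i +ᶠ z) (trans (sym (-ᶠ-+ (∂ w i) (-ᶠ ∂ w′ i))) (cong (-ᶠ ∂ w i +ᶠ_) (-ᶠ-involutive (∂ w′ i)))))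
        (trans (solve 4 (λ v w w- w′ → ((v :+ w) :+ (w- :+ w′)) := (w :+ (w- :+ (v :+ w′)))) refl (vec v i) (∂ w i) (-ᶠ ∂ w i) (∂ w′ i))
        (trans (cancelˡ′ (∂ w i) _) q)))

  refine : ∀ U U₁ {μ T v} → (∀ {g} → mem U₁ g → mem U g) →
           Good (core U) μ v → Rank (core U) T → ¬ ¬ ∃ (Refines U U₁ μ T v)
  refine U U₁ {zero} {T} {v} sub good (es , len , ind) = pure
    (_ , 0 , 0 , z≤n , (λ S ()) , (es , trans len (sym (+-identityʳ T)) , indep-anti (λ a c → sub (a c)) es ind) ,
     shift U v (has-0 (core-subspace U)))
  refine U U₁ {suc μ} {T} {v} sub good (es , len , ind) = search μ 0 refl ([] , refl , [] , tt)
    where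
    A = core U
    A₁ = core U₁
    SA = core-subspace U
    S₁ = core-subspace U₁
    A₁⊆A : ∀ {x} → A₁ x → A x
    A₁⊆A a c = sub (a c)

    NewVectors : ℕ → Set
    NewVectors t = ∃ λ fs → length fs ≡ t × All A fs × Indep A₁ fs

    finish : ∀ {t ν} → suc μ ≤ suc ν * suc t → suc t * ν < suc μ → NewVectors t →
             Saturated A A₁ SA S₁ A₁⊆A ν (suc t) → ¬ ¬ ∃ (Refines U U₁ (suc μ) T v)
    finish {t} {ν} le small (fs , len′ , inA , ind′) sat =
      saturated⇒good A A₁ SA S₁ A₁⊆A v good small sat >>= λ (w , w∈ , good′) →
      pure (_ , t , suc ν , le , good′ ,
        (es List.++ fs , trans (length-++ es) (cong₂ _+_ len len′) , indep-++ SA A₁⊆A es ind inA ind′) ,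
        shift U v w∈)

    -- Given `t` new vectors, `ν` is the largest number with `(t + 1) ν ≤ μ`, so that
    -- `μ < (t + 1)(ν + 1)`. The greedy choice starts afresh for this `ν` and either saturates or
    -- produces `t + 1` new vectors. At `t = μ` one has `ν = 0`, and saturation concerns only the
    -- empty set.
    search : ∀ f t → t + f ≡ μ → NewVectors t → ¬ ¬ ∃ (Refines U U₁ (suc μ) T v)
    search zero t t≡μ new = finish
      (≤-reflexive (sym (trans (+-identityʳ _) (cong suc (trans (sym (+-identityʳ t)) t≡μ)))))
      (≤-trans (s≤s (≤-reflexive (*-zeroʳ t))) (s≤s z≤n)) new
      ([] , s≤s z≤n , [] , λ { [] _ w _ → pure (0ⱽ , has-0 S₁ , []) ; (_ ∷ _) () })
    search (suc f) t t+f≡μ new = greedy A A₁ SA S₁ A₁⊆A ν (suc t) [] [] >>= λ where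
        (inj₁ (fs , len′ , nears , ind′)) →
          search f (suc t) (trans (sym (+-suc t f)) t+f≡μ) (fs , len′ , All.map proj₁ nears , ind′)
        (inj₂ sat) → finish
          (≤-trans (s≤s (≤-trans (≤-reflexive μ≡) (+-monoˡ-≤ (ν * suc t) (s≤s⁻¹ (m%n<n μ (suc t))))))
                   ≤-refl)
          (s≤s (≤-trans (≤-reflexive (*-comm (suc t) ν)) (≤-trans (m≤n+m (ν * suc t) _) (≤-reflexive (sym μ≡)))))
          new (subst (Saturated A A₁ SA S₁ A₁⊆A ν) (+-identityʳ (suc t)) sat)
      where
      ν = μ / suc t
      μ≡ : μ ≡ μ % suc t + ν * suc t
      μ≡ = m≡m%n+[m/n]*n μ (suc t)

  δ : Fin (suc m) → Fin n
  δ zero    = 1ᶠ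
  δ (suc _) = 0ᶠ

  start : Move
  start = Fin.funToFin δ

  good-start : Good (core full) (suc m) start
  good-start S len with fresh S len
  ... | i₀ , i₀∉S = pure (w , (λ _ → tt) , All.tabulate λ {i} i∈S →
          trans (cong (_+ᶠ ∂ w i) (Fin.finToFun-funToFin δ i)) (cancels i λ { refl → i₀∉S i∈S }))
    where
    -- For `i₀ ≠ 0` the derivative of `w` is `-1` at the first matrix, `1` at `i₀` and 0 elsewhere:
    -- it moves the translation by `1` from the first matrix to `i₀`, outside `S`.
    step : ℕ → Fin n
    step q with q <? toℕ i₀
    ... | yes _ = -ᶠ 1ᶠ
    ... | no  _ = 0ᶠ
    w : V
    w j = step (toℕ j)
    ext-w : ∀ q → ext w (suc q) ≡ step q
    ext-w q with q <? m
    ... | yes q<m = cong step (Fin.toℕ-fromℕ< q<m)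
    ... | no q≮m with q <? toℕ i₀
    ...   | yes q<i₀ = contradiction (≤-trans q<i₀ (s≤s⁻¹ (Fin.toℕ<n i₀))) q≮m
    ...   | no _ = refl
    -0≡0 : -ᶠ 0ᶠ ≡ 0ᶠ
    -0≡0 = trans (sym (+ᶠ-identityˡ _)) (+ᶠ-inverseʳ 0ᶠ)
    cancels : ∀ i → i ≢ i₀ → δ i +ᶠ ∂ w i ≡ 0ᶠ
    cancels zero 0≢i₀ = trans (cong (λ z → 1ᶠ +ᶠ (z +ᶠ -ᶠ 0ᶠ)) (trans (ext-w 0) step-0))
      (trans (cong (λ z → 1ᶠ +ᶠ (-ᶠ 1ᶠ +ᶠ z)) -0≡0) (cancelˡ′ 1ᶠ 0ᶠ))
      where
      step-0 : step 0 ≡ -ᶠ 1ᶠ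
      step-0 with 0 <? toℕ i₀
      ... | yes _ = refl
      ... | no 0≮ = contradiction (Fin.toℕ-injective (sym (n≤0⇒n≡0 (≮⇒≥ 0≮)))) 0≢i₀
    cancels (suc i) i≢i₀ = trans (+ᶠ-identityˡ _)
      (trans (cong₂ (λ a b → a +ᶠ -ᶠ b) (ext-w (suc (toℕ i))) (ext-w (toℕ i)))
        (trans (cong (λ a → a +ᶠ -ᶠ step (toℕ i)) same) (+ᶠ-inverseʳ _)))
      where
      same : step (suc (toℕ i)) ≡ step (toℕ i)
      same with suc (toℕ i) <? toℕ i₀ | toℕ i <? toℕ i₀
      ... | yes _ | yes _ = refl
      ... | yes p | no q  = contradiction (≤-trans (n≤1+n _) p) q
      ... | no p  | yes q = contradiction (Fin.toℕ-injective (≤-antisym q (≮⇒≥ p))) i≢i₀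
      ... | no _  | no _  = refl

  good-mono : ∀ {A B : V → Set} {μ v} → (∀ {x} → A x → B x) → Good A μ v → Good B μ v
  good-mono A⊆B good S len = good S len >>= λ (w , a , on) → pure (w , A⊆B a , on)

  rank-anti : ∀ {A B : V → Set} {T} → (∀ {x} → B x → A x) → Rank A T → Rank B T
  rank-anti B⊆A (es , len , ind) = es , len , indep-anti B⊆A es ind

  open Run good-mono rank-anti trans-inv conj refine avoid public

module FieldBound {n′ : ℕ} (F : Field (suc n′)) {m : ℕ} where
  open Field F
  open Translations F {m}
  open FieldCase F {m}

  private
    N = suc n′

  sensitive : ∀ Φ → Computes Φ (Word N (suc m)) →
              Descent.Sensitive rel Trans core Good Rank Φ start
  sensitive Φ computes = M , M′ , ((λ _ → 0ᶠ) , (λ _ _ → refl) , λ _ _ → refl) ,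
    λ eq → contradiction (trans (sym (trans (word-value {Φ = Φ} computes M) value₁)) (trans eq (trans (word-value {Φ = Φ} computes M′) value₂))) λ ()
    where
    M M′ : Tuple N (suc m)
    M  = translate λ _ → 0ᶠ
    M′ = translate λ i → 0ᶠ +ᶠ vec start i
    vec-start : ∀ i → 0ᶠ +ᶠ vec start i ≡ δ i
    vec-start i = trans (+ᶠ-identityˡ _) (Fin.finToFun-funToFin δ i)
    -- The point `zero` need not be the zero of the field, but translation by `1ᶠ` moves every
    -- point.
    moved : compose M′ ⟨$⟩ʳ zero ≢ zero
    moved eq = 1≢0 (trans (sym (+ᶠ-identityʳ 1ᶠ)) (+ᶠ-cancelʳ zero _ _ (trans
      (cong (_+ᶠ zero) (+ᶠ-identityʳ 1ᶠ))
      (trans (trans (sym (trans (cong (_+ᶠ (compose (M′ ∘ suc) ⟨$⟩ʳ zero)) (vec-start zero))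
        (cong (1ᶠ +ᶠ_) (compose-id (M′ ∘ suc) (λ i x → trans (cong (_+ᶠ x) (vec-start (suc i))) (+ᶠ-identityˡ x)) zero)))) eq)
        (sym (+ᶠ-identityˡ zero))))))
    value₁ : does (zero Fin.≟ (compose M ⟨$⟩ʳ zero)) ≡ true
    value₁ = cong (λ x → does (zero {n = n′} Fin.≟ x)) (compose-id M (λ _ → τ-0) zero)
    value₂ : does (zero Fin.≟ (compose M′ ⟨$⟩ʳ zero)) ≡ false
    value₂ with zero Fin.≟ (compose M′ ⟨$⟩ʳ zero)
    ... | yes eq = contradiction (sym eq) moved
    ... | no _   = refl

  field-bound : (∀ U es → Indep (core U) es → ¬ ¬ Index≥ U (N ^ length es)) → WordBound N m
  field-bound index = word-bound (λ { U _ (es , refl , ind) → index U es ind })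
    start good-start ([] , refl , tt) sensitive

  -- Over a prime field every subgroup is a subspace.
  prime-index : (∀ U w → mem U (translate w) → core U w) →
                ∀ U es → Indep (core U) es → ¬ ¬ Index≥ U (N ^ length es)
  prime-index prime U es ind = pure
    ( List.map (translate ∘ proj₁) (combinations es)
    , ≤-reflexive (sym (trans (length-map _ (combinations es)) (length-combinations es)))
    , AllPairs.map⁺ (AllPairs.map (λ { {x , _} {y , _} x#y u → x#y (prime U _ (resp U (λ j b → sym (+ᶠ-assoc (-ᶠ x j) (y j) b)) u)) })
        (combinations-distinct (core-subspace U) es ind)) )

-- The fields with 2, 3 and 4 elements

module _ {n : ℕ} (add mul : Vec (Vec (Fin n) n) n) (neg recip : Vec (Fin n) n) (o i : Fin n) where

  private
    _⊹_ _⋆_ : Fin n → Fin n → Fin n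
    a ⊹ b = lookup (lookup add a) b
    a ⋆ b = lookup (lookup mul a) b

  Associative Commutative Distributive Neutral Inverses : Set
  Associative  = ∀ a b c → (a ⊹ b) ⊹ c ≡ a ⊹ (b ⊹ c) × (a ⋆ b) ⋆ c ≡ a ⋆ (b ⋆ c)
  Commutative  = ∀ a b → a ⊹ b ≡ b ⊹ a × a ⋆ b ≡ b ⋆ a
  Distributive = ∀ a b c → a ⋆ (b ⊹ c) ≡ (a ⋆ b) ⊹ (a ⋆ c)
  Neutral      = ∀ a → o ⊹ a ≡ a × i ⋆ a ≡ a
  Inverses     = ∀ a → lookup neg a ⊹ a ≡ o × (a ≡ o ⊎ lookup recip a ⋆ a ≡ i)

  laws? : Dec (Associative × Commutative × Distributive × Neutral × Inverses × ¬ i ≡ o)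
  laws? =
    Fin.all? (λ a → Fin.all? λ b → Fin.all? λ c →
      ((a ⊹ b) ⊹ c Fin.≟ a ⊹ (b ⊹ c)) ×-dec ((a ⋆ b) ⋆ c Fin.≟ a ⋆ (b ⋆ c))) ×-dec
    Fin.all? (λ a → Fin.all? λ b → (a ⊹ b Fin.≟ b ⊹ a) ×-dec (a ⋆ b Fin.≟ b ⋆ a)) ×-dec
    Fin.all? (λ a → Fin.all? λ b → Fin.all? λ c → a ⋆ (b ⊹ c) Fin.≟ (a ⋆ b) ⊹ (a ⋆ c)) ×-dec
    Fin.all? (λ a → (o ⊹ a Fin.≟ a) ×-dec (i ⋆ a Fin.≟ a)) ×-dec
    Fin.all? (λ a → (lookup neg a ⊹ a Fin.≟ o) ×-dec ((a Fin.≟ o) ⊎-dec (lookup recip a ⋆ a Fin.≟ i))) ×-dec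
    ¬? (i Fin.≟ o)

  table-field : True laws? → Field n
  table-field ok = record
    { _+ᶠ_ = _⊹_ ; _*ᶠ_ = _⋆_ ; -ᶠ_ = lookup neg ; 0ᶠ = o ; 1ᶠ = i
    ; isCommutativeRing = record
      { isRing = record
        { +-isAbelianGroup = record
          { isGroup = record
            { isMonoid = record
              { isSemigroup = record
                { isMagma = record { isEquivalence = isEquivalence ; ∙-cong = cong₂ _⊹_ }
                ; assoc = λ a b c → proj₁ (assoc a b c) }
              ; identity = (λ a → proj₁ (neutral a)) , λ a → trans (proj₁ (commut a o)) (proj₁ (neutral a)) }
            ; inverse = (λ a → proj₁ (inverses a)) , λ a → trans (proj₁ (commut a _)) (proj₁ (inverses a))
            ; ⁻¹-cong = cong (lookup neg) }
          ; comm = λ a b → proj₁ (commut a b) }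
        ; *-cong = cong₂ _⋆_
        ; *-assoc = λ a b c → proj₂ (assoc a b c)
        ; *-identity = (λ a → proj₂ (neutral a)) , λ a → trans (proj₂ (commut a i)) (proj₂ (neutral a))
        ; distrib = distributes , λ a b c → trans (proj₂ (commut (b ⊹ c) a))
            (trans (distributes a b c) (cong₂ _⊹_ (proj₂ (commut a b)) (proj₂ (commut a c)))) }
      ; *-comm = λ a b → proj₂ (commut a b) }
    ; invertible = λ c c≢0 → lookup recip c , Data.Sum.[ (λ c≡0 → contradiction c≡0 c≢0) , id ] (proj₂ (inverses c))
    ; 1≢0 = proj₂ (proj₂ (proj₂ (proj₂ (proj₂ laws)))) }
    where
    abstract
      laws : Associative × Commutative × Distributive × Neutral × Inverses × ¬ i ≡ o
      laws = toWitness {a? = laws?} ok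
    assoc = proj₁ laws
    commut = proj₁ (proj₂ laws)
    distributes = proj₁ (proj₂ (proj₂ laws))
    neutral = proj₁ (proj₂ (proj₂ (proj₂ laws)))
    inverses = proj₁ (proj₂ (proj₂ (proj₂ (proj₂ laws))))

pattern #0 = zero
pattern #1 = suc zero
pattern #2 = suc (suc zero)
pattern #3 = suc (suc (suc zero))

F₂ : Field 2
F₂ = table-field
  ((#0 ∷ #1 ∷ []) ∷ (#1 ∷ #0 ∷ []) ∷ [])
  ((#0 ∷ #0 ∷ []) ∷ (#0 ∷ #1 ∷ []) ∷ [])
  (#0 ∷ #1 ∷ []) (#0 ∷ #1 ∷ []) #0 #1 tt

F₃ : Field 3
F₃ = table-field
  ((#0 ∷ #1 ∷ #2 ∷ []) ∷ (#1 ∷ #2 ∷ #0 ∷ []) ∷ (#2 ∷ #0 ∷ #1 ∷ []) ∷ [])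
  ((#0 ∷ #0 ∷ #0 ∷ []) ∷ (#0 ∷ #1 ∷ #2 ∷ []) ∷ (#0 ∷ #2 ∷ #1 ∷ []) ∷ [])
  (#0 ∷ #2 ∷ #1 ∷ []) (#0 ∷ #1 ∷ #2 ∷ []) #0 #1 tt

-- Addition is bitwise exclusive or; `#2` generates the multiplicative group, with `#3` as its
-- square and as `#2 + #1`.
F₄ : Field 4
F₄ = table-field
  ((#0 ∷ #1 ∷ #2 ∷ #3 ∷ []) ∷ (#1 ∷ #0 ∷ #3 ∷ #2 ∷ []) ∷ (#2 ∷ #3 ∷ #0 ∷ #1 ∷ []) ∷ (#3 ∷ #2 ∷ #1 ∷ #0 ∷ []) ∷ [])
  ((#0 ∷ #0 ∷ #0 ∷ #0 ∷ []) ∷ (#0 ∷ #1 ∷ #2 ∷ #3 ∷ []) ∷ (#0 ∷ #2 ∷ #3 ∷ #1 ∷ []) ∷ (#0 ∷ #3 ∷ #1 ∷ #2 ∷ []) ∷ [])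
  (#0 ∷ #1 ∷ #2 ∷ #3 ∷ []) (#0 ∷ #1 ∷ #3 ∷ #2 ∷ []) #0 #1 tt

module _ {m : ℕ} where

  prime-bound-2 : WordBound 2 m
  prime-bound-2 = field-bound (prime-index λ U w u → λ where
      #0 → resp U (λ j x → sym (trans (cong (_+ᶠ x) (zeroˡ (w j))) (τ-0 x))) (mem-ε U)
      #1 → resp U (translate-cong λ j → sym (*ᶠ-identityˡ (w j))) u)
    where
    open Field F₂
    open Translations F₂ {m}
    open FieldBound F₂ {m}

  prime-bound-3 : WordBound 3 m
  prime-bound-3 = field-bound (prime-index λ U w u → λ where
      #0 → resp U (λ j x → sym (trans (cong (_+ᶠ x) (zeroˡ (w j))) (τ-0 x))) (mem-ε U)
      #1 → resp U (translate-cong λ j → sym (*ᶠ-identityˡ (w j))) u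
      #2 → resp U (λ j x → sym (trans (cong (_+ᶠ x) (double (w j))) (τ-+ (w j) (w j) x))) (mem-∙ U u u))
    where
    open Field F₃
    open Translations F₃ {m}
    open FieldBound F₃ {m}
    double : ∀ a → #2 *ᶠ a ≡ a +ᶠ a
    double #0 = refl
    double #1 = refl
    double #2 = refl

-- The index of subgroups of powers of S₄

pigeonhole-prod : ∀ {m} {a : Fin m → ℕ} {I : Set} (f : I → ∀ j → Fin (a j)) is →
  AllPairs (λ i j → Differ {a = a} (f i) (f j)) is → length is ≤ prod a
pigeonhole-prod {zero} f []            _ = z≤n
pigeonhole-prod {zero} f (i ∷ [])      _ = ≤-refl
pigeonhole-prod {zero} f (i ∷ j ∷ is) (((() , _) ∷ _) ∷ _)
pigeonhole-prod {suc m} {a} {I} f is differ =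
  ≤-trans (≤-reflexive (sum-fibres key is)) (≤-trans (sum-mono fibre≤) (≤-reflexive (sum-const (a zero))))
  where
  key : I → Fin (a zero)
  key i = f i zero
  c = prod (a ∘ suc)
  sum-const : ∀ r → sum {r} (λ _ → c) ≡ r * c
  sum-const zero    = refl
  sum-const (suc r) = cong (c +_) (sum-const r)
  fibre≤ : ∀ k → length (fibre key k is) ≤ c
  fibre≤ k = subst (_≤ c) (length-toList in-fibre)
    (pigeonhole-prod (λ (i , _) j → f i (suc j)) (All.toList in-fibre)
      (AllPairs.map (λ { {i , eq} {j , eq′} (zero , ≢) → contradiction (trans eq (sym eq′)) ≢ ; (suc x , ≢) → x , ≢ })
        (allPairs-toList in-fibre (AllPairs.filter⁺ (λ i → key i Fin.≟ k) differ))))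
    where
    in-fibre : All (λ i → key i ≡ k) (fibre key k is)
    in-fibre = All.all-filter (λ i → key i Fin.≟ k) is

module _ {I : Set} {R D : I → I → Set} (R? : ∀ i j → Dec (R i j)) (R-refl : ∀ i → R i i)
  {B : ℕ} (bound : ∀ i is → All (R i) is → AllPairs D is → length is ≤ B) where

  private
    split : ∀ i is → length is ≡ length (filter (R? i) is) + length (filter (¬? ∘ R? i) is)
    split i [] = refl
    split i (j ∷ is) with R? i j
    ... | yes _ = cong suc (split i is)
    ... | no  _ = trans (cong suc (split i is)) (sym (+-suc _ _))

    classes : ∀ N is → length is ≤ N → AllPairs D is →
      ∃ λ ks → AllPairs (λ i j → ¬ R i j) ks × length is ≤ length ks * B × (∀ {P : I → Set} → All P is → All P ks)
    classes N [] _ _ = [] , [] , z≤n , λ _ → []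
    classes (suc N) (i ∷ is) (s≤s le) ds@(d ∷ ds′) with ks , apart , total , within ←
        classes N (filter (¬? ∘ R? i) is)
          (≤-trans (≤-trans (m≤n+m _ _) (≤-reflexive (sym (split i is)))) le) (AllPairs.filter⁺ (¬? ∘ R? i) ds′) =
      i ∷ ks , within (All.all-filter (¬? ∘ R? i) is) ∷ apart ,
      ≤-trans (≤-reflexive (cong suc (split i is))) (+-mono-≤ class≤ total) ,
      λ { (p ∷ ps) → p ∷ within (All.filter⁺ (¬? ∘ R? i) ps) }
      where
      class≤ : suc (length (filter (R? i) is)) ≤ B
      class≤ = bound i (i ∷ filter (R? i) is) (R-refl i ∷ All.all-filter (R? i) is)
        (All.filter⁺ (R? i) d ∷ AllPairs.filter⁺ (R? i) ds′)

  representatives : ∀ is → AllPairs D is → ∃ λ ks → AllPairs (λ i j → ¬ R i j) ks × length is ≤ length ks * B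
  representatives is ds with ks , apart , total , _ ← classes (length is) is ≤-refl ds = ks , apart , total

open Field F₄

-- S₄ acts on F₄ by affine maps over the field with two elements; lin π is
-- the linear part of π.
lin : Permutation′ 4 → Fin 4 → Fin 4
lin π a = (π ⟨$⟩ʳ a) +ᶠ (π ⟨$⟩ʳ #0)

table : Permutation′ 4 → Vec (Fin 4) 4
table π = (π ⟨$⟩ʳ #0) ∷ (π ⟨$⟩ʳ #1) ∷ (π ⟨$⟩ʳ #2) ∷ (π ⟨$⟩ʳ #3) ∷ []

lookup-table : ∀ π x → lookup (table π) x ≡ π ⟨$⟩ʳ x
lookup-table π #0 = refl
lookup-table π #1 = refl
lookup-table π #2 = refl
lookup-table π #3 = refl

Clash : (p q r s : Fin 4) → Set
Clash p q r s = p ≡ q ⊎ p ≡ r ⊎ p ≡ s ⊎ q ≡ r ⊎ q ≡ s ⊎ r ≡ s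

module _ (Q : Vec (Fin 4) 4 → Set) (Q? : ∀ v → Dec (Q v)) where

  -- Properties of permutations of four points are checked on all 4⁴ value tables, where `Clash`
  -- excuses those that are not injective.
  for-permutations? : Dec (∀ p q r s → Clash p q r s ⊎ Q (p ∷ q ∷ r ∷ s ∷ []))
  for-permutations? = Fin.all? λ p → Fin.all? λ q → Fin.all? λ r → Fin.all? λ s →
    ((p Fin.≟ q) ⊎-dec (p Fin.≟ r) ⊎-dec (p Fin.≟ s) ⊎-dec (q Fin.≟ r) ⊎-dec (q Fin.≟ s) ⊎-dec (r Fin.≟ s))
      ⊎-dec Q? (p ∷ q ∷ r ∷ s ∷ [])

  for-permutations : True for-permutations? → ∀ π → Q (table π)
  for-permutations ok π = Data.Sum.[ (λ clash → contradiction clash no-clash) , id ] (toWitness ok _ _ _ _)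
    where
    no-clash : ¬ Clash (π ⟨$⟩ʳ #0) (π ⟨$⟩ʳ #1) (π ⟨$⟩ʳ #2) (π ⟨$⟩ʳ #3)
    no-clash (inj₁ e) with () ← perm-injective π e
    no-clash (inj₂ (inj₁ e)) with () ← perm-injective π e
    no-clash (inj₂ (inj₂ (inj₁ e))) with () ← perm-injective π e
    no-clash (inj₂ (inj₂ (inj₂ (inj₁ e)))) with () ← perm-injective π e
    no-clash (inj₂ (inj₂ (inj₂ (inj₂ (inj₁ e))))) with () ← perm-injective π e
    no-clash (inj₂ (inj₂ (inj₂ (inj₂ (inj₂ e))))) with () ← perm-injective π e

affine : ∀ π a b → π ⟨$⟩ʳ (a +ᶠ b) ≡ lin π a +ᶠ (π ⟨$⟩ʳ b)
affine π a b = trans (sym (lookup-table π (a +ᶠ b))) (trans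
  (for-permutations (λ v → ∀ a b → lookup v (a +ᶠ b) ≡ (lookup v a +ᶠ lookup v #0) +ᶠ lookup v b)
    (λ v → Fin.all? λ a → Fin.all? λ b → lookup v (a +ᶠ b) Fin.≟ (lookup v a +ᶠ lookup v #0) +ᶠ lookup v b) tt π a b)
  (cong₂ (λ x y → (x +ᶠ (π ⟨$⟩ʳ #0)) +ᶠ y) (lookup-table π a) (lookup-table π b)))

+-self : ∀ a → a +ᶠ a ≡ #0
+-self #0 = refl
+-self #1 = refl
+-self #2 = refl
+-self #3 = refl

lin-+ : ∀ π a b → lin π (a +ᶠ b) ≡ lin π a +ᶠ lin π b
lin-+ π a b = trans (cong (_+ᶠ (π ⟨$⟩ʳ #0)) (affine π a b)) (+ᶠ-assoc (lin π a) (π ⟨$⟩ʳ b) (π ⟨$⟩ʳ #0))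

-- The image of lin π - 1 has at most two elements.
Reflection : Vec (Fin 4) 4 → Set
Reflection v = ∃ λ b → ∀ a → (lookup v a +ᶠ lookup v #0) +ᶠ a ≡ #0 ⊎ (lookup v a +ᶠ lookup v #0) +ᶠ a ≡ b

reflection? : ∀ v → Dec (Reflection v)
reflection? v = Fin.any? λ b → Fin.all? λ a →
  ((lookup v a +ᶠ lookup v #0) +ᶠ a Fin.≟ #0) ⊎-dec ((lookup v a +ᶠ lookup v #0) +ᶠ a Fin.≟ b)

reflection-range : ∀ π → Reflection (table π) → ∃ λ b → ∀ a → lin π a +ᶠ a ∈ #0 ∷ b ∷ []
reflection-range π (b , range) = b , λ a → subst (λ y → (y +ᶠ (π ⟨$⟩ʳ #0)) +ᶠ a ∈ #0 ∷ b ∷ []) (lookup-table π a) (member (range a))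
  where
  member : ∀ {y} → y ≡ #0 ⊎ y ≡ b → y ∈ #0 ∷ b ∷ []
  member (inj₁ eq) = here eq
  member (inj₂ eq) = there (here eq)

ω : Permutation′ 4
ω = Perm.permutation (#2 *ᶠ_) (#3 *ᶠ_)
  (λ { #0 → refl ; #1 → refl ; #2 → refl ; #3 → refl }) (λ { #0 → refl ; #1 → refl ; #2 → refl ; #3 → refl })

-- Pairwise distinct modulo the Klein four-group: the identity, a reflection, a rotation and their
-- product. In `correct` they become representatives of four cosets.
four : Fin 4 → Permutation′ 4
four #0 = Perm.id
four #1 = Perm.transpose #0 #1
four #2 = ω
four #3 = ω ⊙ Perm.transpose #0 #1

table-⊙ : ∀ γ ρ → DVec.map (lookup (table γ)) (table ρ) ≡ table (γ ⊙ ρ)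
table-⊙ γ ρ rewrite lookup-table γ (ρ ⟨$⟩ʳ #0) | lookup-table γ (ρ ⟨$⟩ʳ #1)
                  | lookup-table γ (ρ ⟨$⟩ʳ #2) | lookup-table γ (ρ ⟨$⟩ʳ #3) = refl

private
  quotient : Fin 4 → Fin 4 → Permutation′ 4
  quotient i j = four i ⁻ ⊙ four j

  SomeReflection : Vec (Fin 4) 4 → Set
  SomeReflection v = ∀ i j → i ≡ j ⊎ Reflection v ⊎ Reflection (DVec.map (lookup v) (table (quotient i j))) ⊎
                     Reflection (DVec.map (lookup v) (table (quotient i j ⊙ quotient i j)))

  someReflection? : ∀ v → Dec (SomeReflection v)
  someReflection? v = Fin.all? λ i → Fin.all? λ j → (i Fin.≟ j) ⊎-dec reflection? v ⊎-dec
    reflection? (DVec.map (lookup v) (table (quotient i j))) ⊎-dec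
    reflection? (DVec.map (lookup v) (table (quotient i j ⊙ quotient i j)))

-- If γ, γ r and γ r² all have order 3 modulo the Klein four-group, then r is
-- trivial modulo it.
some-reflection : ∀ i j → i ≢ j → ∀ γ → let r = four i ⁻ ⊙ four j in
  Reflection (table γ) ⊎ Reflection (table (γ ⊙ r)) ⊎ Reflection (table (γ ⊙ (r ⊙ r)))
some-reflection i j i≢j γ = convert (for-permutations SomeReflection someReflection? tt γ i j)
  where
  convert : i ≡ j ⊎ Reflection (table γ) ⊎ Reflection (DVec.map (lookup (table γ)) (table (quotient i j))) ⊎
            Reflection (DVec.map (lookup (table γ)) (table (quotient i j ⊙ quotient i j))) → _
  convert (inj₁ i≡j) = contradiction i≡j i≢j
  convert (inj₂ (inj₁ p)) = inj₁ p
  convert (inj₂ (inj₂ (inj₁ p))) = inj₂ (inj₁ (subst Reflection (table-⊙ γ (quotient i j)) p))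
  convert (inj₂ (inj₂ (inj₂ p))) = inj₂ (inj₂ (subst Reflection (table-⊙ γ (quotient i j ⊙ quotient i j)) p))

-- A subgroup of S₄ has at least as many cosets as lin ρ - 1 has values, for
-- some ρ with π ρ in the subgroup.
record Correction (R : PermSubgroup 4) (π : Permutation′ 4) : Set where
  open PermSubgroup R
  field
    ρ      : Permutation′ 4
    member : has (π ⊙ ρ)
    range  : List (Fin 4)
    lin∈   : ∀ a → lin ρ a +ᶠ a ∈ range
    cosets : List (Permutation′ 4)
    enough : length range ≤ length cosets
    apart  : AllPairs (λ x y → ¬ has (x ⁻ ⊙ y)) cosets

correct : ∀ R π → ¬ ¬ Correction R π
correct R π =
  ¬¬-excluded-middle >>= λ inside? →
  ¬¬-excluded-middle >>= λ reflection? →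
  pure (cases inside? reflection?)
  where
  open PermSubgroup R
  cases : Dec (has π) → Dec (∃ λ ρ → has (π ⊙ ρ) × Reflection (table ρ)) → Correction R π
  cases (yes hπ) _ = record
    { ρ = Perm.id ; member = has-≈ (λ _ → refl) hπ ; range = #0 ∷ []
    ; lin∈ = λ a → here (trans (cong (_+ᶠ a) (+ᶠ-identityʳ a)) (+-self a))
    ; cosets = Perm.id ∷ [] ; enough = ≤-refl ; apart = [] ∷ [] }
  cases (no ¬hπ) (yes (ρ , h , refl′)) = record
    { ρ = ρ ; member = h ; range = _ ; lin∈ = proj₂ (reflection-range ρ refl′)
    ; cosets = Perm.id ∷ π ∷ [] ; enough = ≤-refl
    ; apart = ((λ h′ → ¬hπ (has-≈ (λ _ → refl) h′)) ∷ []) ∷ [] ∷ [] }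
  cases (no _) (no none) = record
    { ρ = π ⁻ ; member = has-≈ (λ x → sym (Perm.inverseʳ π)) has-id
    ; range = List.allFin 4 ; lin∈ = λ a → ∈-allFin (lin (π ⁻) a +ᶠ a)
    ; cosets = List.tabulate four ; enough = ≤-refl
    ; apart = AllPairs.tabulate⁺ {f = four} λ {i} {j} i≢j h → Data.Sum.[
        (λ p → none (π ⁻ , has-≈ (λ x → sym (Perm.inverseʳ π)) has-id , p)) , Data.Sum.[
        (λ p → none (π ⁻ ⊙ (four i ⁻ ⊙ four j) , has-≈ (λ x → sym (Perm.inverseʳ π)) h , p)) ,
        (λ p → none (π ⁻ ⊙ ((four i ⁻ ⊙ four j) ⊙ (four i ⁻ ⊙ four j)) ,
                       has-≈ (λ x → sym (Perm.inverseʳ π)) (has-⊙ h h) , p)) ] ]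
        (some-reflection i j i≢j (π ⁻)) }

consᵗ : Permutation′ n → Tuple n m → Tuple n (suc m)
consᵗ π g zero    = π
consᵗ π g (suc j) = g j

head-subgroup : Subgroup n (suc m) → PermSubgroup n
head-subgroup U = record
  { has     = λ π → ∃ λ g → mem U g × g zero ≈ π
  ; has-≈   = λ { π≈ρ (g , u , eq) → g , u , λ x → trans (eq x) (π≈ρ x) }
  ; has-id  = ε , mem-ε U , λ _ → refl
  ; has-⊙   = λ { {π} (g , u , eq) (h , v , eq′) → g ∙ h , mem-∙ U u v , λ x → trans (eq _) (cong (π ⟨$⟩ʳ_) (eq′ x)) }
  ; has-inv = λ { {π} (g , u , eq) → inv g , mem-inv U u , ≈⇒≈ˡ (g zero) π eq } }

tail-subgroup : Subgroup n (suc m) → Subgroup n m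
tail-subgroup {n} {m} U = record
  { mem     = λ g → mem U (consᵗ Perm.id g)
  ; resp    = λ {g} {h} g≋h → resp U {consᵗ Perm.id g} {consᵗ Perm.id h} λ { zero _ → refl ; (suc j) → g≋h j }
  ; mem-ε   = resp U {ε} {consᵗ Perm.id ε} (λ { zero _ → refl ; (suc j) _ → refl }) (mem-ε U)
  ; mem-∙   = λ {g} {h} u v → resp U {consᵗ Perm.id g ∙ consᵗ Perm.id h} {consᵗ Perm.id (g ∙ h)}
      (λ { zero _ → refl ; (suc j) _ → refl }) (mem-∙ U u v)
  ; mem-inv = λ {g} u → resp U {inv (consᵗ Perm.id g)} {consᵗ Perm.id (inv g)}
      (λ { zero _ → refl ; (suc j) _ → refl }) (mem-inv U u) }

record Corrections {m} (U : Subgroup 4 m) (h : Tuple 4 m) : Set where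
  field
    ρ      : Tuple 4 m
    member : mem U (h ∙ ρ)
    range  : Fin m → List (Fin 4)
    lin∈   : ∀ j a → lin (ρ j) a +ᶠ a ∈ range j
    cosets : List (Tuple 4 m)
    enough : prod (length ∘ range) ≤ length cosets
    apart  : AllPairs (Apart U) cosets

corrections : ∀ {m} (U : Subgroup 4 m) h → ¬ ¬ Corrections U h
corrections {zero} U h = pure record
  { ρ = ε ; member = resp U {ε} {h ∙ ε} (λ ()) (mem-ε U) ; range = λ () ; lin∈ = λ ()
  ; cosets = ε ∷ [] ; enough = ≤-refl ; apart = [] ∷ [] }
corrections {suc m} U h =
  correct (head-subgroup U) (h zero) >>= λ C →
  let g , g∈ , g₀ = Correction.member C in
  -- `g` has the desired first entry but arbitrary others. A correction `σ` of `g⁻¹ h` in the tail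
  -- subgroup turns `g` into `g (g⁻¹ h σ) = h σ` there.
  corrections (tail-subgroup U) (λ j → g (suc j) ⁻ ⊙ h (suc j)) >>= λ D →
  pure (combine C g g∈ g₀ D)
  where
  combine : (C : Correction (head-subgroup U) (h zero)) (g : Tuple 4 (suc m)) → mem U g → g zero ≈ h zero ⊙ Correction.ρ C →
            Corrections (tail-subgroup U) (λ j → g (suc j) ⁻ ⊙ h (suc j)) → Corrections U h
  combine C g g∈ g₀ D = record
    { ρ = ρ ; member = resp U {g ∙ consᵗ Perm.id _} {h ∙ ρ}
        (λ { zero → g₀ ; (suc j) x → Perm.inverseʳ (g (suc j)) }) (mem-∙ U g∈ D.member)
    ; range = λ { zero → C.range ; (suc j) → D.range j }
    ; lin∈ = λ { zero → C.lin∈ ; (suc j) → D.lin∈ j }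
    ; cosets = List.cartesianProductWith consᵗ C.cosets D.cosets
    ; enough = ≤-trans (*-mono-≤ C.enough D.enough) (≤-reflexive (sym
        (length-product {R = λ _ _ → ⊤} {S = λ _ _ → ⊤} {T = λ _ _ → ⊤} consᵗ (λ _ _ _ → tt) (λ _ _ → tt) C.cosets D.cosets)))
    ; apart = allPairs-product consᵗ
        (λ x#y f f′ u → x#y (_ , u , λ _ → refl))
        (λ {f} {f′} f#f′ x u → f#f′ (resp U {inv (consᵗ x f) ∙ consᵗ x f′} {consᵗ Perm.id (inv f ∙ f′)}
          (λ { zero y → Perm.inverseˡ x ; (suc j) _ → refl }) u)) C.apart D.apart }
    where
    module C = Correction C
    module D = Corrections D
    ρ : Tuple 4 (suc m)
    ρ = consᵗ C.ρ D.ρ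

module _ {m : ℕ} where
  open Translations F₄ {m}
  open FieldBound F₄ {m}

  -- The product of U with the normal subgroup of all translations.
  saturate : Subgroup 4 m → Subgroup 4 m
  saturate U = record
    { mem     = λ g → ∃ λ w → mem U (g ∙ translate w)
    ; resp    = λ { g≋h (w , u) → w , resp U (λ j x → g≋h j _) u }
    ; mem-ε   = 0ⱽ , resp U (λ j x → sym (τ-0 x)) (mem-ε U)
    ; mem-∙   = λ { {g} {h} (w , u) (v , u′) → (λ j → lin (h j ⁻) (w j) +ᶠ v j) ,
        resp U (λ j x → cong (g j ⟨$⟩ʳ_) (trans (pull (h j) (w j) (v j +ᶠ x))
          (cong (h j ⟨$⟩ʳ_) (sym (+ᶠ-assoc (lin (h j ⁻) (w j)) (v j) x))))) (mem-∙ U u u′) }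
    ; mem-inv = λ { {g} (w , u) → (λ j → lin (g j) (w j)) ,
        resp U (λ j x → trans (cong (λ y → y +ᶠ (g j ⟨$⟩ˡ x)) (sym (char-2 (w j))))
          (trans (sym (Perm.inverseˡ (g j))) (cong (g j ⟨$⟩ˡ_)
            (trans (affine (g j) (w j) (g j ⟨$⟩ˡ x)) (cong (lin (g j) (w j) +ᶠ_) (Perm.inverseʳ (g j))))))) (mem-inv U u) } }
    where
    char-2 : ∀ a → a ≡ -ᶠ a
    char-2 #0 = refl
    char-2 #1 = refl
    char-2 #2 = refl
    char-2 #3 = refl
    pull : ∀ (π : Permutation′ 4) a x → a +ᶠ (π ⟨$⟩ʳ x) ≡ π ⟨$⟩ʳ (lin (π ⁻) a +ᶠ x)
    pull π a x = trans (sym (Perm.inverseʳ π)) (cong (π ⟨$⟩ʳ_)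
      (trans (affine (π ⁻) a (π ⟨$⟩ʳ x)) (cong (lin (π ⁻) a +ᶠ_) (Perm.inverseˡ π))))

  module _ (U : Subgroup 4 m) (C : Corrections (saturate U) (λ _ → ω)) where
    open Corrections C

    W : V → Set
    W w = mem U (translate w)

    W-+ : ∀ {x y} → W x → W y → W (x +ⱽ y)
    W-+ {x} {y} u v = resp U (λ j z → sym (τ-+ (x j) (y j) z)) (mem-∙ U u v)

    -- An element of U acts on W as ω ρ does.
    fixed⇒core : ∀ x → W x → (∀ j → lin (ρ j) (x j) ≡ x j) → core U x
    fixed⇒core x x∈W fixed = λ where
        #0 → resp U (λ j z → sym (trans (cong (_+ᶠ z) (zeroˡ (x j))) (τ-0 z))) (mem-ε U)
        #1 → resp U (translate-cong λ j → sym (*ᶠ-identityˡ (x j))) x∈W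
        #2 → ωx
        #3 → resp U (translate-cong λ j → ω+1 (x j)) (W-+ {#2 ·ⱽ x} {x} ωx x∈W)
      where
      ω+1 : ∀ a → #2 *ᶠ a +ᶠ a ≡ #3 *ᶠ a
      ω+1 #0 = refl
      ω+1 #1 = refl
      ω+1 #2 = refl
      ω+1 #3 = refl
      ωx : W (#2 ·ⱽ x)
      ωx = scale-conjugate F₄ U #2 ω (λ _ → refl) ρ (proj₁ member) x
        (λ j y → trans (affine (ρ j) (x j) y) (cong (_+ᶠ (ρ j ⟨$⟩ʳ y)) (fixed j))) (proj₂ member) x∈W

    -- On a coset of W the values of lin ρ - 1 determine the coset of core U.
    class-bound : ∀ {I : Set} (v : I → V) d is → All (λ i → W (-ⱽ v d +ⱽ v i)) is →
      AllPairs (λ i j → Distinct (core U) (v i) (v j)) is → length is ≤ prod (length ∘ range)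
    class-bound {I} v d is inW apart′ = pigeonhole-prod key is (differ inW apart′)
      where
      rel-d : I → V
      rel-d i = -ⱽ v d +ⱽ v i
      key : I → ∀ j → Fin (length (range j))
      key i j = Any.index (lin∈ j (rel-d i j))
      sum-of-equal : ∀ s t a b → s +ᶠ a ≡ t +ᶠ b → s +ᶠ t ≡ a +ᶠ b
      sum-of-equal = toWitness {a? = Fin.all? λ s → Fin.all? λ t → Fin.all? λ a → Fin.all? λ b →
        (s +ᶠ a Fin.≟ t +ᶠ b) →-dec (s +ᶠ t Fin.≟ a +ᶠ b)} tt
      difference : ∀ d p q → (-ᶠ d +ᶠ p) +ᶠ (-ᶠ d +ᶠ q) ≡ -ᶠ p +ᶠ q
      difference = toWitness {a? = Fin.all? λ d → Fin.all? λ p → Fin.all? λ q →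
        (-ᶠ d +ᶠ p) +ᶠ (-ᶠ d +ᶠ q) Fin.≟ -ᶠ p +ᶠ q} tt
      same-value : ∀ i k j → key i j ≡ key k j → lin (ρ j) (rel-d i j) +ᶠ rel-d i j ≡ lin (ρ j) (rel-d k j) +ᶠ rel-d k j
      same-value i k j eq = trans (lookup-index (lin∈ j (rel-d i j)))
        (trans (cong (List.lookup (range j)) eq) (sym (lookup-index (lin∈ j (rel-d k j)))))
      separated : ∀ i k → W (rel-d i) → W (rel-d k) → Distinct (core U) (v i) (v k) → Differ {a = length ∘ range} (key i) (key k)
      separated i k wi wk i#k with Fin.any? (λ j → ¬? (key i j Fin.≟ key k j))
      ... | yes found = found
      ... | no none = contradiction (resp-≗ (core-subspace U) (λ j → difference (v d j) (v i j) (v k j))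
              (fixed⇒core (rel-d i +ⱽ rel-d k) (W-+ {rel-d i} {rel-d k} wi wk) λ j →
                trans (lin-+ (ρ j) (rel-d i j) (rel-d k j))
                  (sum-of-equal (lin (ρ j) (rel-d i j)) (lin (ρ j) (rel-d k j)) (rel-d i j) (rel-d k j) (same-value i k j
                    (decidable-stable (key i j Fin.≟ key k j) λ ≢ → none (j , ≢)))))) i#k
      differ : ∀ {is} → All (λ i → W (rel-d i)) is → AllPairs (λ i j → Distinct (core U) (v i) (v j)) is →
               AllPairs (λ i j → Differ {a = length ∘ range} (key i) (key j)) is
      differ []       []       = []
      differ (w ∷ ws) (d ∷ ds) = All.zipWith (λ (w′ , i#k) → separated _ _ w w′ i#k) (ws , d) ∷ differ ws ds

  -- Cosets of `saturate U` multiply with classes of translations modulo those in `U`. One such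
  -- class holds at most the product of the range sizes of vectors distinct modulo `core U`, and the
  -- corrections provide at least that many cosets of `saturate U`, so all `4 ^ length es`
  -- combinations are accounted for.
  index-4 : ∀ U es → Indep (core U) es → ¬ ¬ Index≥ U (4 ^ length es)
  index-4 U es ind =
    corrections (saturate U) (λ _ → ω) >>= λ C →
    ¬¬-Fin (λ i → ¬¬-excluded-middle {A = mem U (translate (Fin.finToFun {4} {m} i))}) >>= λ W? →
    pure (bound C W?)
    where
    bound : Corrections (saturate U) (λ _ → ω) → (∀ i → Dec (mem U (translate (Fin.finToFun {4} {m} i)))) →
            Index≥ U (4 ^ length es)
    bound C W? =
      List.cartesianProductWith shifted C.cosets ks ,
      ≤-trans (≤-reflexive (sym (length-combinations es))) (≤-trans total
        (≤-trans (*-monoʳ-≤ (length ks) C.enough) (≤-reflexive (trans (*-comm (length ks) (length C.cosets))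
          (sym (length-product {R = λ _ _ → ⊤} {S = λ _ _ → ⊤} {T = λ _ _ → ⊤} shifted (λ _ _ _ → tt) (λ _ _ → tt) C.cosets ks)))))) ,
      allPairs-product shifted (λ {q} {q′} → differ₁ {q} {q′}) (λ {p} {p′} → differ₂ {p} {p′}) C.apart apart
      where
      module C = Corrections C
      I = ∃ (Span es)
      R : I → I → Set
      R (x , _) (y , _) = mem U (translate (-ⱽ x +ⱽ y))
      W?′ : ∀ w → Dec (mem U (translate w))
      W?′ w = map′ (resp U (translate-cong (Fin.finToFun-funToFin w)))
        (resp U (translate-cong λ j → sym (Fin.finToFun-funToFin w j))) (W? (Fin.funToFin w))
      classes = representatives {R = R} {D = λ p q → Distinct (core U) (proj₁ p) (proj₁ q)}
        (λ p q → W?′ (-ⱽ proj₁ p +ⱽ proj₁ q))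
        (λ (x , _) → resp U (λ j b → sym (trans (cong (_+ᶠ b) (trans (+ᶠ-comm (-ᶠ x j) (x j)) (+ᶠ-inverseʳ (x j)))) (τ-0 b))) (mem-ε U))
        (class-bound U C proj₁) (combinations es) (combinations-distinct (core-subspace U) es ind)
      ks = proj₁ classes
      apart = proj₁ (proj₂ classes)
      total = proj₂ (proj₂ classes)
      shifted : Tuple 4 m → I → Tuple 4 m
      shifted q (x , _) = q ∙ translate x
      sat = saturate U
      translate∈sat : ∀ x → mem sat (translate x)
      translate∈sat x = -ⱽ x , resp U (λ j b → sym (trans (sym (+ᶠ-assoc (x j) (-ᶠ x j) b))
        (trans (cong (_+ᶠ b) (+ᶠ-inverseʳ (x j))) (τ-0 b)))) (mem-ε U)
      differ₁ : ∀ {q q′} → Apart sat q q′ → ∀ p p′ → Apart U (shifted q p) (shifted q′ p′)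
      differ₁ {q} {q′} q#q′ (x , _) (y , _) u = q#q′ (resp sat {translate x ∙ e ∙ inv (translate y)} {inv q ∙ q′}
          (λ j b → trans (cancelˡ′ (x j) _) (cong (λ z → q j ⟨$⟩ˡ (q′ j ⟨$⟩ʳ z)) (cancelˡ′ (y j) b)))
          (mem-∙ sat {translate x ∙ e} {inv (translate y)}
            (mem-∙ sat {translate x} {e} (translate∈sat x) e∈sat)
            (mem-inv sat {translate y} (translate∈sat y))))
        where
        e : Tuple 4 m
        e = inv (q ∙ translate x) ∙ (q′ ∙ translate y)
        e∈sat : mem sat e
        e∈sat = 0ⱽ , resp U {e} {e ∙ translate 0ⱽ} (λ j b → cong (e j ⟨$⟩ʳ_) (sym (τ-0 b))) u
      differ₂ : ∀ {p p′} → ¬ R p p′ → ∀ q → Apart U (shifted q p) (shifted q p′)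
      differ₂ {x , _} {y , _} ¬r q u = ¬r (resp U (λ j b →
        trans (cong (-ᶠ x j +ᶠ_) (Perm.inverseˡ (q j))) (sym (+ᶠ-assoc (-ᶠ x j) (y j) b))) u)

  bound-4 : WordBound 4 m
  bound-4 = field-bound index-4

-- For `n = 1` the word function is constantly 1 and is computed by a constant leaf of size 0, below
-- the required 1; hence `2 ≤ n`.
wordBound : ∀ n m .{{_ : NonZero n}} → 2 ≤ n → WordBound n m
wordBound 1 m (s≤s ())
wordBound 2 m _ = prime-bound-2
wordBound 3 m _ = prime-bound-3
wordBound 4 m _ = bound-4
wordBound (suc (suc (suc (suc (suc n′))))) m _ = AtLeast5.bound

theorem1p2 : ∀ (n k d : ℕ) .{{_ : NonZero n}} .{{_ : NonZero k}} .{{_ : NonZero d}} →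
    2 ≤ n →
    (min TCSizes (WordSymmetry n k) (Word n k) ≥ n ^ʳ log₂ k)
    × (min TCSizes[depth≤ d ] (WordSymmetry n k) (Word n k) ≥ n ^ʳ (d ⊛[ root d k ∸1]))
theorem1p2 n (suc m) d 2≤n =
  (λ { _ (Φ , inv★ , computes , refl) p q le → decidable-stable (_ ≤? _) λ ¬le →
    wordBound n m 2≤n Φ (λ g → inv★ (act g) (g , λ _ → refl)) computes λ bound →
      ¬le (log-bound bound p q le) }) ,
  (λ { _ (Φ , depth≤ , inv★ , computes , refl) p q le → decidable-stable (_ ≤? _) λ ¬le →
    wordBound n m 2≤n Φ (λ g → inv★ (act g) (g , λ _ → refl)) computes λ bound →
      ¬le (root-bound bound d depth≤ p q le) })
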